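{- Let $(X,d)$ be a geodesic space. Then the following are equivalent: (1) Every unit ball graph on $X$ is (claw, net)-free. (2) $X$ has no tripod. (3) $X$ is homeomorphic to a manifold of dimension at most $1$, that is, $X$ is similar to $S^1$ or isometric to an interval (a convex subset of $\mathbb{R}$).
   Context: All graphs are finite, simple and undirected. Geodesic space: let $(X,d)$ be a metric space. A geodesic from $x$ to $y$ is a distance-preserving map $\gamma\colon[0,d(x,y)]\to X$ with $\gamma(0)=x$, $\gamma(d(x,y))=y$; its image is a geodesic segment with endpoints $x,y$, written $[x,y]$ (not necessarily unique). $(X,d)$ is a geodesic space if every two points are joined by a geodesic. Unit ball graph: a graph $G=(V_G,E_G)$ is a unit ball graph on $(X,d)$ if there exist $\delta>0$ and a map $\rho\colon V_G\to X$ such that for distinct $u,v\in V_G$, $\{u,v\}\in E_G$ if and only if $d(\rho(u),\rho(v))\le\delta$. The claw is the star $K_{1,3}$. The net is the graph on six vertices obtained from a triangle by attaching one pendant vertex to each of its three vertices. A graph is (claw, net)-free if it has no induced subgraph isomorphic to the claw or to the net. Tripod: a subset $Y\subseteq X$ is a tripod if there exist four distinct points $x_1,x_2,x_3,y\in Y$ and geodesic segments $[x_i,y]$ ($i=1,2,3$) such that $Y=[x_1,y]\cup[x_2,y]\cup[x_3,y]$ and $[x_i,y]\cap[x_j,y]=\{y\}$ for $i\ne j$. Metric spaces $X,Y$ are similar if there exist a bijection $f\colon X\to Y$ and $r>0$ with $d_Y(f(a),f(b))=r\,d_X(a,b)$ for all $a,b\in X$; they are isometric if this holds with $r=1$. $S^1$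 is the unit circle with the great-circle (arc length) metric. Manifolds are allowed to have boundary; the meaning of condition (3) is the one given after "that is". -}

module Defs where

open import Algebra.Bundles using (CommutativeRing)
open import Data.Fin.Base as Fin using (Fin; toℕ)
open import Data.Fin.Patterns
open import Data.List.Base using (List; []; _∷_)
open import Data.List.Membership.Propositional using (_∈_)
open import Data.List.Relation.Unary.All as All using (All; []; _∷_)
open import Data.Nat.Base as ℕ using (ℕ; zero; suc)
open import Data.Product.Base using (Σ; ∃; ∃-syntax; _×_; _,_; proj₁; proj₂; uncurry)
open import Data.Sum.Base using (_⊎_; inj₁; inj₂; swap)
open import Function.Base using (_on_; _∘_)
open import Function.Bundles using (Bijection; _⇔_)
open import Function.Definitions using (Injective)
open import Function.Metric.Structures using (IsGeneralMetric)
open import Level as L using (0ℓ)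
open import Relation.Binary.Bundles using (Setoid; TotalOrder)
open import Relation.Binary.Core using (Rel)
open import Relation.Binary.Definitions using (Symmetric; Irreflexive; _Respects_)
open import Relation.Binary.PropositionalEquality.Core using (_≡_; _≢_; refl)
open import Relation.Binary.Structures using (IsTotalOrder)
open import Relation.Nullary using (¬_; contradiction)
open import Relation.Unary using (Pred; Satisfiable)

import Algebra.Construct.NaturalChoice.Max as Max
import Algebra.Construct.NaturalChoice.Min as Min
import Algebra.Definitions.RawMonoid as RawMonoidDefs
import Algebra.Properties.Ring as RingProperties
import Algebra.Properties.CommutativeSemigroup as CommutativeSemigroupProperties
import Relation.Binary.Construct.NonStrictToStrict as Strict
import Relation.Binary.Construct.On as On
import Relation.Binary.Reasoning.PartialOrder as PartialOrderReasoning

record Graph : Set₁ where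
  field
    order  : ℕ
    Adj    : Rel (Fin order) 0ℓ
    sym    : Symmetric Adj
    irrefl : Irreflexive _≡_ Adj

  Vertex : Set
  Vertex = Fin order

fromEdges : ∀ {n} (es : List (Fin n × Fin n)) → All (uncurry _≢_) es → Graph
fromEdges {n} es loopless = record
  { order  = n
  ; Adj    = λ u v → (u , v) ∈ es ⊎ (v , u) ∈ es
  ; sym    = swap
  ; irrefl = λ { refl (inj₁ e) → All.lookup loopless e refl
               ; refl (inj₂ e) → All.lookup loopless e refl }
  }

claw : Graph
claw = fromEdges {4} ((0F , 1F) ∷ (0F , 2F) ∷ (0F , 3F) ∷ [])
                     ((λ ()) ∷ (λ ()) ∷ (λ ()) ∷ [])

net : Graph
net = fromEdges {6}
  ( (0F , 1F) ∷ (1F , 2F) ∷ (2F , 0F)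
  ∷ (0F , 3F) ∷ (1F , 4F) ∷ (2F , 5F) ∷ [])
  ( (λ ()) ∷ (λ ()) ∷ (λ ()) ∷ (λ ()) ∷ (λ ()) ∷ (λ ()) ∷ [])

-- An isomorphism from H onto the subgraph of G induced by the range of
-- the embedding.
record InducedCopy (H G : Graph) : Set where
  private
    module H = Graph H
    module G = Graph G
  field
    embed     : H.Vertex → G.Vertex
    injective : Injective _≡_ _≡_ embed
    induced   : ∀ u v → H.Adj u v ⇔ G.Adj (embed u) (embed v)

ClawNetFree : Graph → Set
ClawNetFree G = ¬ InducedCopy claw G × ¬ InducedCopy net G

-- agda-stdlib has no real numbers, so they are axiomatised as a complete
-- ordered field, which classically is unique up to isomorphism.  Assuming
-- excluded middle, completeness for predicates of level 0 gives it for
-- predicates of every level.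
record Reals : Set₁ where
  infix 4 _≤_
  field
    commutativeRing : CommutativeRing 0ℓ 0ℓ

  open CommutativeRing commutativeRing public
    hiding (_≉_)
    renaming (Carrier to ℝ; setoid to ≈-setoid; sym to ≈-sym; refl to ≈-refl; trans to ≈-trans)

  field
    _≤_          : Rel ℝ 0ℓ
    isTotalOrder : IsTotalOrder _≈_ _≤_
    +-monoˡ-≤    : ∀ z {x y} → x ≤ y → x + z ≤ y + z
    *-nonNeg     : ∀ {x y} → 0# ≤ x → 0# ≤ y → 0# ≤ x * y
    0≉1          : ¬ 0# ≈ 1#
    inverse      : ∀ x → ¬ x ≈ 0# → ∃[ y ] x * y ≈ 1#

  UpperBound : Pred ℝ 0ℓ → ℝ → Set
  UpperBound P u = ∀ x → P x → x ≤ u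

  Supremum : Pred ℝ 0ℓ → ℝ → Set
  Supremum P s = UpperBound P s × (∀ u → UpperBound P u → s ≤ u)

  field
    complete : (P : Pred ℝ 0ℓ) → Satisfiable P → ∃ (UpperBound P) → ∃ (Supremum P)

  totalOrder : TotalOrder 0ℓ 0ℓ 0ℓ
  totalOrder = record { isTotalOrder = isTotalOrder }

  open TotalOrder totalOrder public
    using (poset; isPartialOrder; total; antisym)
    renaming ( reflexive to ≤-reflexive; refl to ≤-refl; trans to ≤-trans
             ; ≤-respˡ-≈ to ≤-respˡ; ≤-respʳ-≈ to ≤-respʳ )
  open Strict _≈_ _≤_ public using (_<_)
  open Min totalOrder public
    using (_⊓_; ⊓-sel; ⊓-cong; x⊓y≤x; x⊓y≤y; ⊓-glb)
  open Max totalOrder public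
    using (_⊔_; ⊔-sel; ⊔-cong; ⊔-comm; ⊔-lub; x≤x⊔y; x≤y⊔x)
  open RawMonoidDefs +-rawMonoid public using (sum) renaming (_×_ to _·_)

  infix 8 ∣_∣
  ∣_∣ : ℝ → ℝ
  ∣ x ∣ = x ⊔ (- x)

  open RingProperties ring public using (-1*x≈-x; -‿involutive; -‿+-comm; -0#≈0#; -‿distribˡ-*; -‿distribʳ-*)
  open CommutativeSemigroupProperties
    (CommutativeRing.+-commutativeSemigroup commutativeRing) public
    using (interchange; x∙yz≈y∙xz)
  open PartialOrderReasoning poset

  +-mono-≤ : ∀ {x y u v} → x ≤ y → u ≤ v → x + u ≤ y + v
  +-mono-≤ {x} {y} {u} {v} x≤y u≤v = begin
    x + u ≤⟨ +-monoˡ-≤ u x≤y ⟩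
    y + u ≈⟨ +-comm y u ⟩
    u + y ≤⟨ +-monoˡ-≤ y u≤v ⟩
    v + y ≈⟨ +-comm v y ⟩
    y + v ∎

  cancel : ∀ x z → (x + z) + - z ≈ x
  cancel x z = ≈-trans (+-assoc x z (- z))
               (≈-trans (+-cong ≈-refl (-‿inverseʳ z)) (+-identityʳ x))

  cancel′ : ∀ x z → (x + - z) + z ≈ x
  cancel′ x z = ≈-trans (+-assoc x (- z) z)
                (≈-trans (+-cong ≈-refl (-‿inverseˡ z)) (+-identityʳ x))

  +-cancelʳ-≤ : ∀ z {x y} → x + z ≤ y + z → x ≤ y
  +-cancelʳ-≤ z {x} {y} p = begin
    x             ≈⟨ cancel x z ⟨
    (x + z) + - z ≤⟨ +-monoˡ-≤ (- z) p ⟩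
    (y + z) + - z ≈⟨ cancel y z ⟩
    y             ∎

  x≤y+z⇒x-z≤y : ∀ {x y z} → x ≤ y + z → x + - z ≤ y
  x≤y+z⇒x-z≤y {x} {y} {z} p = +-cancelʳ-≤ z (≤-respˡ (≈-sym (cancel′ x z)) p)

  x+z≤y⇒x≤y-z : ∀ {x y z} → x + z ≤ y → x ≤ y + - z
  x+z≤y⇒x≤y-z {x} {y} {z} p = +-cancelʳ-≤ z (≤-respʳ (≈-sym (cancel′ y z)) p)

  x≤y⇒0≤y-x : ∀ {x y} → x ≤ y → 0# ≤ y + - x
  x≤y⇒0≤y-x {x} {y} p = x+z≤y⇒x≤y-z (≤-respˡ (≈-sym (+-identityˡ x)) p)

  x≤0⇒0≤-x : ∀ {x} → x ≤ 0# → 0# ≤ - x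
  x≤0⇒0≤-x {x} p = ≤-respʳ (+-identityˡ (- x)) (x≤y⇒0≤y-x p)

  neg-sub : ∀ x y → - (x + - y) ≈ y + - x
  neg-sub x y = ≈-trans (≈-sym (-‿+-comm x (- y)))
                (≈-trans (+-cong ≈-refl (-‿involutive y)) (+-comm (- x) y))

  telescope : ∀ x y z → (x + - y) + (y + - z) ≈ x + - z
  telescope x y z = ≈-trans (≈-sym (+-assoc _ y (- z))) (+-cong (cancel′ x y) ≈-refl)

  x≤∣x∣ : ∀ x → x ≤ ∣ x ∣
  x≤∣x∣ x = x≤x⊔y x (- x)

  -x≤∣x∣ : ∀ x → - x ≤ ∣ x ∣
  -x≤∣x∣ x = x≤y⊔x x (- x)

  ∣∣-nonNeg : ∀ x → 0# ≤ ∣ x ∣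
  ∣∣-nonNeg x with total 0# x
  ... | inj₁ 0≤x = ≤-trans 0≤x (x≤∣x∣ x)
  ... | inj₂ x≤0 = ≤-trans (x≤0⇒0≤-x x≤0) (-x≤∣x∣ x)

  ∣∣-cong : ∀ {x y} → x ≈ y → ∣ x ∣ ≈ ∣ y ∣
  ∣∣-cong x≈y = ⊔-cong x≈y (-‿cong x≈y)

  ∣0∣≈0 : ∣ 0# ∣ ≈ 0#
  ∣0∣≈0 = antisym (⊔-lub ≤-refl (≤-reflexive -0#≈0#)) (∣∣-nonNeg 0#)

  ∣x∣≈0⇒x≈0 : ∀ {x} → ∣ x ∣ ≈ 0# → x ≈ 0#
  ∣x∣≈0⇒x≈0 {x} p = antisym (≤-respʳ p (x≤∣x∣ x))
    (≤-respʳ (-‿involutive x) (x≤0⇒0≤-x (≤-respʳ p (-x≤∣x∣ x))))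

  ∣-x∣≈∣x∣ : ∀ x → ∣ - x ∣ ≈ ∣ x ∣
  ∣-x∣≈∣x∣ x = ≈-trans (⊔-cong ≈-refl (-‿involutive x)) (⊔-comm (- x) x)

  ∣x+y∣≤∣x∣+∣y∣ : ∀ x y → ∣ x + y ∣ ≤ ∣ x ∣ + ∣ y ∣
  ∣x+y∣≤∣x∣+∣y∣ x y = ⊔-lub (+-mono-≤ (x≤∣x∣ x) (x≤∣x∣ y))
    (≤-respˡ (-‿+-comm x y) (+-mono-≤ (-x≤∣x∣ x) (-x≤∣x∣ y)))

  dist : ℝ → ℝ → ℝ
  dist x y = ∣ x + - y ∣

  dist-sym : ∀ x y → dist x y ≈ dist y x
  dist-sym x y = ≈-trans (∣∣-cong (≈-sym (neg-sub y x))) (∣-x∣≈∣x∣ (y + - x))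

  dist-triangle : ∀ x y z → dist x z ≤ dist x y + dist y z
  dist-triangle x y z = ≤-respˡ (∣∣-cong (telescope x y z)) (∣x+y∣≤∣x∣+∣y∣ _ _)

  dist-cong : ∀ {x y u v} → x ≈ y → u ≈ v → dist x u ≈ dist y v
  dist-cong x≈y u≈v = ∣∣-cong (+-cong x≈y (-‿cong u≈v))

  ≈⇒dist≈0 : ∀ {x y} → x ≈ y → dist x y ≈ 0#
  ≈⇒dist≈0 {x} {y} x≈y = ≈-trans
    (∣∣-cong (≈-trans (+-cong x≈y ≈-refl) (-‿inverseʳ y))) ∣0∣≈0

  dist≈0⇒≈ : ∀ {x y} → dist x y ≈ 0# → x ≈ y
  dist≈0⇒≈ {x} {y} p = ≈-trans (≈-sym (cancel′ x y))
    (≈-trans (+-cong (∣x∣≈0⇒x≈0 p) ≈-refl) (+-identityˡ y))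

  -- [0, L) with its ends glued: a circle of circumference L.

  module Loop (L : ℝ) where

    Point : Set
    Point = ∃[ s ] 0# ≤ s × s < L

    arcDist : Point → Point → ℝ
    arcDist (s , _) (t , _) = dist s t ⊓ (L + - dist s t)

    sub≤L : ((s , _) (t , _) : Point) → s + - t ≤ L
    sub≤L (s , _ , s<L) (t , 0≤t , _) = x≤y+z⇒x-z≤y
      (≤-trans (proj₁ s<L) (≤-respˡ (+-identityʳ L) (+-mono-≤ ≤-refl 0≤t)))

    dist≤L : ((s , _) (t , _) : Point) → dist s t ≤ L
    dist≤L x@(s , _) y@(t , _) = ⊔-lub (sub≤L x y) (≤-respˡ (≈-sym (neg-sub s t)) (sub≤L y x))

    perimeter : ((s , _) (t , _) (u , _) : Point) →
                dist s u + (dist s t + dist t u) ≤ L + L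
    perimeter x@(s , _) y@(t , _) z@(u , _)
      with ⊔-sel (s + - t) (- (s + - t)) | ⊔-sel (t + - u) (- (t + - u))
    ... | inj₁ p | inj₁ q = +-mono-≤ (dist≤L x z)
            (≤-respˡ (≈-sym (≈-trans (+-cong p q) (telescope s t u))) (sub≤L x z))
    ... | inj₂ p | inj₂ q = +-mono-≤ (dist≤L x z)
            (≤-respˡ (≈-sym (≈-trans (+-cong (≈-trans p (neg-sub s t)) (≈-trans q (neg-sub t u)))
                              (≈-trans (+-comm _ _) (telescope u t s)))) (sub≤L z x))
    ... | inj₁ p | inj₂ q with ⊔-sel (s + - u) (- (s + - u))
    ...   | inj₁ r = ≤-respˡ (x∙yz≈y∙xz _ _ _) (+-mono-≤ (dist≤L x y)
            (≤-respˡ (≈-sym (≈-trans (+-cong r (≈-trans q (neg-sub t u))) (telescope s u t)))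
              (sub≤L x y)))
    ...   | inj₂ r = ≤-respˡ (+-assoc _ _ _) (+-mono-≤
            (≤-respˡ (≈-sym (≈-trans (+-cong (≈-trans r (neg-sub s u)) p) (telescope u s t)))
              (sub≤L z y))
            (dist≤L y z))
    perimeter x@(s , _) y@(t , _) z@(u , _) | inj₂ p | inj₁ q
      with ⊔-sel (s + - u) (- (s + - u))
    ...   | inj₁ r = ≤-respˡ (+-assoc _ _ _) (+-mono-≤
            (≤-respˡ (≈-sym (≈-trans (+-cong r (≈-trans p (neg-sub s t)))
                              (≈-trans (+-comm _ _) (telescope t s u))))
              (sub≤L y z))
            (dist≤L y z))
    ...   | inj₂ r = ≤-respˡ (x∙yz≈y∙xz _ _ _) (+-mono-≤ (dist≤L x y)
            (≤-respˡ (≈-sym (≈-trans (+-cong (≈-trans r (neg-sub s u)) q)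
                              (≈-trans (+-comm _ _) (telescope t u s))))
              (sub≤L y x)))

    swing : ∀ {a b c} → b ≤ a + c → L + - c ≤ a + (L + - b)
    swing {a} {b} {c} p = begin
      L + - c         ≤⟨ x+z≤y⇒x≤y-z (begin
          L + - c + b         ≤⟨ +-mono-≤ ≤-refl p ⟩
          L + - c + (a + c)   ≈⟨ x∙yz≈y∙xz _ _ _ ⟩
          a + (L + - c + c)   ≈⟨ +-cong ≈-refl (cancel′ L c) ⟩
          a + L               ∎) ⟩
      a + L + - b     ≈⟨ +-assoc a L (- b) ⟩
      a + (L + - b)   ∎

    full≉L : ((s , _) (t , _) : Point) → ¬ s + - t ≈ L
    full≉L (s , _ , s≤L , s≉L) (t , 0≤t , _) p = s≉L (antisym s≤L
      (≤-respˡ p (x≤y+z⇒x-z≤y (≤-respˡ (+-identityʳ s) (+-mono-≤ ≤-refl 0≤t)))))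

    full≈L : ∀ {m a u} → m ≈ 0# → m ≈ L + - a → a ≈ u → u ≈ L
    full≈L {m} {a} {u} p q r = ≈-trans (≈-sym r) (≈-trans (≈-sym (+-identityˡ a))
      (≈-trans (+-cong (≈-trans (≈-sym p) q) ≈-refl) (cancel′ L a)))

    arcDist-nonNeg : ∀ x y → 0# ≤ arcDist x y
    arcDist-nonNeg x y = ⊓-glb (∣∣-nonNeg _) (x≤y⇒0≤y-x (dist≤L x y))

    arcDist-cong : ∀ {x y u v : Point} → proj₁ x ≈ proj₁ y → proj₁ u ≈ proj₁ v →
                   arcDist x u ≈ arcDist y v
    arcDist-cong p q = ⊓-cong (dist-cong p q) (+-cong ≈-refl (-‿cong (dist-cong p q)))

    ≈⇒arcDist≈0 : ∀ {x y : Point} → proj₁ x ≈ proj₁ y → arcDist x y ≈ 0#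
    ≈⇒arcDist≈0 {x} {y} p =
      antisym (≤-trans (x⊓y≤x _ _) (≤-reflexive (≈⇒dist≈0 p))) (arcDist-nonNeg x y)

    arcDist≈0⇒≈ : ∀ {x y : Point} → arcDist x y ≈ 0# → proj₁ x ≈ proj₁ y
    arcDist≈0⇒≈ {x@(s , 0≤s , s<L)} {y@(t , 0≤t , t<L)} p
      with ⊓-sel (dist s t) (L + - dist s t)
    ... | inj₁ q = dist≈0⇒≈ (≈-trans (≈-sym q) p)
    ... | inj₂ q with ⊔-sel (s + - t) (- (s + - t))
    ...   | inj₁ r = contradiction (full≈L p q r) (full≉L x y)
    ...   | inj₂ r = contradiction (full≈L p q (≈-trans r (neg-sub s t))) (full≉L y x)

    arcDist-sym : ∀ x y → arcDist x y ≈ arcDist y x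
    arcDist-sym (s , _) (t , _) =
      ⊓-cong (dist-sym s t) (+-cong ≈-refl (-‿cong (dist-sym s t)))

    arcDist-triangle : ∀ x y z → arcDist x z ≤ arcDist x y + arcDist y z
    arcDist-triangle x@(s , _) y@(t , _) z@(u , _)
      with ⊓-sel (dist s t) (L + - dist s t) | ⊓-sel (dist t u) (L + - dist t u)
    ... | inj₁ p | inj₁ q = begin
      arcDist x z                               ≤⟨ x⊓y≤x _ _ ⟩
      dist s u                                  ≤⟨ dist-triangle s t u ⟩
      dist s t + dist t u                       ≈⟨ +-cong p q ⟨
      arcDist x y + arcDist y z                 ∎
    ... | inj₁ p | inj₂ q = begin
      arcDist x z                               ≤⟨ x⊓y≤y _ _ ⟩
      L + - dist s u                            ≤⟨ swing (≤-respʳ (+-cong (dist-sym t s) ≈-refl)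
                                                     (dist-triangle t s u)) ⟩
      dist s t + (L + - dist t u)               ≈⟨ +-cong p q ⟨
      arcDist x y + arcDist y z                 ∎
    ... | inj₂ p | inj₁ q = begin
      arcDist x z                               ≤⟨ x⊓y≤y _ _ ⟩
      L + - dist s u                            ≤⟨ swing (≤-respʳ (≈-trans (+-cong ≈-refl (dist-sym u t))
                                                     (+-comm _ _)) (dist-triangle s u t)) ⟩
      dist t u + (L + - dist s t)               ≈⟨ +-comm _ _ ⟩
      (L + - dist s t) + dist t u               ≈⟨ +-cong p q ⟨
      arcDist x y + arcDist y z                 ∎
    ... | inj₂ p | inj₂ q = begin
      arcDist x z                               ≤⟨ x⊓y≤x _ _ ⟩
      dist s u                                  ≤⟨ x+z≤y⇒x≤y-z (perimeter x y z) ⟩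
      (L + L) + - (dist s t + dist t u)         ≈⟨ +-cong ≈-refl (-‿+-comm _ _) ⟨
      (L + L) + (- dist s t + - dist t u)       ≈⟨ interchange _ _ _ _ ⟩
      (L + - dist s t) + (L + - dist t u)       ≈⟨ +-cong p q ⟨
      arcDist x y + arcDist y z                 ∎

  0≤1 : 0# ≤ 1#
  0≤1 with total 0# 1#
  ... | inj₁ p = p
  ... | inj₂ p = ≤-respʳ (≈-trans (-1*x≈-x (- 1#)) (-‿involutive 1#))
                   (*-nonNeg (x≤0⇒0≤-x p) (x≤0⇒0≤-x p))

  *-monoʳ-≤ : ∀ {z x y} → 0# ≤ z → x ≤ y → z * x ≤ z * y
  *-monoʳ-≤ {z} {x} {y} 0≤z x≤y = begin
    z * x                       ≈⟨ +-identityˡ _ ⟨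
    0# + z * x                  ≤⟨ +-monoˡ-≤ _ (*-nonNeg 0≤z (x≤y⇒0≤y-x x≤y)) ⟩
    z * (y + - x) + z * x       ≈⟨ distribˡ z _ x ⟨
    z * (y + - x + x)           ≈⟨ *-cong ≈-refl (cancel′ y x) ⟩
    z * y                       ∎

  0≤x² : ∀ x → 0# ≤ x * x
  0≤x² x with total 0# x
  ... | inj₁ p = *-nonNeg p p
  ... | inj₂ p = ≤-respʳ
    (≈-trans (≈-sym (-‿distribˡ-* x (- x)))
      (≈-trans (-‿cong (≈-sym (-‿distribʳ-* x x))) (-‿involutive _)))
    (*-nonNeg (x≤0⇒0≤-x p) (x≤0⇒0≤-x p))

  1≤1+x : ∀ {x} → 0# ≤ x → 1# ≤ 1# + x
  1≤1+x p = ≤-respˡ (+-identityʳ 1#) (+-mono-≤ ≤-refl p)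

  ·-nonNeg : ∀ n {x} → 0# ≤ x → 0# ≤ n · x
  ·-nonNeg zero    p = ≤-refl
  ·-nonNeg (suc n) p = ≤-respˡ (+-identityˡ 0#) (+-mono-≤ p (·-nonNeg n p))

  module Reciprocal (x : ℝ) (1≤x : 1# ≤ x) where

    x≉0 : ¬ x ≈ 0#
    x≉0 p = 0≉1 (antisym 0≤1 (≤-respʳ p 1≤x))

    recip : ℝ
    recip = proj₁ (inverse x x≉0)

    x*recip≈1 : x * recip ≈ 1#
    x*recip≈1 = proj₂ (inverse x x≉0)

    recip-nonNeg : 0# ≤ recip
    recip-nonNeg with total 0# recip
    ... | inj₁ p = p
    ... | inj₂ p = contradiction (antisym 0≤1 1≤0) 0≉1
      where
      1≤0 : 1# ≤ 0#
      1≤0 = begin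
        1#          ≈⟨ x*recip≈1 ⟨
        x * recip   ≤⟨ *-monoʳ-≤ (≤-trans 0≤1 1≤x) p ⟩
        x * 0#      ≈⟨ zeroʳ x ⟩
        0#          ∎

    recip≤1 : recip ≤ 1#
    recip≤1 = begin
      recip        ≈⟨ *-identityʳ recip ⟨
      recip * 1#   ≤⟨ *-monoʳ-≤ recip-nonNeg 1≤x ⟩
      recip * x    ≈⟨ *-comm recip x ⟩
      x * recip    ≈⟨ x*recip≈1 ⟩
      1#           ∎

  open Reciprocal public using (recip)

  1≤suc : ∀ m → 1# ≤ suc m · 1#
  1≤suc m = 1≤1+x (·-nonNeg m 0≤1)

  1≤1+x² : ∀ x → 1# ≤ 1# + x * x
  1≤1+x² x = 1≤1+x (0≤x² x)

  -- π is the arc length of the half circle that t ∈ [-1, 1] traces through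
  -- ((1 - t²) / (1 + t²), 2t / (1 + t²)) with speed 2 / (1 + t²), that is,
  -- the integral of 4 / (1 + t²) over [0, 1]; the integrand decreases, so
  -- right Riemann sums are lower sums.
  lowerSum : ℕ → ℝ
  lowerSum m = sum {suc m} λ k → Δ * (4 · 1# * recip (1# + t k * t k) (1≤1+x² (t k)))
    where
    Δ = recip (suc m · 1#) (1≤suc m)
    t : Fin (suc m) → ℝ
    t k = suc (toℕ k) · Δ

  sum-bound : ∀ {n c} (f : Fin n → ℝ) → (∀ k → f k ≤ c) → sum f ≤ (n · 1#) * c
  sum-bound {zero}  {c} f p = ≤-reflexive (≈-sym (zeroˡ c))
  sum-bound {suc n} {c} f p = begin
    f 0F + sum (f ∘ Fin.suc)   ≤⟨ +-mono-≤ (p 0F) (sum-bound (f ∘ Fin.suc) (p ∘ Fin.suc)) ⟩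
    c + (n · 1#) * c           ≈⟨ +-cong (*-identityˡ c) ≈-refl ⟨
    1# * c + (n · 1#) * c      ≈⟨ distribʳ c 1# (n · 1#) ⟨
    (suc n · 1#) * c           ∎

  lowerSum≤4 : ∀ m → lowerSum m ≤ 4 · 1#
  lowerSum≤4 m = begin
    lowerSum m                            ≤⟨ sum-bound {suc m} _ (λ k →
        *-monoʳ-≤ (Δ.recip-nonNeg) (≤-respʳ (*-identityʳ _)
          (*-monoʳ-≤ (·-nonNeg 4 0≤1) (Reciprocal.recip≤1 _ (1≤1+x² (suc (toℕ k) · Δ.recip)))))) ⟩
    (suc m · 1#) * (Δ.recip * (4 · 1#))   ≈⟨ *-assoc _ _ _ ⟨
    (suc m · 1#) * Δ.recip * (4 · 1#)     ≈⟨ *-cong Δ.x*recip≈1 ≈-refl ⟩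
    1# * (4 · 1#)                         ≈⟨ *-identityˡ _ ⟩
    4 · 1#                                ∎
    where module Δ = Reciprocal (suc m · 1#) (1≤suc m)

  π-exists : ∃ (Supremum λ s → ∃[ m ] s ≈ lowerSum m)
  π-exists = complete _ (lowerSum 0 , 0 , ≈-refl)
    (4 · 1# , λ { _ (m , p) → ≤-respˡ (≈-sym p) (lowerSum≤4 m) })

  π : ℝ
  π = proj₁ π-exists

module Geometry (R : Reals) where

  private
    module ℝ = Reals R
  open ℝ using (ℝ; _≤_; _<_; 0#; 1#; _+_; _*_; -_; dist; π)

  record MetricSpace a ℓ : Set (L.suc (a L.⊔ ℓ)) where
    infix 4 _≈_
    field
      Carrier         : Set a
      _≈_             : Rel Carrier ℓ
      d               : Carrier → Carrier → ℝ
      isGeneralMetric : IsGeneralMetric _≈_ ℝ._≈_ _≤_ 0# _+_ d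

    open IsGeneralMetric isGeneralMetric public

    setoid : Setoid a ℓ
    setoid = record { isEquivalence = ≈-isEquivalence }

  -- A predicate on ℝ as a metric subspace of ℝ.
  ⟦_⟧ : Pred ℝ 0ℓ → MetricSpace 0ℓ 0ℓ
  ⟦ P ⟧ = record
    { Carrier = ∃ P
    ; _≈_     = ℝ._≈_ on proj₁
    ; d       = dist on proj₁
    ; isGeneralMetric = record
      { isSemiMetric = record
        { isQuasiSemiMetric = record
          { isPreMetric = record
            { isProtoMetric = record
              { isPartialOrder  = ℝ.isPartialOrder
              ; ≈-isEquivalence = On.isEquivalence proj₁ ℝ.isEquivalence
              ; cong            = ℝ.dist-cong
              ; nonNegative     = ℝ.∣∣-nonNeg _
              }
            ; ≈⇒0 = ℝ.≈⇒dist≈0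
            }
          ; 0⇒≈ = ℝ.dist≈0⇒≈
          }
        ; sym = λ x y → ℝ.dist-sym (proj₁ x) (proj₁ y)
        }
      ; triangle = λ x y z → ℝ.dist-triangle (proj₁ x) (proj₁ y) (proj₁ z)
      }
    }

  -- The unit circle with arc length as coordinate: s ∈ [0, 2π) stands for
  -- the point (cos s, sin s), and two points are as far apart as the shorter
  -- of the two arcs between them is long.
  S¹ : MetricSpace 0ℓ 0ℓ
  S¹ = record
    { Carrier = Point
    ; _≈_     = ℝ._≈_ on proj₁
    ; d       = arcDist
    ; isGeneralMetric = record
      { isSemiMetric = record
        { isQuasiSemiMetric = record
          { isPreMetric = record
            { isProtoMetric = record
              { isPartialOrder  = ℝ.isPartialOrder
              ; ≈-isEquivalence = On.isEquivalence proj₁ ℝ.isEquivalence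
              ; cong            = λ {x} {y} {u} {v} → arcDist-cong {x} {y} {u} {v}
              ; nonNegative     = λ {x} {y} → arcDist-nonNeg x y
              }
            ; ≈⇒0 = λ {x} {y} → ≈⇒arcDist≈0 {x} {y}
            }
          ; 0⇒≈ = λ {x} {y} → arcDist≈0⇒≈ {x} {y}
          }
        ; sym = arcDist-sym
        }
      ; triangle = arcDist-triangle
      }
    }
    where open ℝ.Loop (π + π)

  module _ {a ℓ a′ ℓ′} (X : MetricSpace a ℓ) (Y : MetricSpace a′ ℓ′) where
    private
      module X = MetricSpace X
      module Y = MetricSpace Y

    DistancePreserving : (X.Carrier → Y.Carrier) → Set a
    DistancePreserving f = ∀ x x′ → Y.d (f x) (f x′) ℝ.≈ X.d x x′

    SimilarWithRatio : ℝ → Set (a L.⊔ ℓ L.⊔ a′ L.⊔ ℓ′)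
    SimilarWithRatio r = Σ (Bijection X.setoid Y.setoid) λ f →
      ∀ x x′ → Y.d (Bijection.to f x) (Bijection.to f x′) ℝ.≈ r * X.d x x′

    Similar : Set (a L.⊔ ℓ L.⊔ a′ L.⊔ ℓ′)
    Similar = ∃[ r ] 0# < r × SimilarWithRatio r

    Isometric : Set (a L.⊔ ℓ L.⊔ a′ L.⊔ ℓ′)
    Isometric = SimilarWithRatio 1#

  record Interval (I : Pred ℝ 0ℓ) : Set where
    field
      respects : I Respects ℝ._≈_
      convex   : ∀ {x y t} → I x → I y → 0# ≤ t → t ≤ 1# → I ((1# + - t) * x + t * y)

  module _ {a ℓ} (X : MetricSpace a ℓ) where
    private
      module X = MetricSpace X
    open X using (_≈_; d)

    record Geodesic (x y : X.Carrier) : Set (a L.⊔ ℓ) where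
      Domain : MetricSpace 0ℓ 0ℓ
      Domain = ⟦ (λ t → 0# ≤ t × t ≤ d x y) ⟧

      field
        γ                  : MetricSpace.Carrier Domain → X.Carrier
        distancePreserving : DistancePreserving Domain X γ
        start              : γ (0# , ℝ.≤-refl , X.nonNegative) ≈ x
        end                : γ (d x y , X.nonNegative , ℝ.≤-refl) ≈ y

      Segment : Pred X.Carrier ℓ
      Segment p = ∃[ t ] γ t ≈ p

    IsGeodesicSpace : Set (a L.⊔ ℓ)
    IsGeodesicSpace = ∀ x y → Geodesic x y

    record IsTripod (Y : Pred X.Carrier ℓ) : Set (a L.⊔ ℓ) where
      field
        x        : Fin 3 → X.Carrier
        y        : X.Carrier
        x∈Y      : ∀ i → Y (x i)
        y∈Y      : Y y
        x≉x      : ∀ {i j} → i ≢ j → ¬ x i ≈ x j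
        x≉y      : ∀ i → ¬ x i ≈ y
        leg      : ∀ i → Geodesic (x i) y

      open module Leg i = Geodesic (leg i) using (Segment)

      field
        union    : ∀ p → Y p ⇔ (∃[ i ] Segment i p)
        meet     : ∀ {i j} → i ≢ j → ∀ p → (Segment i p × Segment j p) ⇔ p ≈ y

    HasTripod : Set (a L.⊔ L.suc ℓ)
    HasTripod = ∃ IsTripod

    IsUnitBallGraph : Graph → Set a
    IsUnitBallGraph G = ∃[ δ ] 0# < δ × Σ (Vertex → X.Carrier) λ ρ →
      ∀ {u v} → u ≢ v → Adj u v ⇔ d (ρ u) (ρ v) ≤ δ
      where open Graph G

module Submission where

-- Call X separated if, whenever y lies strictly between a and b, every z lies
-- on the same side of y as a or as b, that is, one of z and a (or of z and b)
-- is between y and the other.  If this fails, then where the geodesics from y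
-- to a, b and z branch there is a tripod two of whose legs form a geodesic, a
-- fork.  For small δ a fork carries a unit ball graph that contains a claw or a
-- net: walk down the stem until some point q is within δ of the line formed by
-- the other two legs while the preceding point q′ is not; then consider the
-- extreme points of the line within δ of q.
--
-- Let X be separated and o strictly between p and q.  The points on the side of
-- p, and those on the side of q, are determined by their distance from o, and
-- since geodesics are connected, a geodesic from one side to the other passes
-- through a common point of the two.  If the sides share only o, then the signed
-- distance from o embeds X into the line.  If they share another point m, then
-- nothing lies beyond m and X is a circle in which o and m are antipodal.
--
-- Conversely, on the line and on the circle the points other than c fall into two
-- sides of c, and points on the same side are as far apart as their distances
-- from c differ.  This property excludes tripods, claws and nets alike.

import Algebra.Properties.Monoid.Mult as Mult
import Data.Fin.Properties as Fin
import Data.List.Membership.DecPropositional as DecMembership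
import Data.Nat.Properties as ℕ
import Data.Product.Properties as Product
import Data.Vec.Properties as Vec
import Relation.Binary.Reasoning.PartialOrder as PartialOrderReasoning
open import Axiom.ExcludedMiddle using (ExcludedMiddle)
open import Data.Bool.Base using (Bool; true; false; _∧_)
open import Data.Empty using (⊥; ⊥-elim)
open import Data.Fin.Base using (Fin; zero; suc)
open import Data.Fin.Patterns
open import Data.Integer.Base as ℤ using (ℤ; +_; +[1+_]; -[1+_])
open import Data.List.Base as List using (List; []; _∷_; _++_)
open import Data.List.Membership.Propositional using (_∈_)
open import Data.List.Relation.Unary.All as All using (All; []; _∷_)
open import Data.List.Relation.Unary.All.Properties using (++⁺)
open import Data.Nat.Base as ℕ using (ℕ; zero; suc)
open import Data.Product.Base using (Σ; ∃-syntax; _×_; _,_; proj₁; proj₂; map₂; uncurry)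
open import Data.Sum.Base as Sum using (_⊎_; inj₁; inj₂; [_,_]′)
open import Data.Unit.Base using (⊤)
open import Data.Vec.Base as Vec using (Vec; []; _∷_)
open import Data.Vec.N-ary using (N-ary; _$ⁿ_; ∀ⁿʰ; curryⁿ)
open import Function.Base using (_∘_; id)
open import Function.Bundles using (Bijection; Equivalence; _⇔_; mk⇔)
open import Level as L using (Level; 0ℓ)
open import Relation.Binary.Definitions using (Symmetric; Irreflexive)
open import Relation.Binary.PropositionalEquality.Core as ≡ using (_≡_; _≢_; refl; cong)
open import Relation.Nullary using (¬_; Dec; yes; no; contradiction; does)
open import Relation.Nullary.Decidable
  using (True; False; toWitness; toWitnessFalse; fromWitness; decidable-stable; _⊎-dec_)
open import Relation.Unary using (Pred)
open import Defs

-- Linear arithmetic over an ordered field by checked certificates.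

module LinearArithmetic (R : Reals) where
  open Reals R
  open Mult +-monoid using (×-homo-+)
  open PartialOrderReasoning poset

  infix  8 ⊝_
  infixl 7 _⊕_ _⊖_
  infix  6 _≼_ _≐_
  infix  3 _⊢_

  data Expr (n : ℕ) : Set where
    var : Fin n → Expr n
    𝟘   : Expr n
    _⊕_ : Expr n → Expr n → Expr n
    ⊝_  : Expr n → Expr n

  _⊖_ : ∀ {n} → Expr n → Expr n → Expr n
  e ⊖ f = e ⊕ ⊝ f

  data Formula (n : ℕ) : Set where
    _≼_ _≐_ : Expr n → Expr n → Formula n

  record Sequent (n : ℕ) : Set where
    constructor _⊢_
    field
      hypotheses : List (Formula n)
      conclusion : Formula n

  private
    variable
      n : ℕ

  Env : ℕ → Set
  Env = Vec ℝ

  ⟦_⟧ₑ : Expr n → Env n → ℝ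
  ⟦ var i ⟧ₑ ρ = Vec.lookup ρ i
  ⟦ 𝟘     ⟧ₑ ρ = 0#
  ⟦ e ⊕ f ⟧ₑ ρ = ⟦ e ⟧ₑ ρ + ⟦ f ⟧ₑ ρ
  ⟦ ⊝ e   ⟧ₑ ρ = - ⟦ e ⟧ₑ ρ

  ⟦_⟧ : Formula n → Env n → Set
  ⟦ e ≼ f ⟧ ρ = ⟦ e ⟧ₑ ρ ≤ ⟦ f ⟧ₑ ρ
  ⟦ e ≐ f ⟧ ρ = ⟦ e ⟧ₑ ρ ≈ ⟦ f ⟧ₑ ρ

  -- Curried, so that each hypothesis becomes one argument of `lin`.
  ⟦_⟧⇒_ : List (Formula n) → (Env n → Set) → Env n → Set
  (⟦ []     ⟧⇒ C) ρ = C ρ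
  (⟦ h ∷ hs ⟧⇒ C) ρ = ⟦ h ⟧ ρ → (⟦ hs ⟧⇒ C) ρ

  Lin : ℕ → Set
  Lin = Vec ℕ

  Ineq : ℕ → Set
  Ineq n = Lin n × Lin n

  infixl 6 _+ᴸ_ _+ᴵ_

  _+ᴸ_ : Lin n → Lin n → Lin n
  _+ᴸ_ = Vec.zipWith ℕ._+_

  0ᴸ : Lin n
  0ᴸ = Vec.replicate _ 0

  unit : Fin n → Lin n
  unit zero    = 1 ∷ 0ᴸ
  unit (suc i) = 0 ∷ unit i

  _+ᴵ_ : Ineq n → Ineq n → Ineq n
  (l , r) +ᴵ (l′ , r′) = l +ᴸ l′ , r +ᴸ r′

  0ᴵ : Ineq n
  0ᴵ = 0ᴸ , 0ᴸ

  _·ᴵ_ : ℕ → Ineq n → Ineq n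
  zero  ·ᴵ i = 0ᴵ
  suc k ·ᴵ i = i +ᴵ k ·ᴵ i

  flip : Ineq n → Ineq n
  flip (l , r) = r , l

  -- (p , q) stands for p - q.
  normalise : Expr n → Lin n × Lin n
  normalise (var i) = unit i , 0ᴸ
  normalise 𝟘       = 0ᴸ , 0ᴸ
  normalise (e ⊕ f) = normalise e +ᴵ normalise f
  normalise (⊝ e)   = flip (normalise e)

  ineq : Expr n → Expr n → Ineq n
  ineq e f = normalise e +ᴵ flip (normalise f)

  ineqs : Formula n → List (Ineq n)
  ineqs (e ≼ f) = ineq e f ∷ []
  ineqs (e ≐ f) = ineq e f ∷ ineq f e ∷ []

  combine : List ℕ → List (Ineq n) → Ineq n
  combine (k ∷ ks) (h ∷ hs) = k ·ᴵ h +ᴵ combine ks hs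
  combine _        _        = 0ᴵ

  Certificate : Set
  Certificate = ℕ × List ℕ

  -- The conclusion times suc c is the combination of the hypotheses.
  valid? : (hs : List (Ineq n)) (g : Ineq n) (c : Certificate) → _
  valid? hs g (c , ks) = Vec.≡-dec ℕ._≟_ (proj₁ s) (proj₂ s)
    where s = combine ks hs +ᴵ suc c ·ᴵ flip g

  -- Unverified search: Gaussian elimination on the equations and
  -- Fourier–Motzkin elimination on the rest, recording multipliers.
  private
    record Row (n : ℕ) : Set where
      constructor mkRow
      field
        equation    : Bool
        coeffs      : Vec ℤ n
        multipliers : List ℤ

    add : List ℤ → List ℤ → List ℤ
    add (x ∷ xs) (y ∷ ys) = x ℤ.+ y ∷ add xs ys
    add []       ys       = ys
    add xs       []       = xs

    resolve : ℤ → ℤ → Row n → Row n → Row n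
    resolve j k (mkRow e u c) (mkRow e′ v c′) = mkRow (e ∧ e′)
      (Vec.zipWith (λ x y → j ℤ.* x ℤ.+ k ℤ.* y) u v)
      (add (List.map (j ℤ.*_) c) (List.map (k ℤ.*_) c′))

    record Split (n : ℕ) : Set where
      constructor split
      field
        pivots pos neg : List (ℤ × Row n)
        zer            : List (Row n)

    splitRows : List (Row (suc n)) → Split n
    splitRows [] = split [] [] [] []
    splitRows (mkRow e (a ∷ u) c ∷ rs) with e | a | splitRows rs
    ... | _     | + zero      | split es ps ns zs = split es ps ns (mkRow e u c ∷ zs)
    ... | true  | _           | split es ps ns zs = split ((a , mkRow e u c) ∷ es) ps ns zs
    ... | false | +[1+ k ]    | split es ps ns zs = split es ((a , mkRow e u c) ∷ ps) ns zs
    ... | false | -[1+ k ]    | split es ps ns zs = split es ps ((a , mkRow e u c) ∷ ns) zs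

    reduce : ℤ × Row n → ℤ × Row n → Row n
    reduce (+ a      , r) (b , r′) = resolve (ℤ.- b) (+ a) r r′
    reduce (-[1+ a ] , r) (b , r′) = resolve b (+[1+ a ]) r r′

    eliminate : List (Row n) → List (List ℤ)
    eliminate {zero}  rs = List.map Row.multipliers rs
    eliminate {suc n} rs with splitRows rs
    ... | split (e ∷ es) ps ns zs = eliminate (List.map (reduce e) (es ++ ps ++ ns) ++ zs)
    ... | split []       ps ns zs = eliminate (zs ++ List.concatMap (λ (a , r) →
                                      List.map (λ (b , r′) → resolve (ℤ.- b) a r r′) ns) ps)

    spread : List (Formula n) → List ℤ → List ℕ
    spread (_ ≼ _ ∷ hs) (c ∷ cs) = ℤ.∣ c ∣ ∷ spread hs cs
    -- An equation counts as two opposite inequalities; the sign of its multiplier decides which of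
    -- them receives it.
    spread (_ ≐ _ ∷ hs) (c ∷ cs) = ℤ.∣ c ℤ.⊔ + 0 ∣ ∷ ℤ.∣ c ℤ.⊓ + 0 ∣ ∷ spread hs cs
    spread _            _        = []

    firstUseful : List (Formula n) → List (List ℤ) → Certificate
    firstUseful hs ((+[1+ c ] ∷ cs) ∷ _) = c , spread hs cs
    firstUseful hs (_ ∷ css)             = firstUseful hs css
    firstUseful hs []                    = 0 , []

    row : Bool → Ineq n → List ℤ → Row n
    row e (l , r) c = mkRow e (Vec.zipWith ℤ._⊖_ r l) c

    rows : List ℤ → List (Formula n) → List (Row n)
    rows c []           = []
    rows c (e ≼ f ∷ hs) = row false (ineq e f) (c ++ + 1 ∷ []) ∷ rows (+ 0 ∷ c) hs
    rows c (e ≐ f ∷ hs) = row true  (ineq e f) (c ++ + 1 ∷ []) ∷ rows (+ 0 ∷ c) hs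

  search : List (Formula n) → Ineq n → Certificate
  -- The reversed goal comes first, with multiplier 1. A combination in which every variable cancels
  -- and the reversed goal has a positive multiplier is a certificate.
  search hs g = firstUseful hs (eliminate (row false (flip g) (+ 1 ∷ []) ∷ rows (+ 0 ∷ []) hs))

  derives : List (Formula n) → List (Ineq n) → Set
  derives hs []       = ⊤
  derives hs (g ∷ gs) = True (valid? (List.concatMap ineqs hs) g (search hs g)) × derives hs gs

  Derivable : Sequent n → Set
  Derivable (hs ⊢ g) = derives hs (ineqs g)

  eval : Env n → Lin n → ℝ
  eval []      []       = 0#
  eval (x ∷ ρ) (k ∷ ks) = k · x + eval ρ ks

  eval-0 : (ρ : Env n) → eval ρ 0ᴸ ≈ 0#
  eval-0 []      = ≈-refl
  eval-0 (x ∷ ρ) = ≈-trans (+-identityˡ _) (eval-0 ρ)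

  eval-+ : (ρ : Env n) (u v : Lin n) → eval ρ (u +ᴸ v) ≈ eval ρ u + eval ρ v
  eval-+ []      []      []      = ≈-sym (+-identityˡ 0#)
  eval-+ (x ∷ ρ) (j ∷ u) (k ∷ v) =
    ≈-trans (+-cong (×-homo-+ x j k) (eval-+ ρ u v)) (interchange _ _ _ _)

  eval-unit : (ρ : Env n) (i : Fin n) → eval ρ (unit i) ≈ Vec.lookup ρ i
  eval-unit (x ∷ ρ) zero    = ≈-trans (+-cong (+-identityʳ x) (eval-0 ρ)) (+-identityʳ x)
  eval-unit (x ∷ ρ) (suc i) = ≈-trans (+-identityˡ _) (eval-unit ρ i)

  normalise-correct : (ρ : Env n) (e : Expr n) →
    ⟦ e ⟧ₑ ρ + eval ρ (proj₂ (normalise e)) ≈ eval ρ (proj₁ (normalise e))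
  normalise-correct ρ (var i) =
    ≈-trans (+-cong (≈-sym (eval-unit ρ i)) (eval-0 ρ)) (+-identityʳ _)
  normalise-correct ρ 𝟘       = +-identityˡ _
  normalise-correct ρ (e ⊕ f) = ≈-trans (+-cong ≈-refl (eval-+ ρ _ _))
    (≈-trans (interchange _ _ _ _)
    (≈-trans (+-cong (normalise-correct ρ e) (normalise-correct ρ f)) (≈-sym (eval-+ ρ _ _))))
  normalise-correct ρ (⊝ e)   = ≈-trans (+-cong ≈-refl (≈-sym (normalise-correct ρ e)))
    (≈-trans (≈-sym (+-assoc _ _ _)) (≈-trans (+-cong (-‿inverseˡ _) ≈-refl) (+-identityˡ _)))

  Holds : Env n → Ineq n → Set
  Holds ρ (l , r) = eval ρ l ≤ eval ρ r

  module _ (ρ : Env n) (e f : Expr n) where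
    private
      p⁺ = eval ρ (proj₁ (normalise e))
      p⁻ = eval ρ (proj₂ (normalise e))
      q⁺ = eval ρ (proj₁ (normalise f))
      q⁻ = eval ρ (proj₂ (normalise f))

      left : ⟦ e ⟧ₑ ρ + (p⁻ + q⁻) ≈ eval ρ (proj₁ (ineq e f))
      left = begin-equality
        ⟦ e ⟧ₑ ρ + (p⁻ + q⁻)   ≈⟨ +-assoc _ _ _ ⟨
        ⟦ e ⟧ₑ ρ + p⁻ + q⁻     ≈⟨ +-cong (normalise-correct ρ e) ≈-refl ⟩
        p⁺ + q⁻                ≈⟨ eval-+ ρ _ _ ⟨
        eval ρ (proj₁ (ineq e f)) ∎

      right : ⟦ f ⟧ₑ ρ + (p⁻ + q⁻) ≈ eval ρ (proj₂ (ineq e f))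
      right = begin-equality
        ⟦ f ⟧ₑ ρ + (p⁻ + q⁻)   ≈⟨ x∙yz≈y∙xz _ _ _ ⟩
        p⁻ + (⟦ f ⟧ₑ ρ + q⁻)   ≈⟨ +-cong ≈-refl (normalise-correct ρ f) ⟩
        p⁻ + q⁺                ≈⟨ eval-+ ρ _ _ ⟨
        eval ρ (proj₂ (ineq e f)) ∎

    ≤⇒holds : ⟦ e ⟧ₑ ρ ≤ ⟦ f ⟧ₑ ρ → Holds ρ (ineq e f)
    ≤⇒holds p = ≤-respˡ left (≤-respʳ right (+-monoˡ-≤ _ p))

    holds⇒≤ : Holds ρ (ineq e f) → ⟦ e ⟧ₑ ρ ≤ ⟦ f ⟧ₑ ρ
    holds⇒≤ p = +-cancelʳ-≤ _ (≤-respˡ (≈-sym left) (≤-respʳ (≈-sym right) p))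

  holds-+ : (ρ : Env n) (h i : Ineq n) → Holds ρ h → Holds ρ i → Holds ρ (h +ᴵ i)
  holds-+ ρ h i p q =
    ≤-respˡ (≈-sym (eval-+ ρ _ _)) (≤-respʳ (≈-sym (eval-+ ρ _ _)) (+-mono-≤ p q))

  holds-· : (ρ : Env n) (k : ℕ) (h : Ineq n) → Holds ρ h → Holds ρ (k ·ᴵ h)
  holds-· ρ zero    h p = ≤-refl
  holds-· ρ (suc k) h p = holds-+ ρ h (k ·ᴵ h) p (holds-· ρ k h p)

  holds-combine : (ρ : Env n) (ks : List ℕ) {hs : List (Ineq n)} →
                  All (Holds ρ) hs → Holds ρ (combine ks hs)
  holds-combine ρ []       ps       = ≤-refl
  holds-combine ρ (k ∷ ks) []       = ≤-refl
  holds-combine ρ (k ∷ ks) (_∷_ {h} p ps) =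
    holds-+ ρ (k ·ᴵ h) (combine ks _) (holds-· ρ k h p) (holds-combine ρ ks ps)

  -- Division by `suc c` is avoided by totality: if `r ≤ l`, then `c` of the `suc c` copies of the
  -- reversed goal hold, and subtracting them and the hypotheses from the certified equation leaves
  -- `l ≤ r`.
  valid⇒holds : (ρ : Env n) (hs : List (Ineq n)) (g : Ineq n) (c : Certificate) →
    True (valid? hs g c) → All (Holds ρ) hs → Holds ρ g
  valid⇒holds ρ hs g@(l , r) (c , ks) v ps with total (eval ρ l) (eval ρ r)
  ... | inj₁ l≤r = l≤r
  ... | inj₂ r≤l = +-cancelʳ-≤ _ (begin
    eval ρ l + (A + C)   ≈⟨ swap₁ ⟩
    A + (eval ρ l + C)   ≤⟨ +-mono-≤ (holds-combine ρ ks ps) (+-mono-≤ ≤-refl C≤D) ⟩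
    B + (eval ρ l + D)   ≈⟨ eqn ⟨
    A + (eval ρ r + C)   ≈⟨ x∙yz≈y∙xz _ _ _ ⟩
    eval ρ r + (A + C)   ∎)
    where
    s = combine ks hs
    k = c ·ᴵ flip g
    A = eval ρ (proj₁ s)
    B = eval ρ (proj₂ s)
    C = eval ρ (proj₁ k)
    D = eval ρ (proj₂ k)
    swap₁ = x∙yz≈y∙xz (eval ρ l) A C
    C≤D : C ≤ D
    C≤D = holds-· ρ c (flip g) r≤l
    eqn : A + (eval ρ r + C) ≈ B + (eval ρ l + D)
    eqn = begin-equality
      A + (eval ρ r + C)                            ≈⟨ +-cong ≈-refl (eval-+ ρ _ _) ⟨
      A + eval ρ (r +ᴸ proj₁ k)                     ≈⟨ eval-+ ρ _ _ ⟨
      eval ρ (proj₁ s +ᴸ (r +ᴸ proj₁ k))            ≡⟨ cong (eval ρ) (toWitness v) ⟩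
      eval ρ (proj₂ s +ᴸ (l +ᴸ proj₂ k))            ≈⟨ eval-+ ρ _ _ ⟩
      B + eval ρ (l +ᴸ proj₂ k)                     ≈⟨ +-cong ≈-refl (eval-+ ρ _ _) ⟩
      B + (eval ρ l + D)                            ∎

  derives⇒holds : (ρ : Env n) (hs : List (Formula n)) (gs : List (Ineq n)) → derives hs gs →
                  All (Holds ρ) (List.concatMap ineqs hs) → All (Holds ρ) gs
  derives⇒holds ρ hs []       _        ps = []
  derives⇒holds ρ hs (g ∷ gs) (v , vs) ps =
    valid⇒holds ρ _ g (search hs g) v ps ∷ derives⇒holds ρ hs gs vs ps

  formula⇒holds : (ρ : Env n) (φ : Formula n) → ⟦ φ ⟧ ρ → All (Holds ρ) (ineqs φ)
  formula⇒holds ρ (e ≼ f) p = ≤⇒holds ρ e f p ∷ []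
  formula⇒holds ρ (e ≐ f) p =
    ≤⇒holds ρ e f (≤-reflexive p) ∷ ≤⇒holds ρ f e (≤-reflexive (≈-sym p)) ∷ []

  holds⇒formula : (ρ : Env n) (φ : Formula n) → All (Holds ρ) (ineqs φ) → ⟦ φ ⟧ ρ
  holds⇒formula ρ (e ≼ f) (p ∷ [])     = holds⇒≤ ρ e f p
  holds⇒formula ρ (e ≐ f) (p ∷ q ∷ []) = antisym (holds⇒≤ ρ e f p) (holds⇒≤ ρ f e q)

  discharge : (ρ : Env n) (hs : List (Formula n)) {C : Env n → Set} →
    (All (Holds ρ) (List.concatMap ineqs hs) → C ρ) → (⟦ hs ⟧⇒ C) ρ
  discharge ρ []       f = f []
  discharge ρ (h ∷ hs) f = λ p → discharge ρ hs λ ps → f (++⁺ (formula⇒holds ρ h p) ps)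

  Valid : Sequent n → Env n → Set
  Valid (hs ⊢ g) = ⟦ hs ⟧⇒ ⟦ g ⟧

  derivable⇒valid : (S : Sequent n) → Derivable S → (ρ : Env n) → Valid S ρ
  derivable⇒valid (hs ⊢ g) v ρ = discharge ρ hs {⟦ g ⟧} λ ps →
    holds⇒formula ρ g (derives⇒holds ρ hs (ineqs g) v ps)

  ∀-valid : (n : ℕ) (P : Env n → Set) → (∀ ρ → P ρ) → ∀ⁿʰ n (curryⁿ P)
  ∀-valid zero    P f = f []
  ∀-valid (suc n) P f {x} = ∀-valid n (λ ρ → P (x ∷ ρ)) (λ ρ → f (x ∷ ρ))

  sequent : (n : ℕ) → N-ary n (Expr n) (Sequent n) → Sequent n
  sequent n f = f $ⁿ Vec.tabulate var

  -- The atoms are inferred from the hypotheses and the conclusion.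
  lin : (n : ℕ) (f : N-ary n (Expr n) (Sequent n)) {_ : Derivable (sequent n f)} →
        ∀ⁿʰ n (curryⁿ (Valid (sequent n f)))
  lin n f {v} = ∀-valid n (Valid (sequent n f)) (derivable⇒valid (sequent n f) v)

-- Order, suprema and distances on the real line.

module RealProperties (em : ∀ ℓ → ExcludedMiddle ℓ) (R : Reals) where
  open Reals R
  open LinearArithmetic R using (lin; _⊢_; _≼_; _≐_; _⊕_; _⊖_; 𝟘)

  private
    variable
      p : Level
      x y z : ℝ

  byContradiction : {A : Set p} → ¬ ¬ A → A
  byContradiction = decidable-stable (em _)

  infix 4 _≰_
  -- Strict inequality in negated form: a proof of `x ≤ y` found by `lin` refutes it at once.
  _≰_ : ℝ → ℝ → Set
  x ≰ y = ¬ x ≤ y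

  Pos : ℝ → Set
  Pos x = x ≰ 0#

  ≰⇒≥ : x ≰ y → y ≤ x
  ≰⇒≥ {x} {y} x≰y with total x y
  ... | inj₁ x≤y = contradiction x≤y x≰y
  ... | inj₂ y≤x = y≤x

  <⇒≱ : x < y → y ≰ x
  <⇒≱ (x≤y , x≉y) y≤x = x≉y (antisym x≤y y≤x)

  ≰⇒< : y ≰ x → x < y
  ≰⇒< y≰x = ≰⇒≥ y≰x , λ x≈y → y≰x (≤-reflexive (≈-sym x≈y))

  pos-1 : Pos 1#
  pos-1 1≤0 = 0≉1 (antisym 0≤1 1≤0)

  private
    2≉0 : ¬ 1# + 1# ≈ 0#
    2≉0 2≈0 = pos-1 (≤-respʳ 2≈0 (1≤1+x 0≤1))

  half : ℝ → ℝ
  half x = x * proj₁ (inverse (1# + 1#) 2≉0)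

  half+half : ∀ x → half x + half x ≈ x
  half+half x = begin-equality
    x * i + x * i           ≈⟨ distribˡ x i i ⟨
    x * (i + i)             ≈⟨ *-cong ≈-refl (+-cong (*-identityˡ i) (*-identityˡ i)) ⟨
    x * (1# * i + 1# * i)   ≈⟨ *-cong ≈-refl (distribʳ i 1# 1#) ⟨
    x * ((1# + 1#) * i)     ≈⟨ *-cong ≈-refl (proj₂ (inverse (1# + 1#) 2≉0)) ⟩
    x * 1#                  ≈⟨ *-identityʳ x ⟩
    x                       ∎
    where
    i = proj₁ (inverse (1# + 1#) 2≉0)
    open PartialOrderReasoning poset

  pos-half : Pos x → Pos (half x)
  pos-half {x} 0<x h≤0 = 0<x
    (lin 2 (λ x h → h ⊕ h ≐ x ∷ h ≼ 𝟘 ∷ [] ⊢ x ≼ 𝟘) (half+half x) h≤0)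

  pos-⊓ : Pos x → Pos y → ∃[ z ] Pos z × z ≤ x × z ≤ y
  pos-⊓ {x} {y} 0<x 0<y with total x y
  ... | inj₁ x≤y = x , 0<x , ≤-refl , x≤y
  ... | inj₂ y≤x = y , 0<y , y≤x , ≤-refl

  pos-third : Pos x → ∃[ z ] Pos z × z + (z + z) ≤ x
  pos-third {x} 0<x = half (half x) , pos-half (pos-half 0<x) ,
    lin 3 (λ x h q → h ⊕ h ≐ x ∷ q ⊕ q ≐ h ∷ 𝟘 ≼ q ∷ [] ⊢ q ⊕ (q ⊕ q) ≼ x)
      (half+half x) (half+half (half x)) (≰⇒≥ (pos-half (pos-half 0<x)))

  -- If `x - y` were positive, it would exceed the slack `ε + ε` for an ε with three copies fitting
  -- into `x - y`. The slack has room for two errors, as when two points are approximated at once.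
  ≤-limit : (∀ ε → Pos ε → x ≤ y + (ε + ε)) → x ≤ y
  ≤-limit {x} {y} x≤y+2ε = byContradiction λ x≰y →
    let 0<x-y : Pos (x + - y)
        0<x-y q = x≰y (lin 2 (λ x y → x ⊖ y ≼ 𝟘 ∷ [] ⊢ x ≼ y) q)
        ε , 0<ε , 3ε≤ = pos-third 0<x-y
    in 0<ε (lin 3 (λ x y ε → ε ⊕ (ε ⊕ ε) ≼ x ⊖ y ∷ x ≼ y ⊕ (ε ⊕ ε) ∷ [] ⊢ ε ≼ 𝟘)
             3ε≤ (x≤y+2ε ε 0<ε))

  record Supremum′ (P : Pred ℝ p) (s : ℝ) : Set p where
    field
      upper : ∀ {x} → P x → x ≤ s
      near  : ∀ {ε} → Pos ε → ∃[ x ] P x × x + ε ≰ s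

  -- Completeness is given at level 0; `True (em _)` replaces `P x` by an equivalent proposition of
  -- that level. Leastness says that `s - ε` is no upper bound, which gives `near`.
  supremum : (P : Pred ℝ p) → ∃[ x ] P x → ∀ b → (∀ x → P x → x ≤ b) → ∃[ s ] Supremum′ P s
  supremum P (x , px) b ub
    with complete (λ x → True (em _ {P x})) (x , fromWitness px) (b , λ x q → ub x (toWitness q))
  ... | s , upper , least = s , record
    { upper = λ {x} px → upper x (fromWitness px)
    ; near  = λ {ε} 0<ε → byContradiction λ none → 0<ε
        (lin 2 (λ s ε → s ≼ s ⊖ ε ∷ [] ⊢ ε ≼ 𝟘) (least (s + - ε) λ x px →
          lin 3 (λ x s ε → x ⊕ ε ≼ s ∷ [] ⊢ x ≼ s ⊖ ε)
            (byContradiction λ ≰s → none (x , toWitness px , ≰s))))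
    }

  -- A point less than ε below the supremum stands in for a maximum when `P` may fail to be closed.
  almostMaximum : (P : Pred ℝ p) → ∃[ x ] P x → ∀ b → (∀ x → P x → x ≤ b) →
    ∀ {ε} → Pos ε → ∃[ x ] P x × (∀ {y} → x + ε ≤ y → ¬ P y)
  almostMaximum P ∃P b ub 0<ε with supremum P ∃P b ub
  ... | s , sup with Supremum′.near sup 0<ε
  ...   | x , px , x+ε≰s = x , px , λ x+ε≤y py → x+ε≰s (≤-trans x+ε≤y (Supremum′.upper sup py))

  -- The supremum of `P` on the interval is a limit of points of `P` from below, and `closed` puts
  -- such limits into `P`.
  maximumOn : (P : Pred ℝ p) → ∀ {m} → 0# ≤ m → P 0# →
    (∀ {x} → 0# ≤ x → x ≤ m →
      (∀ ε → Pos ε → ∃[ y ] P y × 0# ≤ y × y ≤ x × x ≤ y + ε) → P x) →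
    ∃[ x ] 0# ≤ x × x ≤ m × P x × (∀ {y} → y ≰ x → y ≤ m → ¬ P y)
  maximumOn P {m} 0≤m p0 closed
    with supremum (λ x → 0# ≤ x × x ≤ m × P x) (0# , ≤-refl , 0≤m , p0) m (λ _ q → proj₁ (proj₂ q))
  ... | s , sup = s , 0≤s , s≤m ,
    closed 0≤s s≤m (λ ε 0<ε → let x , q@(0≤x , _ , px) , x+ε≰s = near 0<ε in
      x , px , 0≤x , upper q , ≰⇒≥ x+ε≰s) ,
    λ y≰s y≤m py → y≰s (upper (≤-trans 0≤s (≰⇒≥ y≰s) , y≤m , py))
    where
    open Supremum′ sup
    0≤s : 0# ≤ s
    0≤s = upper (≤-refl , 0≤m , p0)
    s≤m : s ≤ m
    s≤m = ≤-limit λ ε 0<ε → let x , (_ , x≤m , _) , x+ε≰s = near 0<ε in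
      lin 4 (λ s x ε m → s ≼ x ⊕ ε ∷ x ≼ m ∷ 𝟘 ≼ ε ∷ [] ⊢ s ≼ m ⊕ (ε ⊕ ε))
        (≰⇒≥ x+ε≰s) x≤m (≰⇒≥ 0<ε)

  dist-≤ : x ≤ y → dist x y ≈ y + - x
  dist-≤ {x} {y} x≤y = antisym
    (⊔-lub (lin 2 (λ x y → x ≼ y ∷ [] ⊢ x ⊖ y ≼ y ⊖ x) x≤y) (≤-reflexive (neg-sub x y)))
    (≤-respˡ (neg-sub x y) (-x≤∣x∣ (x + - y)))

  dist-≥ : y ≤ x → dist x y ≈ x + - y
  dist-≥ {y} {x} y≤x = ≈-trans (dist-sym x y) (dist-≤ y≤x)

  dist-shift : ∀ {e} → 0# ≤ e → x + e ≈ y ⊎ y + e ≈ x → dist x y ≈ e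
  dist-shift 0≤e (inj₁ p) = ≈-trans
    (dist-≤ (lin 3 (λ x y e → 𝟘 ≼ e ∷ x ⊕ e ≐ y ∷ [] ⊢ x ≼ y) 0≤e p))
    (lin 3 (λ x y e → x ⊕ e ≐ y ∷ [] ⊢ y ⊖ x ≐ e) p)
  dist-shift 0≤e (inj₂ p) = ≈-trans
    (dist-≥ (lin 3 (λ x y e → 𝟘 ≼ e ∷ y ⊕ e ≐ x ∷ [] ⊢ y ≼ x) 0≤e p))
    (lin 3 (λ x y e → y ⊕ e ≐ x ∷ [] ⊢ x ⊖ y ≐ e) p)

  module Inverse {x} (0<x : Pos x) where
    private
      x≉0 : ¬ x ≈ 0#
      x≉0 p = 0<x (≤-reflexive p)

    infix 9 x⁻¹*_
    x⁻¹*_ : ℝ → ℝ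
    x⁻¹* y = proj₁ (inverse x x≉0) * y

    x*x⁻¹* : ∀ y → x * (x⁻¹* y) ≈ y
    x*x⁻¹* y = ≈-trans (≈-sym (*-assoc x _ y))
      (≈-trans (*-cong (proj₂ (inverse x x≉0)) ≈-refl) (*-identityˡ y))

    x⁻¹*x* : ∀ y → x⁻¹* (x * y) ≈ y
    x⁻¹*x* y = ≈-trans (≈-sym (*-assoc _ x y))
      (≈-trans (*-cong (≈-trans (*-comm _ x) (proj₂ (inverse x x≉0))) ≈-refl) (*-identityˡ y))

    *-cancelˡ-≤ : x * y ≤ x * z → y ≤ z
    *-cancelˡ-≤ {y} {z} p = byContradiction λ y≰z → y≰z (≤-reflexive
      (≈-trans (≈-sym (x⁻¹*x* y)) (≈-trans
        (*-cong ≈-refl (antisym p (*-monoʳ-≤ (≰⇒≥ 0<x) (≰⇒≥ y≰z)))) (x⁻¹*x* z))))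

  pos-* : Pos x → Pos y → Pos (x * y)
  pos-* {x} 0<x 0<y xy≤0 = 0<y (Inverse.*-cancelˡ-≤ 0<x (≤-respʳ (≈-sym (zeroʳ x)) xy≤0))

  pos-recip : ∀ x (1≤x : 1# ≤ x) → Pos (recip x 1≤x)
  pos-recip x 1≤x r≤0 = pos-1 (≤-respˡ (Reciprocal.x*recip≈1 x 1≤x)
    (≤-respʳ (zeroʳ x) (*-monoʳ-≤ (≤-trans 0≤1 1≤x) r≤0)))

  -- Already the Riemann sum with a single term is positive, and it bounds `π` from below.
  pos-π : Pos π
  pos-π π≤0 = pos-* (pos-recip (1 · 1#) (1≤suc 0))
      (pos-* {4 · 1#} (λ 4≤0 → pos-1 (≤-trans (1≤suc 3) 4≤0)) (pos-recip _ (1≤1+x² _)))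
    (≤-trans (≤-reflexive (≈-sym (+-identityʳ _)))
      (≤-trans (proj₁ (proj₂ π-exists) (lowerSum 0) (0 , ≈-refl)) π≤0))

  -- Going from s to t by e, forwards or backwards, on the line or across
  -- the seam of a circle of circumference L.
  Arc : (L s t e : ℝ) → Set
  Arc L s t e = (s + e ≈ t ⊎ t + e ≈ s) ⊎ (s + L ≈ t + e ⊎ t + L ≈ s + e)

  Arc-sym : ∀ {L s t e} → Arc L s t e → Arc L t s e
  Arc-sym = Sum.map Sum.swap Sum.swap

  Arc-circumference : ∀ {L L′ s t e} → L ≈ L′ → Arc L s t e → Arc L′ s t e
  Arc-circumference {s = s} {t} L≈L′ = Sum.map₂ (Sum.map (step s) (step t))
    where
    step : ∀ s {t} → s + _ ≈ t → s + _ ≈ t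
    step s = ≈-trans (+-cong ≈-refl (≈-sym L≈L′))

  Arc-scale : ∀ k {L s t e} → Arc L s t e → Arc (k * L) (k * s) (k * t) (k * e)
  Arc-scale k = Sum.map (Sum.map two two) (Sum.map four four)
    where
    two : ∀ {s e t} → s + e ≈ t → k * s + k * e ≈ k * t
    two p = ≈-trans (≈-sym (distribˡ k _ _)) (*-cong ≈-refl p)
    four : ∀ {s L t e} → s + L ≈ t + e → k * s + k * L ≈ k * t + k * e
    four p = ≈-trans (two p) (distribˡ k _ _)

  -- The coordinates differ by `e` or, across the seam, by `L - e`; since `e` is at most half of
  -- `L`, it is the smaller of the two.
  arc-distance : ∀ {L s t e} → 0# ≤ e → e + e ≤ L → Arc L s t e → dist s t ⊓ (L + - dist s t) ≈ e
  arc-distance {L} {e = e} 0≤e 2e≤L (inj₁ p) = ≈-trans (⊓-cong D≈ (+-cong ≈-refl (-‿cong D≈)))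
    (antisym (x⊓y≤x _ _) (⊓-glb ≤-refl (lin 2 (λ e L → e ⊕ e ≼ L ∷ [] ⊢ e ≼ L ⊖ e) 2e≤L)))
    where D≈ = dist-shift 0≤e p
  arc-distance {L} {e = e} 0≤e 2e≤L (inj₂ p) = ≈-trans (⊓-cong D≈ (+-cong ≈-refl (-‿cong D≈)))
    (antisym (≤-trans (x⊓y≤y _ _) (lin 2 (λ e L → [] ⊢ L ⊖ (L ⊖ e) ≼ e)))
      (⊓-glb (lin 2 (λ e L → e ⊕ e ≼ L ∷ [] ⊢ e ≼ L ⊖ e) 2e≤L)
             (lin 2 (λ e L → [] ⊢ e ≼ L ⊖ (L ⊖ e)))))
    where
    move : ∀ {s t} → s + L ≈ t + e → s + (L + - e) ≈ t
    move = lin 4 (λ s L t e → s ⊕ L ≐ t ⊕ e ∷ [] ⊢ s ⊕ (L ⊖ e) ≐ t)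
    D≈ = dist-shift (lin 2 (λ e L → e ⊕ e ≼ L ∷ 𝟘 ≼ e ∷ [] ⊢ 𝟘 ≼ L ⊖ e) 2e≤L 0≤e) (Sum.map move move p)

-- Betweenness, rays and forks in a metric space.

module MetricProperties (em : ∀ ℓ → ExcludedMiddle ℓ) (R : Reals)
                        {a ℓ} (X : Geometry.MetricSpace R a ℓ) where
  open Reals R
  open LinearArithmetic R using (lin; _⊢_; _≼_; _≐_; _⊕_; _⊖_; 𝟘)
  open RealProperties em R
  open Geometry R
  private module X = MetricSpace X
  open X using (d) renaming (Carrier to Pt; _≈_ to _≋_) public

  private
    variable
      x y z p : Pt
      s t : ℝ

  d-sym : ∀ x y → d x y ≈ d y x
  d-sym = X.sym

  △ : ∀ x y z → d x z ≤ d x y + d y z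
  △ = X.triangle

  d≥0 : ∀ x y → 0# ≤ d x y
  d≥0 x y = X.nonNegative

  ≋-refl : x ≋ x
  ≋-refl = X.EqC.refl

  ≋-sym : x ≋ y → y ≋ x
  ≋-sym = X.EqC.sym

  ≋-trans : x ≋ y → y ≋ z → x ≋ z
  ≋-trans = X.EqC.trans

  d≤0⇒≋ : d x y ≤ 0# → x ≋ y
  d≤0⇒≋ p = X.0⇒≈ (antisym p (d≥0 _ _))

  ≋⇒d≤0 : x ≋ y → d x y ≤ 0#
  ≋⇒d≤0 x≋y = ≤-reflexive (X.≈⇒0 x≋y)

  ≉⇒pos : ¬ x ≋ y → Pos (d x y)
  ≉⇒pos x≉y p = x≉y (d≤0⇒≋ p)

  d-congʳ : x ≋ y → d z x ≈ d z y
  d-congʳ = X.cong ≋-refl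

  d-congˡ : x ≋ y → d x z ≈ d y z
  d-congˡ x≋y = X.cong x≋y ≋-refl

  -- The triangle inequality turns this into an equality.
  Between : Pt → Pt → Pt → Set
  Between x y z = d x y + d y z ≤ d x z

  SameSide : Pt → Pt → Pt → Set
  SameSide c x y = Between c x y ⊎ Between c y x

  CircleOrInterval : Set (a L.⊔ ℓ L.⊔ L.suc 0ℓ)
  CircleOrInterval = Similar X S¹ ⊎ (∃[ I ] Interval I × Isometric X ⟦ I ⟧)

  -- A geodesic of length `l` from `w`, given as a function on all of ℝ that is constrained on
  -- [0, l] alone. Parameters can then be shifted without carrying proofs of their bounds.
  record IsRay (w : Pt) (l : ℝ) (f : ℝ → Pt) : Set ℓ where
    field
      start     : f 0# ≋ w
      isometric : 0# ≤ s → s ≤ t → t ≤ l → d (f s) (f t) ≈ t + - s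

    from-start : 0# ≤ s → s ≤ l → d w (f s) ≈ s
    from-start {s} 0≤s s≤l = ≈-trans (d-congˡ (≋-sym start))
      (lin 2 (λ s D → D ≐ s ⊖ 𝟘 ∷ [] ⊢ D ≐ s) (isometric ≤-refl 0≤s s≤l))

    shorten : ∀ {l′} → l′ ≤ l → IsRay w l′ f
    shorten l′≤l = record
      { start     = start
      ; isometric = λ 0≤s s≤t t≤l′ → isometric 0≤s s≤t (≤-trans t≤l′ l′≤l)
      }

    rebase : ∀ {v} → w ≋ v → IsRay v l f
    rebase w≋v = record { start = ≋-trans start w≋v ; isometric = isometric }

    respects : 0# ≤ s → s ≤ l → s ≈ t → f s ≋ f t
    respects 0≤s s≤l s≈t = d≤0⇒≋
      (lin 3 (λ s t D → s ≐ t ∷ D ≐ t ⊖ s ∷ [] ⊢ D ≼ 𝟘) s≈t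
        (isometric 0≤s (≤-reflexive s≈t) (≤-respˡ s≈t s≤l)))

    forward : 0# ≤ s → s ≤ l → IsRay (f s) (l + - s) (λ t → f (s + t))
    forward {s} 0≤s s≤l = record
      { start     = ≋-sym (respects 0≤s s≤l (≈-sym (+-identityʳ s)))
      ; isometric = λ {t} {u} 0≤t t≤u u≤l-s →
          lin 4 (λ s t u D → D ≐ (s ⊕ u) ⊖ (s ⊕ t) ∷ [] ⊢ D ≐ u ⊖ t)
            (isometric {s + t} {s + u}
              (lin 2 (λ s t → 𝟘 ≼ s ∷ 𝟘 ≼ t ∷ [] ⊢ 𝟘 ≼ s ⊕ t) 0≤s 0≤t)
              (+-mono-≤ ≤-refl t≤u)
              (lin 3 (λ s u l → u ≼ l ⊖ s ∷ [] ⊢ s ⊕ u ≼ l) u≤l-s))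
      }

    backward : 0# ≤ s → s ≤ l → IsRay (f s) s (λ t → f (s + - t))
    backward {s} 0≤s s≤l = record
      { start     = respects (lin 1 (λ s → 𝟘 ≼ s ∷ [] ⊢ 𝟘 ≼ s ⊖ 𝟘) 0≤s)
                      (lin 2 (λ s l → s ≼ l ∷ [] ⊢ s ⊖ 𝟘 ≼ l) s≤l)
                      (lin 1 (λ s → [] ⊢ s ⊖ 𝟘 ≐ s))
      ; isometric = λ {t} {u} 0≤t t≤u u≤s → ≈-trans (d-sym _ _)
          (lin 4 (λ s t u D → D ≐ (s ⊖ t) ⊖ (s ⊖ u) ∷ [] ⊢ D ≐ u ⊖ t)
            (isometric {s + - u} {s + - t} (x≤y⇒0≤y-x u≤s)
              (lin 3 (λ s t u → t ≼ u ∷ [] ⊢ s ⊖ u ≼ s ⊖ t) t≤u)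
              (lin 3 (λ s t l → s ≼ l ∷ 𝟘 ≼ t ∷ [] ⊢ s ⊖ t ≼ l) s≤l 0≤t)))
      }

    -- The legs of a tripod run towards its centre, whereas rays run away from their start.
    reversed : 0# ≤ l → Geodesic X (f l) w
    reversed 0≤l = record
      { γ                  = λ (t , _) → f (l + - t)
      ; distancePreserving = distancePreserving
      ; start              = ≋-sym (respects 0≤l ≤-refl (lin 1 (λ l → [] ⊢ l ≐ l ⊖ 𝟘)))
      ; end                = ≋-sym (d≤0⇒≋
          (lin 3 (λ l D E → D ≐ l ∷ E ≐ l ⊖ D ∷ [] ⊢ E ≼ 𝟘) D≈l
            (from-start (lin 2 (λ l D → D ≐ l ∷ [] ⊢ 𝟘 ≼ l ⊖ D) D≈l)
              (lin 2 (λ l D → 𝟘 ≼ D ∷ [] ⊢ l ⊖ D ≼ l) (d≥0 _ _)))))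
      }
      where
      D≈l : d (f l) w ≈ l
      D≈l = ≈-trans (d-sym _ _) (from-start 0≤l ≤-refl)

      preserves : ∀ {s t} → 0# ≤ s → s ≤ t → t ≤ d (f l) w →
                  d (f (l + - s)) (f (l + - t)) ≈ t + - s
      preserves {s} {t} 0≤s s≤t t≤D = ≈-trans (d-sym _ _)
        (lin 4 (λ l s t E → E ≐ (l ⊖ s) ⊖ (l ⊖ t) ∷ [] ⊢ E ≐ t ⊖ s)
          (isometric {l + - t} {l + - s}
            (lin 3 (λ l t D → D ≐ l ∷ t ≼ D ∷ [] ⊢ 𝟘 ≼ l ⊖ t) D≈l t≤D)
            (lin 3 (λ l s t → s ≼ t ∷ [] ⊢ l ⊖ t ≼ l ⊖ s) s≤t)
            (lin 2 (λ l s → 𝟘 ≼ s ∷ [] ⊢ l ⊖ s ≼ l) 0≤s)))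

      distancePreserving : DistancePreserving ⟦ (λ t → 0# ≤ t × t ≤ d (f l) w) ⟧ X
                             (λ (t , _) → f (l + - t))
      distancePreserving (s , 0≤s , s≤D) (t , 0≤t , t≤D) with total s t
      ... | inj₁ s≤t = ≈-trans (preserves 0≤s s≤t t≤D) (≈-sym (dist-≤ s≤t))
      ... | inj₂ t≤s = ≈-trans (d-sym _ _)
                         (≈-trans (preserves 0≤t t≤s s≤D) (≈-sym (dist-≥ t≤s)))

  geodesic⇒ray : Geodesic X x y → ∃[ f ] IsRay x (d x y) f × f (d x y) ≋ y
  geodesic⇒ray {x} {y} g = γ ∘ clamp , isRay , ≋-trans (γ-cong (clamp-id (d≥0 x y) ≤-refl)) end
    where
    open Geodesic g
    D = d x y

    clampBy : ∀ t → Dec (0# ≤ t × t ≤ D) → MetricSpace.Carrier Domain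
    clampBy t (yes p) = t , p
    -- An arbitrary default for parameters outside the domain.
    clampBy t (no  _) = 0# , ≤-refl , d≥0 x y

    clampBy-id : ∀ {t} → 0# ≤ t → t ≤ D → (p? : Dec (0# ≤ t × t ≤ D)) → proj₁ (clampBy t p?) ≈ t
    clampBy-id 0≤t t≤D (yes _) = ≈-refl
    clampBy-id 0≤t t≤D (no ¬p) = contradiction (0≤t , t≤D) ¬p

    clamp : ℝ → MetricSpace.Carrier Domain
    clamp t = clampBy t (em _)

    clamp-id : ∀ {t} → 0# ≤ t → t ≤ D → proj₁ (clamp t) ≈ t
    clamp-id 0≤t t≤D = clampBy-id 0≤t t≤D (em _)

    -- Distance preservation makes `γ` depend on the parameter alone and not on the proofs of its
    -- bounds.
    γ-cong : ∀ {s t} → proj₁ s ≈ proj₁ t → γ s ≋ γ t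
    γ-cong {s} {t} s≈t =
      X.0⇒≈ (≈-trans (distancePreserving s t) (≈⇒dist≈0 s≈t))

    isRay : IsRay x D (γ ∘ clamp)
    isRay = record
      { start     = ≋-trans (γ-cong (clamp-id ≤-refl (d≥0 x y))) start
      ; isometric = λ {s} {t} 0≤s s≤t t≤D → ≈-trans (distancePreserving (clamp s) (clamp t))
          (≈-trans (dist-cong (clamp-id 0≤s (≤-trans s≤t t≤D)) (clamp-id (≤-trans 0≤s s≤t) t≤D))
            (dist-≤ s≤t))
      }

  -- Rays 0 and 1 form the line, ray 2 is the stem. Comparing rays at equal parameters is enough to
  -- keep them apart, because the parameter of a point is its distance from `w`.
  record Fork : Set (a L.⊔ ℓ) where
    field
      w          : Pt
      l          : ℝ
      0<l        : Pos l
      f          : Fin 3 → ℝ → Pt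
      isRay      : ∀ i → IsRay w l (f i)
      opposite   : Between (f 0F l) w (f 1F l)
      stem-left  : Pos s → s ≤ l → ¬ f 2F s ≋ f 0F s
      stem-right : Pos s → s ≤ l → ¬ f 2F s ≋ f 1F s

    private module Ray i = IsRay (isRay i)

    0≤l : 0# ≤ l
    0≤l = ≰⇒≥ 0<l

    -- A shortcut between two intermediate points would make the way between the two ends shorter
    -- than `opposite` allows.
    line-distance : 0# ≤ s → s ≤ l → 0# ≤ t → t ≤ l → d (f 0F s) (f 1F t) ≈ s + t
    line-distance {s} {t} 0≤s s≤l 0≤t t≤l = antisym
      (lin 5 (λ s t D E F → D ≼ E ⊕ F ∷ E ≐ s ∷ F ≐ t ∷ [] ⊢ D ≼ s ⊕ t)
        (△ (f 0F s) w (f 1F t))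
        (≈-trans (d-sym _ _) (Ray.from-start 0F 0≤s s≤l)) (Ray.from-start 1F 0≤t t≤l))
      (lin 10 (λ s t l D E F U V W Z →
          E ⊕ F ≼ D ∷ E ≐ l ∷ F ≐ l ∷ D ≼ U ⊕ V ∷ V ≼ W ⊕ Z ∷ U ≐ l ⊖ s ∷ Z ≐ l ⊖ t ∷ []
          ⊢ s ⊕ t ≼ W)
        opposite
        (≈-trans (d-sym _ _) (Ray.from-start 0F 0≤l ≤-refl)) (Ray.from-start 1F 0≤l ≤-refl)
        (△ (f 0F l) (f 0F s) (f 1F l)) (△ (f 0F s) (f 1F t) (f 1F l))
        (≈-trans (d-sym _ _) (Ray.isometric 0F 0≤s s≤l ≤-refl))
        (Ray.isometric 1F 0≤t t≤l ≤-refl))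

    left-right : Pos s → s ≤ l → ¬ f 0F s ≋ f 1F s
    left-right 0<s s≤l p = 0<s
      (lin 2 (λ s D → D ≐ s ⊕ s ∷ D ≼ 𝟘 ∷ [] ⊢ s ≼ 𝟘)
        (line-distance (≰⇒≥ 0<s) s≤l (≰⇒≥ 0<s) s≤l) (≋⇒d≤0 p))

    apart : ∀ {i j} → i ≢ j → Pos s → s ≤ l → ¬ f i s ≋ f j s
    apart {i = 0F} {0F} i≢j _   _   = contradiction refl i≢j
    apart {i = 0F} {1F} i≢j 0<s s≤l = left-right 0<s s≤l
    apart {i = 0F} {2F} i≢j 0<s s≤l = stem-left 0<s s≤l ∘ ≋-sym
    apart {i = 1F} {0F} i≢j 0<s s≤l = left-right 0<s s≤l ∘ ≋-sym
    apart {i = 1F} {1F} i≢j _   _   = contradiction refl i≢j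
    apart {i = 1F} {2F} i≢j 0<s s≤l = stem-right 0<s s≤l ∘ ≋-sym
    apart {i = 2F} {0F} i≢j 0<s s≤l = stem-left 0<s s≤l
    apart {i = 2F} {1F} i≢j 0<s s≤l = stem-right 0<s s≤l
    apart {i = 2F} {2F} i≢j _   _   = contradiction refl i≢j

    meet : ∀ {i j} → i ≢ j → 0# ≤ s → s ≤ l → 0# ≤ t → t ≤ l →
           f i s ≋ p → f j t ≋ p → p ≋ w
    meet {s = s} {t = t} {i = i} {j = j} i≢j 0≤s s≤l 0≤t t≤l fs≋p ft≋p with em _ {s ≤ 0#}
    ... | yes s≤0 = ≋-trans (≋-sym fs≋p)
                      (≋-sym (d≤0⇒≋ (≤-respˡ (≈-sym (Ray.from-start i 0≤s s≤l)) s≤0)))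
    ... | no  s≰0 = contradiction
      (≋-trans fs≋p (≋-trans (≋-sym ft≋p) (Ray.respects j 0≤t t≤l t≈s)))
      (apart i≢j s≰0 s≤l)
      where
      -- Both parameters are the distance of `p` from `w`.
      t≈s : t ≈ s
      t≈s = ≈-trans (≈-sym (Ray.from-start j 0≤t t≤l))
        (≈-trans (d-congʳ (≋-trans ft≋p (≋-sym fs≋p))) (Ray.from-start i 0≤s s≤l))

    legs : ∀ i → Geodesic X (f i l) w
    legs i = Ray.reversed i 0≤l

    hasTripod : HasTripod X
    hasTripod = (λ p → ∃[ i ] Segment i p) , record
      { x     = λ i → f i l
      ; y     = w
      ; x∈Y   = λ i → i , (0# , ≤-refl , d≥0 _ _) , start i
      ; y∈Y   = 0F , (d _ _ , d≥0 _ _ , ≤-refl) , end 0F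
      ; x≉x   = λ i≢j → apart i≢j 0<l ≤-refl
      ; x≉y   = λ i p → 0<l (≤-respˡ (Ray.from-start i 0≤l ≤-refl) (≋⇒d≤0 (≋-sym p)))
      ; leg   = legs
      ; union = λ p → mk⇔ (λ q → q) (λ q → q)
      ; meet  = λ {i} {j} i≢j p → mk⇔
          (λ (p∈i , p∈j) → let s , 0≤s , s≤l , fs≋p = coordinate p∈i
                               t , 0≤t , t≤l , ft≋p = coordinate p∈j in
            meet i≢j 0≤s s≤l 0≤t t≤l fs≋p ft≋p)
          (λ p≋w → centre∈ i p≋w , centre∈ j p≋w)
      }
      where
      open module Leg i = Geodesic (legs i) using (Segment; start; end)

      coordinate : ∀ {i} → Segment i p → ∃[ s ] 0# ≤ s × s ≤ l × f i s ≋ p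
      coordinate {i = i} ((t , 0≤t , t≤D) , q) = l + - t ,
        lin 3 (λ l t D → D ≐ l ∷ t ≼ D ∷ [] ⊢ 𝟘 ≼ l ⊖ t)
          (≈-trans (d-sym _ _) (Ray.from-start i 0≤l ≤-refl)) t≤D ,
        lin 2 (λ l t → 𝟘 ≼ t ∷ [] ⊢ l ⊖ t ≼ l) 0≤t , q

      centre∈ : ∀ i → p ≋ w → Segment i p
      centre∈ i p≋w = (d _ _ , d≥0 _ _ , ≤-refl) , ≋-trans (end i) (≋-sym p≋w)

  -- Coincidence is a closed condition: if the rays agree at `y` and `e ≤ y + ε`, then at `e` they
  -- are at most `ε + ε` apart.
  lastCoincidence : ∀ {w α β f g m} → IsRay w α f → IsRay w β g → 0# ≤ m → m ≤ α → m ≤ β →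
    ∃[ e ] 0# ≤ e × e ≤ m × f e ≋ g e × (∀ {s} → s ≰ e → s ≤ m → ¬ f s ≋ g s)
  lastCoincidence {f = f} {g} rf rg 0≤m m≤α m≤β =
    maximumOn (λ e → f e ≋ g e) 0≤m (≋-trans F.start (≋-sym G.start))
      λ {e} 0≤e e≤m approx → d≤0⇒≋ (≤-limit λ ε 0<ε →
        let y , fy≋gy , 0≤y , y≤e , e≤y+ε = approx ε 0<ε in
        lin 8 (λ e y ε D U V W Z → D ≼ U ⊕ V ∷ V ≼ W ⊕ Z ∷ W ≼ 𝟘 ∷ U ≐ e ⊖ y ∷ Z ≐ e ⊖ y ∷
                                   e ≼ y ⊕ ε ∷ [] ⊢ D ≼ 𝟘 ⊕ (ε ⊕ ε))
          (△ (f e) (f y) (g e)) (△ (f y) (g y) (g e)) (≋⇒d≤0 fy≋gy)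
          (≈-trans (d-sym _ _) (F.isometric 0≤y y≤e (≤-trans e≤m m≤α)))
          (G.isometric 0≤y y≤e (≤-trans e≤m m≤β)) e≤y+ε)
    where
    module F = IsRay rf
    module G = IsRay rg

-- Geodesic spaces without forks are separated.

module ForkFree (em : ∀ ℓ → ExcludedMiddle ℓ) (R : Reals)
                {a ℓ} (X : Geometry.MetricSpace R a ℓ)
                (geodesic : Geometry.IsGeodesicSpace R X) where
  open Reals R
  open LinearArithmetic R using (lin; _⊢_; _≼_; _≐_; _⊕_; _⊖_; 𝟘)
  open RealProperties em R
  open Geometry R
  open MetricProperties em R X

  Separated : Set (a L.⊔ ℓ)
  Separated = ∀ {a y b} → Between a y b → ¬ y ≋ a → ¬ y ≋ b → ∀ z → SameSide y a z ⊎ SameSide y b z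

  ray : ∀ x y → ∃[ f ] IsRay x (d x y) f × f (d x y) ≋ y
  ray x y = geodesic⇒ray (geodesic x y)

  -- The line consists of `f` after and before the parameter `e`, the stem is `g` after `e`. The
  -- stem cannot meet the part of `f` before `e`, whose points are nearer to `y`.
  forkAt : ∀ {y α β f g e l} → IsRay y α f → IsRay y β g →
    0# ≤ e → Pos l → l ≤ e → e + l ≤ α → e + l ≤ β → g e ≋ f e →
    (∀ {s} → Pos s → s ≤ l → ¬ g (e + s) ≋ f (e + s)) → Fork
  forkAt {y} {α} {β} {f} {g} {e} {l} rf rg 0≤e 0<l l≤e e+l≤α e+l≤β ge≋fe stem = record
    { w     = f e
    ; l     = l
    ; 0<l   = 0<l
    ; f     = λ { 0F s → f (e + s) ; 1F s → f (e + - s) ; 2F s → g (e + s) }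
    ; isRay = λ { 0F → r₀ ; 1F → r₁ ; 2F → IsRay.rebase r₂ ge≋fe }
    ; opposite = lin 5 (λ e l D E F → D ≐ (e ⊕ l) ⊖ (e ⊖ l) ∷ E ≐ l ∷ F ≐ l ∷ [] ⊢ E ⊕ F ≼ D)
        (≈-trans (d-sym _ _) (IsRay.isometric rf (x≤y⇒0≤y-x l≤e)
          (lin 2 (λ e l → 𝟘 ≼ l ∷ [] ⊢ e ⊖ l ≼ e ⊕ l) 0≤l) e+l≤α))
        (≈-trans (d-sym _ _) (IsRay.from-start r₀ 0≤l ≤-refl))
        (IsRay.from-start r₁ 0≤l ≤-refl)
    ; stem-left  = stem
    ; stem-right = λ {s} 0<s s≤l p → 0<s
        (lin 4 (λ e s D E → D ≐ E ∷ D ≐ e ⊕ s ∷ E ≐ e ⊖ s ∷ [] ⊢ s ≼ 𝟘)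
          (d-congʳ {z = y} p)
          (IsRay.from-start rg (+-nonNeg 0≤e (≰⇒≥ 0<s)) (≤-trans (+-mono-≤ ≤-refl s≤l) e+l≤β))
          (IsRay.from-start rf (x≤y⇒0≤y-x (≤-trans s≤l l≤e))
            (lin 4 (λ e s l α → 𝟘 ≼ s ∷ 𝟘 ≼ l ∷ e ⊕ l ≼ α ∷ [] ⊢ e ⊖ s ≼ α) (≰⇒≥ 0<s) 0≤l e+l≤α)))
    }
    where
    0≤l = ≰⇒≥ 0<l
    +-nonNeg : ∀ {s t} → 0# ≤ s → 0# ≤ t → 0# ≤ s + t
    +-nonNeg = lin 2 (λ e s → 𝟘 ≼ e ∷ 𝟘 ≼ s ∷ [] ⊢ 𝟘 ≼ e ⊕ s)
    room : ∀ {γ} → e + l ≤ γ → l ≤ γ + - e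
    room = lin 3 (λ e l γ → e ⊕ l ≼ γ ∷ [] ⊢ l ≼ γ ⊖ e)
    within : ∀ {γ} → e + l ≤ γ → e ≤ γ
    within = lin 3 (λ e l γ → 𝟘 ≼ l ∷ e ⊕ l ≼ γ ∷ [] ⊢ e ≼ γ) 0≤l
    r₀ = IsRay.shorten (IsRay.forward rf 0≤e (within e+l≤α)) (room e+l≤α)
    r₁ = IsRay.shorten (IsRay.backward rf 0≤e (within e+l≤α)) l≤e
    r₂ = IsRay.shorten (IsRay.forward rg 0≤e (within e+l≤β)) (room e+l≤β)

  covers : ∀ {y a z f g e} → IsRay y (d y a) f → f (d y a) ≋ a → IsRay y (d y z) g → g (d y z) ≋ z →
    0# ≤ e → e ≤ d y a → e ≤ d y z → g e ≋ f e → d y a ≤ e → Between y a z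
  covers {y} {a} {z} {f} {g} {e} rf f≋a rg g≋z 0≤e e≤α e≤β ge≋fe α≤e =
    lin 4 (λ α β e D → D ≐ β ⊖ e ∷ α ≼ e ∷ [] ⊢ α ⊕ D ≼ β)
      (≈-trans (d-congˡ a≋ge) (≈-trans (d-congʳ (≋-sym g≋z)) (IsRay.isometric rg 0≤e e≤β ≤-refl)))
      α≤e
    where
    a≋ge : a ≋ g e
    a≋ge = ≋-trans (≋-sym f≋a)
      (≋-trans (IsRay.respects rf (d≥0 y a) ≤-refl (antisym α≤e e≤α)) (≋-sym ge≋fe))

  -- Consider the last parameter at which the two geodesics coincide. At an end of one of them, that
  -- end lies on the other geodesic; at 0, they part immediately; anywhere else, they form a fork.
  diverge : ¬ Fork → ∀ {y a z f g} →
    IsRay y (d y a) f → f (d y a) ≋ a → IsRay y (d y z) g → g (d y z) ≋ z →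
    SameSide y a z ⊎ (∀ {s} → Pos s → s ≤ d y a → s ≤ d y z → ¬ g s ≋ f s)
  diverge noFork {y} {a} {z} {f} {g} rf f≋a rg g≋z =
    let e , 0≤e , e≤m , ge≋fe , max =
          lastCoincidence rg rf (⊓-glb (d≥0 y a) (d≥0 y z)) (x⊓y≤y _ _) (x⊓y≤x _ _)
    in cases 0≤e (≤-trans e≤m (x⊓y≤x _ _)) (≤-trans e≤m (x⊓y≤y _ _)) ge≋fe
         (λ s≰e s≤α s≤β → max s≰e (⊓-glb s≤α s≤β)) (em _) (em _) (em _)
    where
    cases : ∀ {e} → 0# ≤ e → e ≤ d y a → e ≤ d y z → g e ≋ f e →
      (∀ {s} → s ≰ e → s ≤ d y a → s ≤ d y z → ¬ g s ≋ f s) →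
      Dec (d y a ≤ e) → Dec (d y z ≤ e) → Dec (e ≤ 0#) →
      SameSide y a z ⊎ (∀ {s} → Pos s → s ≤ d y a → s ≤ d y z → ¬ g s ≋ f s)
    cases 0≤e e≤α e≤β ge≋fe max (yes α≤e) _ _ =
      inj₁ (inj₁ (covers rf f≋a rg g≋z 0≤e e≤α e≤β ge≋fe α≤e))
    cases 0≤e e≤α e≤β ge≋fe max (no _) (yes β≤e) _ =
      inj₁ (inj₂ (covers rg g≋z rf f≋a 0≤e e≤β e≤α (≋-sym ge≋fe) β≤e))
    cases 0≤e e≤α e≤β ge≋fe max (no _) (no _) (yes e≤0) =
      inj₂ λ 0<s → max (λ s≤e → 0<s (≤-trans s≤e e≤0))
    cases {e} 0≤e e≤α e≤β ge≋fe max (no α≰e) (no β≰e) (no 0<e) =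
      -- The length `l` has to fit on both geodesics after `e`, and before `e` on the one that also
      -- supplies the backward leg.
      let l′ , 0<l′ , l′≤α-e , l′≤β-e = pos-⊓ (gap α≰e) (gap β≰e)
          l , 0<l , l≤l′ , l≤e = pos-⊓ 0<l′ 0<e
          e+s≤α = λ {s} (s≤l : s ≤ l) → room (≤-trans s≤l (≤-trans l≤l′ l′≤α-e))
          e+s≤β = λ {s} (s≤l : s ≤ l) → room (≤-trans s≤l (≤-trans l≤l′ l′≤β-e))
      in contradiction
        (forkAt rf rg 0≤e 0<l l≤e (e+s≤α ≤-refl) (e+s≤β ≤-refl) ge≋fe
          λ 0<s s≤l → max (beyond 0<s) (e+s≤α s≤l) (e+s≤β s≤l))
        noFork
      where
      gap : ∀ {α} → α ≰ e → Pos (α + - e)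
      gap α≰e p = α≰e (lin 2 (λ α e → α ⊖ e ≼ 𝟘 ∷ [] ⊢ α ≼ e) p)
      room : ∀ {s α} → s ≤ α + - e → e + s ≤ α
      room = lin 3 (λ e s α → s ≼ α ⊖ e ∷ [] ⊢ e ⊕ s ≼ α)
      beyond : ∀ {s} → Pos s → e + s ≰ e
      beyond 0<s p = 0<s (lin 2 (λ e s → e ⊕ s ≼ e ∷ [] ⊢ s ≼ 𝟘) p)

  forkFrom : ∀ {y l f g h} → Pos l → IsRay y l f → IsRay y l g → IsRay y l h →
    Between (f l) y (g l) → (∀ {s} → Pos s → s ≤ l → ¬ h s ≋ f s) →
    (∀ {s} → Pos s → s ≤ l → ¬ h s ≋ g s) → Fork
  forkFrom {y} {l} {f} {g} {h} 0<l rf rg rh opposite stem₀ stem₁ = record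
    { w          = y
    ; l          = l
    ; 0<l        = 0<l
    ; f          = λ { 0F → f ; 1F → g ; 2F → h }
    ; isRay      = λ { 0F → rf ; 1F → rg ; 2F → rh }
    ; opposite   = opposite
    ; stem-left  = stem₀
    ; stem-right = stem₁
    }

  -- If `z` were on neither side, then by `diverge` the geodesic to `z` would leave those to `a` and
  -- `b` at once. As `y` is between `a` and `b`, these would be the line of a fork at `y` whose stem
  -- points to `z`.
  noFork⇒separated : ¬ Fork → Separated
  noFork⇒separated noFork {a} {y} {b} ayb y≉a y≉b z = cases (em _)
    where
    cases : Dec (y ≋ z) → SameSide y a z ⊎ SameSide y b z
    cases (yes y≋z) = inj₁ (inj₂
      (lin 4 (λ yz za ya zy → yz ≼ 𝟘 ∷ yz ≐ zy ∷ za ≼ zy ⊕ ya ∷ [] ⊢ yz ⊕ za ≼ ya)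
        (≋⇒d≤0 y≋z) (d-sym _ _) (△ z y a)))
    cases (no y≉z) =
      let f , rf , f≋a = ray y a
          g , rg , g≋b = ray y b
          h , rh , h≋z = ray y z
      in byContradiction λ neither →
        let stem₀ = [ (λ side → contradiction (inj₁ side) neither) , (λ stem {s} → stem {s}) ]′
                      (diverge noFork rf f≋a rh h≋z)
            stem₁ = [ (λ side → contradiction (inj₂ side) neither) , (λ stem {s} → stem {s}) ]′
                      (diverge noFork rg g≋b rh h≋z)
            l′ , 0<l′ , l′≤α , l′≤β = pos-⊓ (≉⇒pos y≉a) (≉⇒pos y≉b)
            l , 0<l , l≤l′ , l≤ζ = pos-⊓ 0<l′ (≉⇒pos y≉z)
            0≤l = ≰⇒≥ 0<l
            l≤α = ≤-trans l≤l′ l′≤α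
            l≤β = ≤-trans l≤l′ l′≤β
        in noFork (forkFrom 0<l (IsRay.shorten rf l≤α) (IsRay.shorten rg l≤β) (IsRay.shorten rh l≤ζ)
          -- Truncated legs stay opposite: a shortcut from `f l` to `g l` would yield one from `a`
          -- to `b`.
          (lin 11 (λ l ya ay yb ab fl gl af fg fb gb →
            ay ⊕ yb ≼ ab ∷ ay ≐ ya ∷ ab ≼ af ⊕ fb ∷ fb ≼ fg ⊕ gb ∷ af ≐ ya ⊖ l ∷ gb ≐ yb ⊖ l ∷
            fl ≐ l ∷ gl ≐ l ∷ [] ⊢ fl ⊕ gl ≼ fg)
            ayb (d-sym a y) (△ a (f l) b) (△ (f l) (g l) b)
            (≈-trans (d-congˡ (≋-sym f≋a)) (≈-trans (d-sym _ _) (IsRay.isometric rf 0≤l l≤α ≤-refl)))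
            (≈-trans (d-congʳ (≋-sym g≋b)) (IsRay.isometric rg 0≤l l≤β ≤-refl))
            (≈-trans (d-sym _ _) (IsRay.from-start rf 0≤l l≤α)) (IsRay.from-start rg 0≤l l≤β))
          (λ 0<s s≤l → stem₀ 0<s (≤-trans s≤l l≤α) (≤-trans s≤l l≤ζ))
          (λ 0<s s≤l → stem₁ 0<s (≤-trans s≤l l≤β) (≤-trans s≤l l≤ζ)))

-- Sides of a point in a separated space.

module SeparatedSpace (em : ∀ ℓ → ExcludedMiddle ℓ) (R : Reals)
                      {a ℓ} (X : Geometry.MetricSpace R a ℓ)
                      (geodesic : Geometry.IsGeodesicSpace R X)
                      (separated : ForkFree.Separated em R X geodesic) where
  open Reals R
  open LinearArithmetic R using (lin; _⊢_; _≼_; _≐_; _⊕_; _⊖_; 𝟘)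
  open RealProperties em R
  open Geometry R
  open MetricProperties em R X
  open ForkFree em R X geodesic using (ray)

  private
    variable
      x y z w o b m p : Pt

  between-sym : Between x y z → Between z y x
  between-sym {x} {y} {z} =
    lin 6 (λ xy yz xz yx zy zx → xy ≐ yx ∷ yz ≐ zy ∷ xz ≐ zx ∷ xy ⊕ yz ≼ xz ∷ [] ⊢ zy ⊕ yx ≼ zx)
      (d-sym x y) (d-sym y z) (d-sym x z)

  between-trans : Between o z p → Between o p w → Between o z w
  between-trans {o} {z} {p} {w} = lin 6 (λ zw zp pw oz op ow →
    zw ≼ zp ⊕ pw ∷ oz ⊕ zp ≼ op ∷ op ⊕ pw ≼ ow ∷ [] ⊢ oz ⊕ zw ≼ ow) (△ z p w)

  module _ {o p b} (pob : Between p o b) (o≉p : ¬ o ≋ p) (o≉b : ¬ o ≋ b) where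

    inner-opposite : Between o z p → Between z o b
    inner-opposite {z} ozp =
      lin 8 (λ po ob pb oz zp zo zb pz →
        po ⊕ ob ≼ pb ∷ oz ⊕ zp ≼ po ∷ oz ≐ zo ∷ zp ≐ pz ∷ pb ≼ pz ⊕ zb ∷ [] ⊢ zo ⊕ ob ≼ zb)
        pob (≤-respʳ (d-sym o p) ozp) (d-sym o z) (d-sym z p) (△ p z b)

    -- If `z` and `w` both lie beyond `p`, separation is applied at `p`. If both lie between `o` and
    -- `p`, it is applied at `o`, which is also between `z` and `b`. The mixed cases follow by
    -- transitivity.
    collinear : SameSide o p z → SameSide o p w → SameSide o z w
    collinear {z} {w} (inj₁ opz) (inj₁ opw) = cases (em _)
      where
      cases : Dec (p ≋ z) → SameSide o z w
      cases (yes p≋z) = inj₁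
        (lin 7 (λ op pz oz pw ow zp zw →
          pz ≼ 𝟘 ∷ pz ≐ zp ∷ zw ≼ zp ⊕ pw ∷ oz ≼ op ⊕ pz ∷ op ⊕ pw ≼ ow ∷ [] ⊢ oz ⊕ zw ≼ ow)
          (≋⇒d≤0 p≋z) (d-sym p z) (△ z p w) (△ o p z) opw)
      cases (no p≉z) with separated opz (o≉p ∘ ≋-sym) p≉z w
      ... | inj₁ (inj₁ pow) = contradiction
        (lin 4 (λ po op ow pw → po ≐ op ∷ po ⊕ ow ≼ pw ∷ op ⊕ pw ≼ ow ∷ [] ⊢ op ≼ 𝟘)
          (d-sym p o) pow opw)
        (≉⇒pos o≉p)
      ... | inj₁ (inj₂ pwo) = inj₂
        (lin 9 (λ po op wo ow pw oz wz wp pz →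
          po ≐ op ∷ wo ≐ ow ∷ wp ≐ pw ∷ pw ⊕ wo ≼ po ∷ op ⊕ pw ≼ ow ∷ wz ≼ wp ⊕ pz ∷ ow ≼ op ⊕ pw ∷
          op ⊕ pz ≼ oz ∷ [] ⊢ ow ⊕ wz ≼ oz)
          (d-sym p o) (d-sym w o) (d-sym w p) pwo opw (△ w p z) (△ o p w) opz)
      ... | inj₂ (inj₁ pzw) = inj₁
        (lin 6 (λ op pz zw pw oz ow →
          pz ⊕ zw ≼ pw ∷ oz ≼ op ⊕ pz ∷ op ⊕ pw ≼ ow ∷ [] ⊢ oz ⊕ zw ≼ ow)
          pzw (△ o p z) opw)
      ... | inj₂ (inj₂ pwz) = inj₂
        (lin 6 (λ op pz zw pw oz ow →
          pz ⊕ zw ≼ pw ∷ oz ≼ op ⊕ pz ∷ op ⊕ pw ≼ ow ∷ [] ⊢ oz ⊕ zw ≼ ow)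
          pwz (△ o p w) opz)
    collinear (inj₂ ozp) (inj₁ opw) = inj₁ (between-trans ozp opw)
    collinear (inj₁ opz) (inj₂ owp) = inj₂ (between-trans owp opz)
    collinear {z} {w} (inj₂ ozp) (inj₂ owp) = cases (em _)
      where
      cases : Dec (o ≋ z) → SameSide o z w
      cases (yes o≋z) = inj₁
        (lin 4 (λ oz zo ow zw → oz ≼ 𝟘 ∷ oz ≐ zo ∷ zw ≼ zo ⊕ ow ∷ [] ⊢ oz ⊕ zw ≼ ow)
          (≋⇒d≤0 o≋z) (d-sym o z) (△ z o w))
      cases (no o≉z) with separated (inner-opposite ozp) o≉z o≉b w
      ... | inj₁ side       = side
      ... | inj₂ (inj₁ obw) = contradiction
        (lin 5 (λ ob bw ow wo wb →
          ob ⊕ bw ≼ ow ∷ wo ⊕ ob ≼ wb ∷ wo ≐ ow ∷ wb ≐ bw ∷ [] ⊢ ob ≼ 𝟘)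
          obw (inner-opposite owp) (d-sym w o) (d-sym w b))
        (≉⇒pos o≉b)
      ... | inj₂ (inj₂ owb) = inj₂
        (lin 6 (λ ob wb ow wo wz oz →
          ow ⊕ wb ≼ ob ∷ wo ⊕ ob ≼ wb ∷ wo ≐ ow ∷ wz ≼ wo ⊕ oz ∷ [] ⊢ ow ⊕ wz ≼ oz)
          owb (inner-opposite owp) (d-sym w o) (△ w o z))

  -- If both alternatives failed at `z`, they would fail by some positive `η`. Moving `z` by at most
  -- ε changes either defect by at most 2ε, so for 3ε ≤ η both fail at `z′` too.
  sameSide-closed : (∀ ε → Pos ε → ∃[ z′ ] SameSide o p z′ × d z z′ ≤ ε) → SameSide o p z
  sameSide-closed {o} {p} {z} approx = byContradiction λ neither →
    let η , 0<η , η≤₁ , η≤₂ = pos-⊓ (positive (neither ∘ inj₁)) (positive (neither ∘ inj₂))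
        ε , 0<ε , 3ε≤η = pos-third 0<η
        z′ , side , zz′≤ε = approx ε 0<ε
    in 0<ε (tooClose side zz′≤ε 3ε≤η η≤₁ η≤₂)
    where
    positive : ∀ {s t} → s ≰ t → Pos (s + - t)
    positive s≰t q = s≰t (lin 2 (λ s t → s ⊖ t ≼ 𝟘 ∷ [] ⊢ s ≼ t) q)

    tooClose : ∀ {z′ ε η} → SameSide o p z′ → d z z′ ≤ ε → ε + (ε + ε) ≤ η →
      η ≤ d o p + d p z + - d o z → η ≤ d o z + d z p + - d o p → ε ≤ 0#
    tooClose {z′} (inj₁ opz′) near 3ε≤η η≤ _ =
      lin 9 (λ ε η op pz oz pz′ oz′ zz′ z′z →
        op ⊕ pz′ ≼ oz′ ∷ zz′ ≼ ε ∷ ε ⊕ (ε ⊕ ε) ≼ η ∷ η ≼ op ⊕ pz ⊖ oz ∷ zz′ ≐ z′z ∷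
        pz ≼ pz′ ⊕ z′z ∷ oz′ ≼ oz ⊕ zz′ ∷ [] ⊢ ε ≼ 𝟘)
        opz′ near 3ε≤η η≤ (d-sym z z′) (△ p z′ z) (△ o z z′)
    tooClose {z′} (inj₂ oz′p) near 3ε≤η _ η≤ =
      lin 9 (λ ε η op zp oz z′p oz′ zz′ z′z →
        oz′ ⊕ z′p ≼ op ∷ zz′ ≼ ε ∷ ε ⊕ (ε ⊕ ε) ≼ η ∷ η ≼ oz ⊕ zp ⊖ op ∷ zz′ ≐ z′z ∷
        zp ≼ zz′ ⊕ z′p ∷ oz ≼ oz′ ⊕ z′z ∷ [] ⊢ ε ≼ 𝟘)
        oz′p near 3ε≤η η≤ (d-sym z z′) (△ z z′ p) (△ o z′ z)

  Closed : ∀ {q} → Pred Pt q → Set _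
  Closed A = ∀ {z} → (∀ ε → Pos ε → ∃[ z′ ] A z′ × d z z′ ≤ ε) → A z

  -- Geodesics are connected.
  crossing : ∀ {q} {A B : Pred Pt q} → Closed A → Closed B → (∀ z → A z ⊎ B z) →
    ∀ {x y} → A x → B y → ∃[ m ] A m × B m × Between x m y
  crossing {A = A} {B} closedA closedB cover {x} {y} ax by =
    let f , rf , f≋y = ray x y in go f rf f≋y
    where
    respect : ∀ {q} {C : Pred Pt q} → Closed C → ∀ {z w} → z ≋ w → C z → C w
    respect closed z≋w cz = closed λ ε 0<ε →
      _ , cz , ≤-trans (≋⇒d≤0 (≋-sym z≋w)) (≰⇒≥ 0<ε)

    go : ∀ f → IsRay x (d x y) f → f (d x y) ≋ y → ∃[ m ] A m × B m × Between x m y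
    go f rf f≋y =
      -- The crossing point is the last point of `A` on the geodesic. Either it is the end `y`, or
      -- all later points belong to `B` and so does their limit.
      let e , 0≤e , e≤D , ae , max = maximumOn (A ∘ f) (d≥0 x y) (respect closedA (≋-sym rf.start) ax)
            λ 0≤e e≤D approx → closedA λ ε 0<ε →
              let t , at , 0≤t , t≤e , e≤t+ε = approx ε 0<ε in
              f t , at , lin 4 (λ e t ε D → D ≐ e ⊖ t ∷ e ≼ t ⊕ ε ∷ [] ⊢ D ≼ ε)
                (≈-trans (d-sym _ _) (rf.isometric 0≤t t≤e e≤D)) e≤t+ε
      in f e , ae ,
         other 0≤e e≤D (λ s≰e s≤D → [ (λ as → contradiction as (max s≰e s≤D)) , id ]′ (cover _)) (em _) ,
         lin 5 (λ e xy xf ff fy → xf ≐ e ∷ ff ≐ xy ⊖ e ∷ fy ≐ ff ∷ [] ⊢ xf ⊕ fy ≼ xy)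
           (rf.from-start 0≤e e≤D) (rf.isometric 0≤e e≤D ≤-refl) (d-congʳ (≋-sym f≋y))
      where
      module rf = IsRay rf
      other : ∀ {e} → 0# ≤ e → e ≤ d x y → (∀ {s} → s ≰ e → s ≤ d x y → B (f s)) →
              Dec (d x y ≤ e) → B (f e)
      other 0≤e e≤D later (yes D≤e) =
        respect closedB (≋-trans (≋-sym f≋y) (rf.respects (d≥0 x y) ≤-refl (antisym D≤e e≤D))) by
      other {e} 0≤e e≤D later (no D≰e) = closedB λ ε 0<ε →
        let η , 0<η , η≤ε , η≤ = pos-⊓ 0<ε (λ q → D≰e (lin 2 (λ D e → D ⊖ e ≼ 𝟘 ∷ [] ⊢ D ≼ e) q))
            e+η≤D = lin 3 (λ e η D → η ≼ D ⊖ e ∷ [] ⊢ e ⊕ η ≼ D) η≤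
        in f (e + η) ,
           later (λ q → 0<η (lin 2 (λ e η → e ⊕ η ≼ e ∷ [] ⊢ η ≼ 𝟘) q)) e+η≤D ,
           lin 4 (λ e η ε D → D ≐ (e ⊕ η) ⊖ e ∷ η ≼ ε ∷ [] ⊢ D ≼ ε)
             (rf.isometric 0≤e (lin 2 (λ e η → 𝟘 ≼ η ∷ [] ⊢ e ≼ e ⊕ η) (≰⇒≥ 0<η)) e+η≤D) η≤ε

-- Similarities from maps that scale distances; images of isometries into the line.

module Embeddings (em : ∀ ℓ → ExcludedMiddle ℓ) (R : Reals)
                  {a ℓ} (X : Geometry.MetricSpace R a ℓ)
                  (geodesic : Geometry.IsGeodesicSpace R X) where
  open Reals R
  open LinearArithmetic R using (lin; _⊢_; _≼_; _≐_; _⊕_; _⊖_; 𝟘)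
  open RealProperties em R
  open Geometry R
  open MetricProperties em R X
  open ForkFree em R X geodesic using (ray)

  similar : ∀ {a′ ℓ′} {Y : MetricSpace a′ ℓ′} (let module Y = MetricSpace Y) {r} → Pos r →
    (f : Pt → Y.Carrier) → (∀ x x′ → Y.d (f x) (f x′) ≈ r * d x x′) →
    (∀ y → ∃[ x ] f x Y.≈ y) → SimilarWithRatio X Y r
  similar {Y = Y} {r} 0<r f scales onto = record
    { to        = f
    ; cong      = f-cong
    ; bijective =
        (λ {x} {x′} p → d≤0⇒≋ (*-cancelˡ-≤ (≤-reflexive
          (≈-trans (≈-sym (scales x x′)) (≈-trans (Y.≈⇒0 p) (≈-sym (zeroʳ r))))))) ,
        (λ y → let x , fx≈y = onto y in x , λ z≋x → Y.EqC.trans (f-cong z≋x) fx≈y)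
    } , scales
    where
    module Y = MetricSpace Y
    open Inverse 0<r using (*-cancelˡ-≤)
    f-cong : ∀ {x x′} → x ≋ x′ → f x Y.≈ f x′
    f-cong {x} {x′} x≋x′ = Y.0⇒≈ (≈-trans (scales x x′)
      (≈-trans (*-cong ≈-refl (antisym (≋⇒d≤0 x≋x′) (d≥0 x x′))) (zeroʳ r)))

  module _ (f : Pt → ℝ) (isometry : ∀ x y → dist (f x) (f y) ≈ d x y) where

    -- `True (em _)` brings the existence statement down to level 0, where the predicates of
    -- `Interval` live.
    Image : Pred ℝ 0ℓ
    Image t = True (em _ {∃[ x ] f x ≈ t})

    private
      -- The distance to `x` bounds `f z` from above, the distance to `y` bounds it from below.
      along : ∀ {x y z e} → d x z ≈ e → d z y ≈ d x y + - e → f x ≤ f y → f z ≈ f x + e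
      along {x} {y} {z} {e} p q fx≤fy = antisym
        (lin 4 (λ fx fz xz e → fz ⊖ fx ≼ xz ∷ xz ≐ e ∷ [] ⊢ fz ≼ fx ⊕ e)
          (≤-respʳ (isometry z x) (x≤∣x∣ _)) (≈-trans (d-sym z x) p))
        (lin 6 (λ fx fy fz xy zy e →
          fy ⊖ fz ≼ zy ∷ xy ≐ fy ⊖ fx ∷ zy ≐ xy ⊖ e ∷ [] ⊢ fx ⊕ e ≼ fz)
          (≤-respʳ (≈-trans (isometry y z) (d-sym y z)) (x≤∣x∣ _))
          (≈-trans (≈-sym (isometry x y)) (dist-≤ fx≤fy)) q)

      along′ : ∀ {x y z e} → d x z ≈ e → d z y ≈ d x y + - e → f y ≤ f x → f z + e ≈ f x
      along′ {x} {y} {z} {e} p q fy≤fx = antisym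
        (lin 6 (λ fx fy fz xy zy e →
          fz ⊖ fy ≼ zy ∷ xy ≐ fx ⊖ fy ∷ zy ≐ xy ⊖ e ∷ [] ⊢ fz ⊕ e ≼ fx)
          (≤-respʳ (isometry z y) (x≤∣x∣ _))
          (≈-trans (≈-sym (isometry x y)) (dist-≥ fy≤fx)) q)
        (lin 4 (λ fx fz xz e → fx ⊖ fz ≼ xz ∷ xz ≐ e ∷ [] ⊢ fx ≼ fz ⊕ e)
          (≤-respʳ (isometry x z) (x≤∣x∣ _)) p)

      module _ {x y : Pt} {t} (0≤t : 0# ≤ t) (t≤1 : t ≤ 1#) where
        e = t * d x y

        0≤e : 0# ≤ e
        0≤e = *-nonNeg 0≤t (d≥0 x y)

        e≤D : e ≤ d x y
        e≤D = ≤-respˡ (*-comm _ t) (≤-respʳ (*-identityʳ _) (*-monoʳ-≤ (d≥0 x y) t≤1))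

        combination : (1# + - t) * f x + t * f y ≈ f x + t * f y + - (t * f x)
        combination = ≈-trans
          (+-cong (≈-trans (distribʳ (f x) 1# (- t))
            (+-cong (*-identityˡ (f x)) (≈-sym (-‿distribˡ-* t (f x))))) ≈-refl)
          (lin 3 (λ x tx ty → [] ⊢ (x ⊖ tx) ⊕ ty ≐ (x ⊕ ty) ⊖ tx))

        times-difference : ∀ {u v} → d x y ≈ u + - v → e ≈ t * u + - (t * v)
        times-difference {u} {v} D≈ = ≈-trans (*-cong ≈-refl D≈)
          (≈-trans (distribˡ t u (- v)) (+-cong ≈-refl (≈-sym (-‿distribʳ-* t v))))

        -- The witness is the point at distance `t * d x y` from `x` on a geodesic to `y`.
        interpolate : ∃[ z ] f z ≈ (1# + - t) * f x + t * f y
        interpolate =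
          let g , rg , gD≋y = ray x y
              p = IsRay.from-start rg 0≤e e≤D
              q = ≈-trans (d-congʳ (≋-sym gD≋y)) (IsRay.isometric rg 0≤e e≤D ≤-refl)
          in g e , ≈-trans
            ([ (λ fx≤fy → lin 5 (λ fx fz e tx ty →
                 fz ≐ fx ⊕ e ∷ e ≐ ty ⊖ tx ∷ [] ⊢ fz ≐ (fx ⊕ ty) ⊖ tx)
                 (along p q fx≤fy)
                 (times-difference (≈-trans (≈-sym (isometry x y)) (dist-≤ fx≤fy))))
             , (λ fy≤fx → lin 5 (λ fx fz e tx ty →
                 fz ⊕ e ≐ fx ∷ e ≐ tx ⊖ ty ∷ [] ⊢ fz ≐ (fx ⊕ ty) ⊖ tx)
                 (along′ p q fy≤fx)
                 (times-difference (≈-trans (≈-sym (isometry x y)) (dist-≥ fy≤fx))))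
             ]′ (total (f x) (f y)))
            (≈-sym combination)

    image-interval : Interval Image
    image-interval = record
      { respects = λ s≈t p → let x , fx≈s = toWitness p in fromWitness (x , ≈-trans fx≈s s≈t)
      ; convex   = λ p q 0≤t t≤1 →
          let x , fx≈ = toWitness p
              y , fy≈ = toWitness q
              z , fz≈ = interpolate {x} {y} 0≤t t≤1
          in fromWitness (z , ≈-trans fz≈ (+-cong (*-cong ≈-refl fx≈) (*-cong ≈-refl fy≈)))
      }

    isometry⇒interval : ∃[ I ] Interval I × Isometric X ⟦ I ⟧
    isometry⇒interval = Image , image-interval ,
      similar {Y = ⟦ Image ⟧} pos-1 (λ x → f x , fromWitness (x , ≈-refl))
        (λ x y → ≈-trans (isometry x y) (≈-sym (*-identityˡ _)))
        (λ (t , p) → toWitness p)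

-- Separated geodesic spaces are intervals or circles.

module Classification (em : ∀ ℓ → ExcludedMiddle ℓ) (R : Reals)
                      {a ℓ} (X : Geometry.MetricSpace R a ℓ)
                      (geodesic : Geometry.IsGeodesicSpace R X)
                      (separated : ForkFree.Separated em R X geodesic) where
  open Reals R
  open LinearArithmetic R using (lin; _⊢_; _≼_; _≐_; _⊕_; _⊖_; ⊝_; 𝟘)
  open RealProperties em R
  open Geometry R
  open MetricProperties em R X
  open ForkFree em R X geodesic using (ray)
  open SeparatedSpace em R X geodesic separated
  open Embeddings em R X geodesic

  private
    variable
      x y z w p q : Pt

  between≈ : Between x y z → d x y + d y z ≈ d x z
  between≈ xyz = antisym xyz (△ _ _ _)

  sameSide≈ : ∀ {o} → SameSide o z w → d o z + d z w ≈ d o w ⊎ d o w + d z w ≈ d o z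
  sameSide≈ {z} {w} = Sum.map between≈ (λ owz → ≈-trans (+-cong ≈-refl (d-sym z w)) (between≈ owz))

  module Side {p o q} (poq : Between p o q) (o≉p : ¬ o ≋ p) (o≉q : ¬ o ≋ q) where

    -- A point strictly between `o` and `p` is opposite to `q` and so cannot be on the side of `q`.
    common-far : ∀ {m} → SameSide o p m → SameSide o q m → ¬ o ≋ m → Between o p m
    common-far (inj₁ opm) _ _ = opm
    common-far {m} (inj₂ omp) side o≉m = ⊥-elim
      ([ (λ oqm → o≉q (d≤0⇒≋
           (lin 6 (λ mo oq mq om qm qo → mo ⊕ oq ≼ mq ∷ oq ⊕ qm ≼ om ∷ mo ≐ om ∷ mq ≐ qm ∷
                                         qo ≐ oq ∷ [] ⊢ oq ≼ 𝟘)
             moq oqm (d-sym m o) (d-sym m q) (d-sym q o))))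
       , (λ omq → o≉m (d≤0⇒≋
           (lin 4 (λ mo oq mq om → mo ⊕ oq ≼ mq ∷ om ⊕ mq ≼ oq ∷ mo ≐ om ∷ [] ⊢ om ≼ 𝟘)
             moq omq (d-sym m o))))
       ]′ side)
      where moq = inner-opposite poq o≉p o≉q omp

    -- Distances from `m` are `d o m` minus distances from `o`, so those of `p` and `q` differ by
    -- the difference of `d o p` and `d o q`. On one side of `m` this would be `d p q`, which is
    -- their sum.
    not-sameSide : ∀ {m} → Between o p m → Between o q m → ¬ SameSide m p q
    not-sameSide {m} opm oqm (inj₁ mpq) = o≉q (d≤0⇒≋
      (lin 9 (λ om op pm oq qm po pq mp mq →
        om ≼ op ⊕ pm ∷ oq ⊕ qm ≼ om ∷ po ⊕ oq ≼ pq ∷ mp ⊕ pq ≼ mq ∷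
        po ≐ op ∷ mp ≐ pm ∷ mq ≐ qm ∷ [] ⊢ oq ≼ 𝟘)
        (△ o p m) oqm poq mpq (d-sym p o) (d-sym m p) (d-sym m q)))
    not-sameSide {m} opm oqm (inj₂ mqp) = o≉p (d≤0⇒≋
      (lin 10 (λ om op pm oq qm po pq mp mq qp →
        om ≼ oq ⊕ qm ∷ op ⊕ pm ≼ om ∷ po ⊕ oq ≼ pq ∷ mq ⊕ qp ≼ mp ∷
        po ≐ op ∷ mp ≐ pm ∷ mq ≐ qm ∷ qp ≐ pq ∷ [] ⊢ op ≼ 𝟘)
        (△ o q m) opm poq mqp (d-sym p o) (d-sym m p) (d-sym m q) (d-sym q p)))

    same : SameSide o p z → SameSide o p w → SameSide o z w
    same = collinear poq o≉p o≉q

    -- Beyond m the two rays from m through p and q to o would have to agree.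
    antipodal : ∀ {m} → Between o p m → Between o q m → SameSide o p w → Between o w m
    antipodal {w} {m} opm oqm side = cases (same (inj₁ opm) side) (em _)
      where
      m≉o : ¬ m ≋ o
      m≉o m≋o = o≉p (d≤0⇒≋ (lin 4 (λ op pm om mo → op ⊕ pm ≼ om ∷ om ≐ mo ∷ mo ≼ 𝟘 ∷ 𝟘 ≼ pm ∷ [] ⊢ op ≼ 𝟘)
        opm (d-sym o m) (≋⇒d≤0 m≋o) (d≥0 p m)))
      cases : SameSide o m w → Dec (m ≋ w) → Between o w m
      cases (inj₂ owm) _         = owm
      cases (inj₁ omw) (yes m≋w) =
        lin 4 (λ ow om mw wm → ow ≼ om ⊕ mw ∷ mw ≼ 𝟘 ∷ wm ≐ mw ∷ [] ⊢ ow ⊕ wm ≼ om)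
          (△ o m w) (≋⇒d≤0 m≋w) (d-sym w m)
      cases (inj₁ omw) (no m≉w)  = contradiction
        (collinear omw m≉o m≉w (inj₂ (between-sym opm)) (inj₂ (between-sym oqm)))
        (not-sameSide opm oqm)

    -- Up to distance `d o p` a geodesic from `o` to `p` provides the point, after that one from `p`
    -- to `m`.
    point : ∀ {m} → Between o p m → ∀ {u} → 0# ≤ u → u ≤ d o m → ∃[ z ] SameSide o p z × d o z ≈ u
    point {m} opm {u} 0≤u u≤om = [ near , beyond ]′ (total u (d o p))
      where
      near : u ≤ d o p → ∃[ z ] SameSide o p z × d o z ≈ u
      near u≤op =
        let f , rf , f≋p = ray o p
            of≈u = IsRay.from-start rf 0≤u u≤op
        in f u , inj₂ (lin 5 (λ u op of fp ff → of ≐ u ∷ ff ≐ op ⊖ u ∷ fp ≐ ff ∷ [] ⊢ of ⊕ fp ≼ op)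
             of≈u (IsRay.isometric rf 0≤u u≤op ≤-refl) (d-congʳ (≋-sym f≋p))) , of≈u
      beyond : d o p ≤ u → ∃[ z ] SameSide o p z × d o z ≈ u
      beyond op≤u =
        let f , rf , f≋m = ray p m
            v = u + - d o p
            0≤v = x≤y⇒0≤y-x op≤u
            v≤pm = lin 4 (λ u op om pm → u ≼ om ∷ om ≼ op ⊕ pm ∷ [] ⊢ u ⊖ op ≼ pm) u≤om (△ o p m)
            pf≈v = IsRay.from-start rf 0≤v v≤pm
            fm≈ = ≈-trans (d-congʳ (≋-sym f≋m)) (IsRay.isometric rf 0≤v v≤pm ≤-refl)
            opf : Between o p (f v)
            opf = lin 6 (λ op pf of fm pm om →
              om ≼ of ⊕ fm ∷ op ⊕ pm ≼ om ∷ fm ≐ pm ⊖ pf ∷ [] ⊢ op ⊕ pf ≼ of)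
              (△ o (f v) m) opm (≈-trans fm≈ (+-cong ≈-refl (-‿cong (≈-sym pf≈v))))
        in f v , inj₁ opf , ≈-trans (≈-sym (between≈ opf))
             (lin 3 (λ u op pf → pf ≐ u ⊖ op ∷ [] ⊢ op ⊕ pf ≐ u) pf≈v)

  module TwoSided {p o q} (poq : Between p o q) (o≉p : ¬ o ≋ p) (o≉q : ¬ o ≋ q) where

    module P = Side poq o≉p o≉q
    module Q = Side (between-sym poq) o≉q o≉p

    cover : ∀ z → SameSide o p z ⊎ SameSide o q z
    cover = separated poq o≉p o≉q

    otherwise : ¬ SameSide o p z → SameSide o q z
    otherwise {z} ¬p = [ (λ s → contradiction s ¬p) , id ]′ (cover z)

    cross : SameSide o p z → SameSide o q w → ∃[ m ] SameSide o p m × SameSide o q m × Between z m w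
    cross = crossing sameSide-closed sameSide-closed cover

    -- Sides that share only `o`: an interval.

    module Straight (share : ∀ {m} → SameSide o p m → SameSide o q m → o ≋ m) where

      -- A geodesic from one side to the other crosses at a common point, which can only be `o`.
      opposite : SameSide o p z → SameSide o q w → d o z + d o w ≈ d z w
      opposite {z} {w} pz qw =
        let m , pm , qm , zmw = cross pz qw
        in ≈-trans (+-cong (≈-trans (d-sym o z) (d-congʳ (share pm qm))) (d-congˡ (share pm qm)))
             (between≈ zmw)

      signed : ∀ z → Dec (SameSide o p z) → ℝ
      signed z (yes _) = d o z
      signed z (no  _) = - d o z

      signed-isometry : ∀ z w p? q? → dist (signed z p?) (signed w q?) ≈ d z w
      signed-isometry z w (yes pz) (yes pw) = dist-shift (d≥0 z w) (sameSide≈ (P.same pz pw))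
      signed-isometry z w (yes pz) (no ¬pw) = dist-shift (d≥0 z w)
        (inj₂ (lin 3 (λ oz ow zw → oz ⊕ ow ≐ zw ∷ [] ⊢ ⊝ ow ⊕ zw ≐ oz) (opposite pz (otherwise ¬pw))))
      signed-isometry z w (no ¬pz) (yes pw) = dist-shift (d≥0 z w)
        (inj₁ (lin 4 (λ oz ow zw wz → ow ⊕ oz ≐ wz ∷ zw ≐ wz ∷ [] ⊢ ⊝ oz ⊕ zw ≐ ow)
          (opposite pw (otherwise ¬pz)) (d-sym z w)))
      signed-isometry z w (no ¬pz) (no ¬pw) = dist-shift (d≥0 z w)
        (Sum.swap (Sum.map negate negate (sameSide≈ (Q.same (otherwise ¬pz) (otherwise ¬pw)))))
        where
        negate : ∀ {s e t} → s + e ≈ t → - t + e ≈ - s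
        negate = lin 3 (λ s e t → s ⊕ e ≐ t ∷ [] ⊢ ⊝ t ⊕ e ≐ ⊝ s)

      interval : ∃[ I ] Interval I × Isometric X ⟦ I ⟧
      interval = isometry⇒interval (λ z → signed z (em _))
        (λ z w → signed-isometry z w (em _) (em _))

    -- Sides that share another point: a circle.

    module Round {m} (pm : SameSide o p m) (qm : SameSide o q m) (o≉m : ¬ o ≋ m) where

      opm : Between o p m
      opm = P.common-far pm qm o≉m

      oqm : Between o q m
      oqm = Q.common-far qm pm o≉m

      h = d o m

      0<h : Pos h
      0<h = ≉⇒pos o≉m

      towards : ∀ z → Between o z m
      towards z = [ P.antipodal opm oqm , Q.antipodal oqm opm ]′ (cover z)

      r≤h : ∀ z → d o z ≤ h
      r≤h z = lin 3 (λ oz zm om → oz ⊕ zm ≼ om ∷ 𝟘 ≼ zm ∷ [] ⊢ oz ≼ om) (towards z) (d≥0 z m)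

      -- A common point `z` other than `o` can replace `m` in `antipodal`. Then `m` is between `o`
      -- and `z`, and `z` between `o` and `m`.
      share : SameSide o p z → SameSide o q z → o ≋ z ⊎ m ≋ z
      share {z} pz qz = cases (em _)
        where
        cases : Dec (o ≋ z) → o ≋ z ⊎ m ≋ z
        cases (yes o≋z) = inj₁ o≋z
        cases (no  o≉z) = inj₂ (d≤0⇒≋
          (lin 4 (λ om mz oz zm → om ⊕ mz ≼ oz ∷ oz ⊕ zm ≼ om ∷ zm ≐ mz ∷ [] ⊢ mz ≼ 𝟘)
            (P.antipodal (P.common-far pz qz o≉z) (Q.common-far qz pz o≉z) pm) (towards z)
            (d-sym z m)))

      opposite : SameSide o p z → SameSide o q w → Between z o w ⊎ Between z m w
      opposite {z} {w} pz qw =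
        let n , pn , qn , znw = cross pz qw
        in Sum.map (through znw) (through znw) (share pn qn)
        where
        through : ∀ {n n′} → Between z n w → n′ ≋ n → Between z n′ w
        through znw n′≋n = ≤-respˡ (+-cong (d-congʳ (≋-sym n′≋n)) (d-congˡ (≋-sym n′≋n))) znw

      -- The length of the way to `z` that starts at `o`, runs along the side of `p` to `m` and
      -- returns along the side of `q`. Both `o` and `m` count to the side of `p`.
      angle : ∀ z → Dec (SameSide o p z) → ℝ
      angle z (yes _) = d o z
      angle z (no  _) = h + h + - d o z

      angle≥0 : ∀ z p? → 0# ≤ angle z p?
      angle≥0 z (yes _) = d≥0 o z
      angle≥0 z (no  _) = lin 2 (λ h r → r ≼ h ∷ 𝟘 ≼ r ∷ [] ⊢ 𝟘 ≼ h ⊕ h ⊖ r) (r≤h z) (d≥0 o z)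

      -- The value `h + h` would force `z` to be `o`, which is on the side of `p`.
      angle<2h : ∀ z p? → h + h ≰ angle z p?
      angle<2h z (yes _) q = 0<h (lin 2 (λ h r → h ⊕ h ≼ r ∷ r ≼ h ∷ [] ⊢ h ≼ 𝟘) q (r≤h z))
      angle<2h z (no ¬p) q = ¬p (inj₂
        (lin 5 (λ h oz zp op zo → h ⊕ h ≼ h ⊕ h ⊖ oz ∷ zp ≼ zo ⊕ op ∷ zo ≐ oz ∷ [] ⊢ oz ⊕ zp ≼ op)
          q (△ z o p) (d-sym z o)))

      -- A geodesic through `o` crosses the seam of the circle, one through `m` does not.
      arc-cross : ∀ {z w} → SameSide o p z → SameSide o q w →
                  Arc (h + h) (d o z) (h + h + - d o w) (d z w)
      arc-cross {z} {w} pz qw = [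
        (λ zow → inj₂ (inj₁
          (lin 5 (λ h oz zo ow zw → zo ⊕ ow ≐ zw ∷ oz ≐ zo ∷ [] ⊢ oz ⊕ (h ⊕ h) ≐ h ⊕ h ⊖ ow ⊕ zw)
            (between≈ zow) (d-sym o z)))) ,
        (λ zmw → inj₁ (inj₁
          (lin 7 (λ h oz zm ow mw wm zw →
            zm ⊕ mw ≐ zw ∷ wm ≐ mw ∷ oz ⊕ zm ≐ h ∷ ow ⊕ wm ≐ h ∷ [] ⊢ oz ⊕ zw ≐ h ⊕ h ⊖ ow)
            (between≈ zmw) (d-sym w m) (between≈ (towards z)) (between≈ (towards w)))))
        ]′ (opposite pz qw)

      angle-arc : ∀ z w p? q? → Arc (h + h) (angle z p?) (angle w q?) (d z w)
      angle-arc z w (yes pz) (yes pw) = inj₁ (sameSide≈ (P.same pz pw))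
      angle-arc z w (yes pz) (no ¬pw) = arc-cross pz (otherwise ¬pw)
      angle-arc z w (no ¬pz) (yes pw) = Arc-sym
        (Sum.map (Sum.map flipˡ flipˡ) (Sum.map flipʳ flipʳ) (arc-cross pw (otherwise ¬pz)))
        where
        flipˡ : ∀ {s t} → s + d w z ≈ t → s + d z w ≈ t
        flipˡ = ≈-trans (+-cong ≈-refl (d-sym z w))
        flipʳ : ∀ {s t} → s ≈ t + d w z → s ≈ t + d z w
        flipʳ p = ≈-trans p (+-cong ≈-refl (d-sym w z))
      angle-arc z w (no ¬pz) (no ¬pw) = inj₁
        (Sum.swap (Sum.map negate negate (sameSide≈ (Q.same (otherwise ¬pz) (otherwise ¬pw)))))
        where
        negate : ∀ {s e t} → s + e ≈ t → h + h + - t + e ≈ h + h + - s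
        negate = lin 4 (λ h s e t → s ⊕ e ≐ t ∷ [] ⊢ h ⊕ h ⊖ t ⊕ e ≐ h ⊕ h ⊖ s)

      -- The ways from `z` to `w` through `o` and through `m` together have length `h + h`.
      diameter : ∀ z w → d z w + d z w ≤ h + h
      diameter z w = lin 8 (λ h oz ow zm wm zw zo mw →
        zw ≼ zo ⊕ ow ∷ zw ≼ zm ⊕ mw ∷ oz ⊕ zm ≼ h ∷ ow ⊕ wm ≼ h ∷ zo ≐ oz ∷ mw ≐ wm ∷ [] ⊢ zw ⊕ zw ≼ h ⊕ h)
        (△ z o w) (△ z m w) (towards z) (towards w) (d-sym z o) (d-sym m w)

      angle-near : ∀ {z u} → SameSide o p z → d o z ≈ u → ∀ p? → angle z p? ≈ u
      angle-near pz oz≈u (yes _) = oz≈u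
      angle-near pz oz≈u (no ¬p) = contradiction pz ¬p

      -- If `z` were on the side of `p` as well, it would be `o` or `m`, and `u` would be `h + h` or
      -- `h`.
      angle-far : ∀ {z u} → SameSide o q z → d o z ≈ h + h + - u → u ≰ h → h + h ≰ u →
                  ∀ p? → angle z p? ≈ u
      angle-far {z} {u} qz oz≈ u≰h u<2h (no _)   =
        lin 3 (λ h u oz → oz ≐ h ⊕ h ⊖ u ∷ [] ⊢ h ⊕ h ⊖ oz ≐ u) oz≈
      angle-far {z} {u} qz oz≈ u≰h u<2h (yes pz) = ⊥-elim ([ atOrigin , atAntipode ]′ (share pz qz))
        where
        atOrigin : ¬ o ≋ z
        atOrigin o≋z = u<2h (lin 3 (λ h u oz → oz ≐ h ⊕ h ⊖ u ∷ oz ≼ 𝟘 ∷ [] ⊢ h ⊕ h ≼ u)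
          oz≈ (≋⇒d≤0 o≋z))
        atAntipode : ¬ m ≋ z
        atAntipode m≋z = u≰h (lin 3 (λ h u oz → oz ≐ h ⊕ h ⊖ u ∷ h ≐ oz ∷ [] ⊢ u ≼ h)
          oz≈ (d-congʳ m≋z))

      withAngle : ∀ {u} → 0# ≤ u → h + h ≰ u → ∃[ z ] (∀ p? → angle z p? ≈ u)
      withAngle {u} 0≤u u<2h = cases (em _)
        where
        cases : Dec (u ≤ h) → ∃[ z ] (∀ p? → angle z p? ≈ u)
        cases (yes u≤h) = map₂ (λ (pz , oz≈u) → angle-near pz oz≈u) (P.point opm 0≤u u≤h)
        cases (no  u≰h) = map₂ (λ (qz , oz≈) → angle-far qz oz≈ u≰h u<2h)
          (Q.point oqm
            (lin 2 (λ h u → u ≼ h ⊕ h ∷ [] ⊢ 𝟘 ≼ h ⊕ h ⊖ u) (≰⇒≥ u<2h))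
            (lin 2 (λ h u → h ≼ u ∷ [] ⊢ h ⊕ h ⊖ u ≼ h) (≰⇒≥ u≰h)))

      -- The ratio π / h turns the circumference `h + h` into 2π.
      κ = Inverse.x⁻¹*_ 0<h π

      κ*2h≈2π : κ * (h + h) ≈ π + π
      κ*2h≈2π = ≈-trans (distribˡ κ h h) (+-cong κ*h≈π κ*h≈π)
        where
        κ*h≈π : κ * h ≈ π
        κ*h≈π = ≈-trans (*-comm κ h) (Inverse.x*x⁻¹* 0<h π)

      0<κ : Pos κ
      0<κ κ≤0 = pos-π (≤-respˡ (Inverse.x*x⁻¹* 0<h π)
        (≤-respʳ (zeroʳ h) (*-monoʳ-≤ (≰⇒≥ 0<h) κ≤0)))

      scale : ∀ u → 0# ≤ u → h + h ≰ u → MetricSpace.Carrier S¹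
      scale u 0≤u u<2h = κ * u , *-nonNeg (≰⇒≥ 0<κ) 0≤u ,
        ≰⇒< (λ 2π≤κu → u<2h (Inverse.*-cancelˡ-≤ 0<κ (≤-respˡ (≈-sym κ*2h≈2π) 2π≤κu)))

      toCircle : ∀ z → MetricSpace.Carrier S¹
      toCircle z = scale (angle z (em _)) (angle≥0 z (em _)) (angle<2h z (em _))

      toCircle-scales : ∀ z w → MetricSpace.d S¹ (toCircle z) (toCircle w) ≈ κ * d z w
      toCircle-scales z w = arc-distance (*-nonNeg (≰⇒≥ 0<κ) (d≥0 z w))
        (≤-respˡ (distribˡ κ _ _) (≤-respʳ κ*2h≈2π (*-monoʳ-≤ (≰⇒≥ 0<κ) (diameter z w))))
        (Arc-circumference κ*2h≈2π (Arc-scale κ (angle-arc z w (em _) (em _))))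

      onto : (s : MetricSpace.Carrier S¹) → ∃[ z ] proj₁ (toCircle z) ≈ proj₁ s
      onto (s , 0≤s , s<2π) =
        let open Inverse 0<κ
            z , angle≈ = withAngle {x⁻¹* s}
              (*-cancelˡ-≤ (≤-respˡ (≈-sym (zeroʳ κ)) (≤-respʳ (≈-sym (x*x⁻¹* s)) 0≤s)))
              (λ 2h≤ → <⇒≱ s<2π (≤-respˡ κ*2h≈2π (≤-respʳ (x*x⁻¹* s) (*-monoʳ-≤ (≰⇒≥ 0<κ) 2h≤))))
        in z , ≈-trans (*-cong ≈-refl (angle≈ (em _))) (x*x⁻¹* s)

      circle : Similar X S¹
      circle = κ , ≰⇒< 0<κ , similar {Y = S¹} 0<κ toCircle toCircle-scales onto

    circleOrInterval : Dec (∃[ m ] SameSide o p m × SameSide o q m × ¬ o ≋ m) → CircleOrInterval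
    circleOrInterval (yes (m , pm , qm , o≉m)) = inj₁ (Round.circle pm qm o≉m)
    circleOrInterval (no none) = inj₂ (Straight.interval λ pm qm →
      byContradiction λ o≉m → none (_ , pm , qm , o≉m))

  classify : CircleOrInterval
  classify = cases (em _)
    where
    cases : Dec (∃[ p ] ∃[ q ] ¬ p ≋ q) → CircleOrInterval
    -- Without two distinct points, the empty space included, a constant map is an isometry.
    cases (no none) = inj₂ (isometry⇒interval (λ _ → 0#) λ x y → ≈-trans (≈⇒dist≈0 ≈-refl)
      (antisym (d≥0 x y) (≋⇒d≤0 (byContradiction λ x≉y → none (x , y , x≉y)))))
    cases (yes (p , q , p≉q)) =
      -- The midpoint of a geodesic from `p` to `q` serves as `o`.
      let f , rf , f≋q = ray p q
          D = d p q
          e = half D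
          0<e = pos-half (≉⇒pos p≉q)
          e≤D = lin 2 (λ e D → e ⊕ e ≐ D ∷ 𝟘 ≼ e ∷ [] ⊢ e ≼ D) (half+half D) (≰⇒≥ 0<e)
          po≈ = IsRay.from-start rf (≰⇒≥ 0<e) e≤D
          oq≈ = ≈-trans (d-congʳ (≋-sym f≋q)) (IsRay.isometric rf (≰⇒≥ 0<e) e≤D ≤-refl)
      in TwoSided.circleOrInterval {p} {f e} {q}
           (lin 4 (λ e D po oq → po ≐ e ∷ oq ≐ D ⊖ e ∷ [] ⊢ po ⊕ oq ≼ D) po≈ oq≈)
           (λ o≋p → 0<e (≤-respˡ po≈ (≋⇒d≤0 (≋-sym o≋p))))
           (λ o≋q → 0<e (lin 3 (λ e D oq → e ⊕ e ≐ D ∷ oq ≐ D ⊖ e ∷ oq ≼ 𝟘 ∷ [] ⊢ e ≼ 𝟘)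
             (half+half D) oq≈ (≋⇒d≤0 o≋q)))
           (em _)

-- Unit ball graphs with prescribed edges and non-edges.

Covers : ∀ {n} → List (Fin n × Fin n) → Fin n → Fin n → Set
Covers ps u v = (u , v) ∈ ps ⊎ (v , u) ∈ ps

covers? : ∀ {n} (ps : List (Fin n × Fin n)) u v → Dec (Covers ps u v)
covers? ps u v = ((u , v) ∈? ps) ⊎-dec ((v , u) ∈? ps)
  where open DecMembership (Product.≡-dec Fin._≟_ Fin._≟_) using (_∈?_)

-- Decided by computation, this allows an induced copy to be specified by its edges and non-edges,
-- each in one orientation.
exhaustive? : ∀ {n} (es ns : List (Fin n × Fin n)) →
  Dec (∀ u v → u ≡ v ⊎ Covers es u v ⊎ Covers ns u v)
exhaustive? es ns = Fin.all? λ u → Fin.all? λ v →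
  (u Fin.≟ v) ⊎-dec (covers? es u v ⊎-dec covers? ns u v)

-- With the two proofs as parameters, `claw` and `net` are instances by unification.
edgeGraph : ∀ {n} (es : List (Fin n × Fin n)) →
            Symmetric (Covers es) → Irreflexive _≡_ (Covers es) → Graph
edgeGraph {n} es sym irrefl = record { order = n ; Adj = Covers es ; sym = sym ; irrefl = irrefl }

module BallGraphs (em : ∀ ℓ → ExcludedMiddle ℓ) (R : Reals)
                  {a ℓ} (X : Geometry.MetricSpace R a ℓ) where
  open Reals R
  open LinearArithmetic R using (lin; _⊢_; _≼_; _≐_; _⊕_; _⊖_; ⊝_; 𝟘)
  open RealProperties em R
  open Geometry R
  open MetricProperties em R X

  module BallGraph {n} (ρ : Fin n → Pt) {δ} (0<δ : Pos δ) where

    graph : Graph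
    graph = record
      { order  = n
      ; Adj    = λ u v → u ≢ v × d (ρ u) (ρ v) ≤ δ
      ; sym    = λ (u≢v , p) → u≢v ∘ ≡.sym , ≤-respˡ (d-sym _ _) p
      ; irrefl = λ u≡v (u≢v , _) → u≢v u≡v
      }

    isUnitBallGraph : IsUnitBallGraph X graph
    isUnitBallGraph = δ , ≰⇒< 0<δ , ρ , λ u≢v → mk⇔ proj₂ (u≢v ,_)

    module _ {es : List (Fin n × Fin n)} (ns : List (Fin n × Fin n))
             {exhaustive : True (exhaustive? es ns)}
             {sym : Symmetric (Covers es)} {irrefl : Irreflexive _≡_ (Covers es)}
             (close : All (λ (u , v) → d (ρ u) (ρ v) ≤ δ) es)
             (far   : All (λ (u , v) → d (ρ u) (ρ v) ≰ δ) ns) where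
      private
        H : Graph
        H = edgeGraph es sym irrefl

        adjacent : ∀ {u v} → Covers es u v → d (ρ u) (ρ v) ≤ δ
        adjacent (inj₁ uv∈es) = All.lookup close uv∈es
        adjacent (inj₂ vu∈es) = ≤-respˡ (d-sym _ _) (All.lookup close vu∈es)

        separate : ∀ {u v} → Covers ns u v → d (ρ u) (ρ v) ≰ δ
        separate (inj₁ uv∈ns) p = All.lookup far uv∈ns p
        separate (inj₂ vu∈ns) p = All.lookup far vu∈ns (≤-respˡ (d-sym _ _) p)

        reflects : ∀ {u v} → u ≢ v → d (ρ u) (ρ v) ≤ δ →
                   u ≡ v ⊎ Covers es u v ⊎ Covers ns u v → Covers es u v
        reflects u≢v _ (inj₁ u≡v)      = contradiction u≡v u≢v
        reflects _   _ (inj₂ (inj₁ e)) = e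
        reflects _   p (inj₂ (inj₂ n)) = contradiction p (separate n)

      inducedCopy : InducedCopy H graph
      inducedCopy = record
        { embed     = id
        ; injective = id
        ; induced   = λ u v → mk⇔
            (λ e → (λ u≡v → irrefl u≡v e) , adjacent e)
            (λ (u≢v , p) → reflects u≢v p (toWitness exhaustive u v))
        }

  AllClawNetFree : Set (a L.⊔ L.suc 0ℓ)
  AllClawNetFree = ∀ G → IsUnitBallGraph X G → ClawNetFree G

  module _ (free : AllClawNetFree) {δ} (0<δ : Pos δ) where

    noClaw : ∀ {c x y z} → d c x ≤ δ → d c y ≤ δ → d c z ≤ δ →
             d x y ≰ δ → d x z ≰ δ → ¬ d y z ≰ δ
    noClaw {c} {x} {y} {z} cx cy cz xy xz yz = proj₁ (free graph isUnitBallGraph)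
      (inducedCopy ((1F , 2F) ∷ (1F , 3F) ∷ (2F , 3F) ∷ []) (cx ∷ cy ∷ cz ∷ []) (xy ∷ xz ∷ yz ∷ []))
      where
      ρ : Fin 4 → Pt
      ρ 0F = c
      ρ 1F = x
      ρ 2F = y
      ρ 3F = z
      open BallGraph ρ 0<δ

    noNet : ∀ {x y z x′ y′ z′} →
      d x y ≤ δ → d y z ≤ δ → d z x ≤ δ → d x x′ ≤ δ → d y y′ ≤ δ → d z z′ ≤ δ →
      d x y′ ≰ δ → d x z′ ≰ δ → d y x′ ≰ δ → d y z′ ≰ δ → d z x′ ≰ δ → d z y′ ≰ δ →
      d x′ y′ ≰ δ → d x′ z′ ≰ δ → ¬ d y′ z′ ≰ δ
    noNet {x} {y} {z} {x′} {y′} {z′} xy yz zx xx yy zz xy′ xz′ yx′ yz′ zx′ zy′ x′y′ x′z′ y′z′ =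
      proj₂ (free graph isUnitBallGraph) (inducedCopy
        ( (0F , 4F) ∷ (0F , 5F) ∷ (1F , 3F) ∷ (1F , 5F) ∷ (2F , 3F) ∷ (2F , 4F)
        ∷ (3F , 4F) ∷ (3F , 5F) ∷ (4F , 5F) ∷ [])
        (xy ∷ yz ∷ zx ∷ xx ∷ yy ∷ zz ∷ [])
        (xy′ ∷ xz′ ∷ yx′ ∷ yz′ ∷ zx′ ∷ zy′ ∷ x′y′ ∷ x′z′ ∷ y′z′ ∷ []))
      where
      ρ : Fin 6 → Pt
      ρ 0F = x
      ρ 1F = y
      ρ 2F = z
      ρ 3F = x′
      ρ 4F = y′
      ρ 5F = z′
      open BallGraph ρ 0<δ

  -- A claw or a net near the centre of a fork.

  module ForkGraph (F : Fork) where
    open Fork F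
    private module Ray i = IsRay (isRay i)

    -- A signed coordinate on the line, with `w` at 0. The decision is an argument because `total`
    -- may assign 0 to either leg.
    lineBy : ∀ u → 0# ≤ u ⊎ u ≤ 0# → Pt
    lineBy u (inj₁ _) = f 0F u
    lineBy u (inj₂ _) = f 1F (- u)

    line : ℝ → Pt
    line u = lineBy u (total 0# u)

    private
      0≤-u : ∀ {u} → u ≤ 0# → 0# ≤ - u
      0≤-u = lin 1 (λ u → u ≼ 𝟘 ∷ [] ⊢ 𝟘 ≼ ⊝ u)
      -u≤l : ∀ {u} → - l ≤ u → - u ≤ l
      -u≤l = lin 2 (λ l u → ⊝ l ≼ u ∷ [] ⊢ ⊝ u ≼ l)

    line-isometric : ∀ {u v} → - l ≤ u → u ≤ v → v ≤ l → d (line u) (line v) ≈ v + - u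
    line-isometric {u} {v} -l≤u u≤v v≤l = cases (total 0# u) (total 0# v)
      where
      cases : ∀ u? v? → d (lineBy u u?) (lineBy v v?) ≈ v + - u
      cases (inj₁ 0≤u) (inj₁ 0≤v) = Ray.isometric 0F 0≤u u≤v v≤l
      cases (inj₁ 0≤u) (inj₂ v≤0) =
        lin 3 (λ u v D → D ≐ u ⊖ v ∷ 𝟘 ≼ u ∷ u ≼ v ∷ v ≼ 𝟘 ∷ [] ⊢ D ≐ v ⊖ u)
          (line-distance 0≤u (≤-trans u≤v v≤l) (0≤-u v≤0) (-u≤l (≤-trans -l≤u u≤v))) 0≤u u≤v v≤0
      cases (inj₂ u≤0) (inj₁ 0≤v) = ≈-trans (d-sym _ _)
        (line-distance 0≤v v≤l (0≤-u u≤0) (-u≤l -l≤u))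
      cases (inj₂ u≤0) (inj₂ v≤0) = ≈-trans (d-sym _ _)
        (lin 3 (λ u v D → D ≐ ⊝ u ⊖ (⊝ v) ∷ [] ⊢ D ≐ v ⊖ u)
          (Ray.isometric 1F (0≤-u v≤0) (lin 2 (λ u v → u ≼ v ∷ [] ⊢ ⊝ v ≼ ⊝ u) u≤v) (-u≤l -l≤u)))

    line-bounds : ∀ {u} → - l ≤ u → u ≤ l → u ≤ d w (line u) × - u ≤ d w (line u)
    line-bounds {u} -l≤u u≤l = cases (total 0# u)
      where
      cases : ∀ u? → u ≤ d w (lineBy u u?) × - u ≤ d w (lineBy u u?)
      cases (inj₁ 0≤u) =
        let D≈u = Ray.from-start 0F 0≤u u≤l in
        lin 2 (λ D u → D ≐ u ∷ [] ⊢ u ≼ D) D≈u ,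
        lin 2 (λ D u → D ≐ u ∷ 𝟘 ≼ u ∷ [] ⊢ ⊝ u ≼ D) D≈u 0≤u
      cases (inj₂ u≤0) =
        let D≈-u = Ray.from-start 1F (0≤-u u≤0) (-u≤l -l≤u) in
        lin 2 (λ D u → D ≐ ⊝ u ∷ u ≼ 𝟘 ∷ [] ⊢ u ≼ D) D≈-u u≤0 ,
        lin 2 (λ D u → D ≐ ⊝ u ∷ [] ⊢ ⊝ u ≼ D) D≈-u

    line-off : ∀ {q η u} → - l ≤ u → u ≤ l → (∀ {s} → 0# ≤ s → s ≤ l → d q (f 0F s) ≰ η) →
               (∀ {s} → 0# ≤ s → s ≤ l → d q (f 1F s) ≰ η) → d q (line u) ≰ η
    line-off {q} {η} {u} -l≤u u≤l off₀ off₁ = cases (total 0# u)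
      where
      cases : ∀ u? → d q (lineBy u u?) ≰ η
      cases (inj₁ 0≤u) = off₀ 0≤u u≤l
      cases (inj₂ u≤0) = off₁ (0≤-u u≤0) (-u≤l -l≤u)

    -- d (f 2 t) (f i t) ≤ 2 d (f 2 t) (f i s), since the second distance is at least |t - s|.
    leg-gap : ∀ {i t} → 0# ≤ t → t ≤ l → ¬ f 2F t ≋ f i t →
              ∃[ η ] Pos η × (∀ {s} → 0# ≤ s → s ≤ l → d (f 2F t) (f i s) ≰ η)
    leg-gap {i} {t} 0≤t t≤l t≉ =
      let η , 0<η , 3η≤ = pos-third (≉⇒pos t≉) in η , 0<η , λ 0≤s s≤l near → 0<η (
        [ (λ s≤t → lin 9 (λ η D E s t ws wt st F →
             E ≼ η ∷ η ⊕ (η ⊕ η) ≼ D ∷ D ≼ E ⊕ st ∷ st ≐ t ⊖ s ∷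
             ws ≐ s ∷ wt ≐ t ∷ wt ≼ ws ⊕ F ∷ F ≐ E ∷ [] ⊢ η ≼ 𝟘)
             near 3η≤ (△ (f 2F t) (f i _) (f i t)) (Ray.isometric i 0≤s s≤t t≤l)
             (Ray.from-start i 0≤s s≤l) (Ray.from-start 2F 0≤t t≤l) (△ w (f i _) (f 2F t)) (d-sym _ _))
        , (λ t≤s → lin 9 (λ η D E s t ws wt st ts →
             E ≼ η ∷ η ⊕ (η ⊕ η) ≼ D ∷ D ≼ E ⊕ st ∷ st ≐ ts ∷
             ts ≐ s ⊖ t ∷ ws ≐ s ∷ wt ≐ t ∷ ws ≼ wt ⊕ E ∷ [] ⊢ η ≼ 𝟘)
             near 3η≤ (△ (f 2F t) (f i _) (f i t)) (d-sym _ _) (Ray.isometric i 0≤t t≤s s≤l)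
             (Ray.from-start i 0≤s s≤l) (Ray.from-start 2F 0≤t t≤l) (△ w (f 2F t) (f i _)))
        ]′ (total _ t))

    module _ (free : AllClawNetFree) where

      -- If lo and hi are not adjacent, q is the centre of a claw; if they are adjacent and
      -- distinct, they form with q the triangle of a net; otherwise lo is the centre of a claw.
      crowded : ∀ {δ q q′ lo hi} → Pos δ → d q q′ ≤ δ →
        (∀ {u} → - l ≤ u → u ≤ l → d q′ (line u) ≰ δ) →
        - l ≤ lo + - δ → lo ≤ hi → hi + δ ≤ l →
        d q (line lo) ≤ δ → d q (line hi) ≤ δ →
        (∀ {u} → u ≤ lo + - δ → - l ≤ u → d q (line u) ≰ δ) → d q (line (hi + δ)) ≰ δ → ⊥
      crowded {δ} {q} {q′} {lo} {hi} 0<δ qq′ off -l≤ lo≤hi ≤l qlo qhi below above =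
        cases (em _) (em _)
        where
        0≤δ = ≰⇒≥ 0<δ
        lo⁻≤lo : lo + - δ ≤ lo
        lo⁻≤lo = lin 2 (λ lo δ → 𝟘 ≼ δ ∷ [] ⊢ lo ⊖ δ ≼ lo) 0≤δ
        hi≤hi⁺ : hi ≤ hi + δ
        hi≤hi⁺ = lin 2 (λ hi δ → 𝟘 ≼ δ ∷ [] ⊢ hi ≼ hi ⊕ δ) 0≤δ
        -l≤lo = ≤-trans -l≤ lo⁻≤lo
        -l≤hi = ≤-trans -l≤lo lo≤hi
        hi≤l  = ≤-trans hi≤hi⁺ ≤l
        lo≤l  = ≤-trans lo≤hi hi≤l
        lo≤hi⁺ = ≤-trans lo≤hi hi≤hi⁺
        lo⁻≤hi = ≤-trans lo⁻≤lo lo≤hi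

        separate : ∀ {u v} → - l ≤ u → u ≤ v → v ≤ l → v + - u ≰ δ → d (line u) (line v) ≰ δ
        separate -l≤u u≤v v≤l gap p = gap (≤-respˡ (line-isometric -l≤u u≤v v≤l) p)

        separate′ : ∀ {u v} → - l ≤ u → u ≤ v → v ≤ l → v + - u ≰ δ → d (line v) (line u) ≰ δ
        separate′ -l≤u u≤v v≤l gap p = separate -l≤u u≤v v≤l gap (≤-respˡ (d-sym _ _) p)

        step⁺ : d (line hi) (line (hi + δ)) ≤ δ
        step⁺ = lin 3 (λ D hi δ → D ≐ hi ⊕ δ ⊖ hi ∷ [] ⊢ D ≼ δ) (line-isometric -l≤hi hi≤hi⁺ ≤l)

        cases : Dec (hi + - lo ≤ δ) → Dec (hi ≤ lo) → ⊥
        cases (no wide) _ = noClaw free 0<δ qq′ qlo qhi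
          (off -l≤lo lo≤l) (off -l≤hi hi≤l) (separate -l≤lo lo≤hi hi≤l wide)
        -- Here `lo` and `hi` coincide. The leaves are `q` and the points of the line at `hi + δ`
        -- and `hi - δ`.
        cases (yes narrow) (yes hi≤lo) = noClaw free 0<δ
          (≤-respˡ (d-sym _ _) qhi) step⁺
          (lin 4 (λ D E hi δ → D ≐ E ∷ E ≐ hi ⊖ (hi ⊖ δ) ∷ [] ⊢ D ≼ δ) (d-sym _ _)
            (line-isometric -l≤hi⁻ hi⁻≤hi hi≤l))
          above (below hi⁻≤lo⁻ -l≤hi⁻)
          (separate′ -l≤hi⁻ (≤-trans hi⁻≤hi hi≤hi⁺) ≤l (λ p → 0<δ
            (lin 2 (λ hi δ → (hi ⊕ δ) ⊖ (hi ⊖ δ) ≼ δ ∷ [] ⊢ δ ≼ 𝟘) p)))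
          where
          -l≤hi⁻ : - l ≤ hi + - δ
          -l≤hi⁻ = ≤-trans -l≤ (+-mono-≤ lo≤hi ≤-refl)
          hi⁻≤hi : hi + - δ ≤ hi
          hi⁻≤hi = lin 2 (λ hi δ → 𝟘 ≼ δ ∷ [] ⊢ hi ⊖ δ ≼ hi) 0≤δ
          hi⁻≤lo⁻ : hi + - δ ≤ lo + - δ
          hi⁻≤lo⁻ = +-mono-≤ hi≤lo ≤-refl
        -- The pendants at `q`, `hi` and `lo` are `q′`, `hi + δ` and `lo - δ`.
        cases (yes narrow) (no lo<hi) = noNet free 0<δ
          qhi
          (≤-respˡ (≈-trans (≈-sym (line-isometric -l≤lo lo≤hi hi≤l)) (d-sym _ _)) narrow)
          (≤-respˡ (d-sym _ _) qlo)
          qq′ step⁺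
          (lin 4 (λ D E lo δ → D ≐ E ∷ E ≐ lo ⊖ (lo ⊖ δ) ∷ [] ⊢ D ≼ δ) (d-sym _ _)
            (line-isometric -l≤ lo⁻≤lo lo≤l))
          above (below ≤-refl -l≤)
          (λ p → off -l≤hi hi≤l (≤-respˡ (d-sym _ _) p))
          (separate′ -l≤ lo⁻≤hi hi≤l (λ p → lo<hi
            (lin 3 (λ lo hi δ → hi ⊖ (lo ⊖ δ) ≼ δ ∷ [] ⊢ hi ≼ lo) p)))
          (λ p → off -l≤lo lo≤l (≤-respˡ (d-sym _ _) p))
          (separate -l≤lo lo≤hi⁺ ≤l (λ p → lo<hi
            (lin 3 (λ lo hi δ → (hi ⊕ δ) ⊖ lo ≼ δ ∷ [] ⊢ hi ≼ lo) p)))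
          (off (≤-trans -l≤hi hi≤hi⁺) ≤l)
          (off -l≤ (≤-trans lo⁻≤lo lo≤l))
          (separate′ -l≤ (≤-trans lo⁻≤hi hi≤hi⁺) ≤l (λ p → lo<hi
            (lin 3 (λ lo hi δ → (hi ⊕ δ) ⊖ (lo ⊖ δ) ≼ δ ∷ 𝟘 ≼ δ ∷ [] ⊢ hi ≼ lo) p 0≤δ)))

      -- Points of the line within δ of `q` have coordinates between `- c` and `c`, so `c + δ ≤ l`
      -- leaves room for one more step of δ at either end. Almost extreme such points serve as `lo`
      -- and `hi`.
      attached : ∀ {δ q q′ c} → Pos δ → d q q′ ≤ δ →
        (∀ {u} → - l ≤ u → u ≤ l → d q′ (line u) ≰ δ) →
        d w q + δ ≤ c → c + δ ≤ l → ∃[ u ] - l ≤ u × u ≤ l × d q (line u) ≤ δ → ⊥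
      attached {δ} {q} {q′} {c} 0<δ qq′ off wq≤ c+δ≤l (u₀ , -l≤u₀ , u₀≤l , near₀) =
        close (almostMaximum Near (u₀ , -l≤u₀ , u₀≤l , near₀) l (λ _ p → proj₁ (proj₂ p)) 0<δ)
              (almostMaximum (Near ∘ -_)
                (- u₀ , near-neg-neg (-l≤u₀ , u₀≤l , near₀))
                l (λ _ p → lin 2 (λ l u → ⊝ l ≼ ⊝ u ∷ [] ⊢ u ≼ l) (proj₁ p)) 0<δ)
        where
        Near : ℝ → Set
        Near u = - l ≤ u × u ≤ l × d q (line u) ≤ δ

        -- As `total` may treat equal reals differently, the two points of the line are compared by
        -- their distance.
        near-neg-neg : ∀ {u} → Near u → Near (- (- u))
        near-neg-neg {u} (-l≤u , u≤l , near) = ≤-respʳ (≈-sym u≈) -l≤u , ≤-respˡ (≈-sym u≈) u≤l ,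
          lin 6 (λ δ D E F u v → E ≼ δ ∷ D ≼ E ⊕ F ∷ F ≐ v ⊖ u ∷ v ≐ u ∷ [] ⊢ D ≼ δ)
            near (△ q (line u) (line (- (- u))))
            (line-isometric -l≤u (≤-reflexive (≈-sym u≈)) (≤-respˡ (≈-sym u≈) u≤l)) u≈
          where u≈ = -‿involutive u

        bounded : ∀ {u} → Near u → u ≤ c × - u ≤ c
        bounded {u} (-l≤u , u≤l , near) =
          lin 6 (λ u c δ wu wq qu → qu ≼ δ ∷ wq ⊕ δ ≼ c ∷ u ≼ wu ∷ wu ≼ wq ⊕ qu ∷ [] ⊢ u ≼ c)
            near wq≤ (proj₁ (line-bounds -l≤u u≤l)) (△ w q (line u)) ,
          lin 6 (λ u c δ wu wq qu → qu ≼ δ ∷ wq ⊕ δ ≼ c ∷ ⊝ u ≼ wu ∷ wu ≼ wq ⊕ qu ∷ [] ⊢ ⊝ u ≼ c)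
            near wq≤ (proj₂ (line-bounds -l≤u u≤l)) (△ w q (line u))

        finish : ∀ {lo hi} → lo ≤ hi → Near lo → Near hi →
          (∀ {u} → u ≤ lo + - δ → ¬ Near u) → (∀ {u} → hi + δ ≤ u → ¬ Near u) → ⊥
        finish {lo} {hi} lo≤hi nlo nhi below above = crowded 0<δ qq′ off
          (lin 4 (λ lo c δ l → ⊝ lo ≼ c ∷ c ⊕ δ ≼ l ∷ [] ⊢ ⊝ l ≼ lo ⊖ δ) (proj₂ (bounded nlo)) c+δ≤l)
          lo≤hi hi+δ≤l
          (proj₂ (proj₂ nlo)) (proj₂ (proj₂ nhi))
          (λ u≤ -l≤u near → below u≤ (-l≤u ,
            lin 4 (λ u lo δ l → u ≼ lo ⊖ δ ∷ lo ≼ l ∷ 𝟘 ≼ δ ∷ [] ⊢ u ≼ l) u≤ (proj₁ (proj₂ nlo)) (≰⇒≥ 0<δ) ,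
            near))
          (λ near → above ≤-refl
            (lin 3 (λ hi δ l → ⊝ l ≼ hi ∷ 𝟘 ≼ δ ∷ [] ⊢ ⊝ l ≼ hi ⊕ δ) (proj₁ nhi) (≰⇒≥ 0<δ) , hi+δ≤l , near))
          where
          hi+δ≤l : hi + δ ≤ l
          hi+δ≤l = lin 4 (λ hi c δ l → hi ≼ c ∷ c ⊕ δ ≼ l ∷ [] ⊢ hi ⊕ δ ≼ l) (proj₁ (bounded nhi)) c+δ≤l

        close : ∃[ hi ] Near hi × (∀ {u} → hi + δ ≤ u → ¬ Near u) →
                ∃[ v ] Near (- v) × (∀ {u} → v + δ ≤ u → ¬ Near (- u)) → ⊥
        close (hi , nhi , above) (v , nlo , below) =
          -- Both extremes are approximate and may come in the wrong order; exchanging them only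
          -- weakens the bounds.
          [ (λ lo≤hi → finish lo≤hi nlo nhi below′ above)
          , (λ hi≤lo → finish hi≤lo nhi nlo
              (λ u≤ → below′ (≤-trans u≤ (+-mono-≤ hi≤lo ≤-refl)))
              (λ ≤u → above (≤-trans (+-mono-≤ hi≤lo ≤-refl) ≤u)))
          ]′ (total (- v) hi)
          where
          below′ : ∀ {u} → u ≤ - v + - δ → ¬ Near u
          below′ {u} u≤ n = below (lin 3 (λ u v δ → u ≼ ⊝ v ⊖ δ ∷ [] ⊢ v ⊕ δ ≼ ⊝ u) u≤) (near-neg-neg n)

      -- The stem point at `t₀` has a positive gap to the line; δ is chosen with 2δ at most this gap
      -- and at most `t₀`, while three times `t₀` fits into `l`.
      noFork : ⊥
      noFork =
        let t₀ , 0<t₀ , 3t₀≤l = pos-third 0<l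
        in start 0<t₀ 3t₀≤l
          (leg-gap (≰⇒≥ 0<t₀) (third≤ 0<t₀ 3t₀≤l) (stem-left 0<t₀ (third≤ 0<t₀ 3t₀≤l)))
          (leg-gap (≰⇒≥ 0<t₀) (third≤ 0<t₀ 3t₀≤l) (stem-right 0<t₀ (third≤ 0<t₀ 3t₀≤l)))
        where
        third≤ : ∀ {t} → Pos t → t + (t + t) ≤ l → t ≤ l
        third≤ 0<t = lin 2 (λ t l → 𝟘 ≼ t ∷ t ⊕ (t ⊕ t) ≼ l ∷ [] ⊢ t ≼ l) (≰⇒≥ 0<t)

        Gap : Fin 3 → ℝ → ℝ → Set
        Gap i t η = Pos η × (∀ {s} → 0# ≤ s → s ≤ l → d (f 2F t) (f i s) ≰ η)

        -- The last stem point within δ of the line, up to a step of δ, becomes `q`; the stem point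
        -- δ further on becomes `q′`.
        walk : ∀ {t₀ δ} → Pos t₀ → t₀ + (t₀ + t₀) ≤ l → Pos δ → δ ≤ t₀ →
          (∀ {u} → - l ≤ u → u ≤ l → d (f 2F t₀) (line u) ≰ δ + δ) → ⊥
        walk {t₀} {δ} 0<t₀ 3t₀≤l 0<δ δ≤t₀ off =
          arrive (almostMaximum Adjacent (0# , ≤-refl , ≰⇒≥ 0<t₀ , 0# , -l≤0 , 0≤l , start-near) t₀
                   (λ _ p → proj₁ (proj₂ p)) 0<δ)
          where
          Adjacent : ℝ → Set
          Adjacent t = 0# ≤ t × t ≤ t₀ × ∃[ u ] - l ≤ u × u ≤ l × d (f 2F t) (line u) ≤ δ

          -l≤0 : - l ≤ 0#
          -l≤0 = lin 1 (λ l → 𝟘 ≼ l ∷ [] ⊢ ⊝ l ≼ 𝟘) 0≤l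

          start-near : d (f 2F 0#) (line 0#) ≤ δ
          start-near = cases (total 0# 0#)
            where
            cases : ∀ u? → d (f 2F 0#) (lineBy 0# u?) ≤ δ
            cases (inj₁ _) = ≤-trans (≋⇒d≤0 (≋-trans (Ray.start 2F) (≋-sym (Ray.start 0F)))) (≰⇒≥ 0<δ)
            cases (inj₂ _) = ≤-trans (≋⇒d≤0 (≋-trans (Ray.start 2F) (≋-sym (≋-trans
              (≋-sym (Ray.respects 1F ≤-refl 0≤l (≈-sym -0#≈0#))) (Ray.start 1F))))) (≰⇒≥ 0<δ)

          t₀≤l = third≤ 0<t₀ 3t₀≤l

          arrive : ∃[ t ] Adjacent t × (∀ {y} → t + δ ≤ y → ¬ Adjacent y) → ⊥
          arrive (t , (0≤t , t≤t₀ , u , -l≤u , u≤l , near) , later) = attached {c = t₀} 0<δ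
            (lin 3 (λ D t δ → D ≐ t ⊕ δ ⊖ t ∷ [] ⊢ D ≼ δ)
              (Ray.isometric 2F 0≤t t≤t+δ (≤-trans t+δ≤t₀ t₀≤l)))
            (λ -l≤v v≤l near′ → later ≤-refl
              (≤-trans 0≤t t≤t+δ , t+δ≤t₀ , _ , -l≤v , v≤l , near′))
            (≤-respˡ (+-cong (≈-sym (Ray.from-start 2F 0≤t (≤-trans t≤t₀ t₀≤l))) ≈-refl) t+δ≤t₀)
            (lin 3 (λ t δ l → t ⊕ (t ⊕ t) ≼ l ∷ δ ≼ t ∷ 𝟘 ≼ t ∷ [] ⊢ t ⊕ δ ≼ l) 3t₀≤l δ≤t₀ (≰⇒≥ 0<t₀))
            (u , -l≤u , u≤l , near)
            where
            t≤t+δ : t ≤ t + δ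
            t≤t+δ = lin 2 (λ t δ → 𝟘 ≼ δ ∷ [] ⊢ t ≼ t ⊕ δ) (≰⇒≥ 0<δ)

            -- Otherwise `f 2F t₀` would be within δ of `f 2F t`, hence within 2δ of the line.
            t+δ≤t₀ : t + δ ≤ t₀
            t+δ≤t₀ = byContradiction λ beyond → off -l≤u u≤l
              (lin 7 (λ t δ t₀ D E F G → E ≼ δ ∷ D ≼ F ⊕ E ∷ F ≐ G ∷ G ≐ t₀ ⊖ t ∷ t₀ ≼ t ⊕ δ ∷ [] ⊢ D ≼ δ ⊕ δ)
                near (△ (f 2F t₀) (f 2F t) (line u)) (d-sym _ _)
                (Ray.isometric 2F 0≤t t≤t₀ t₀≤l) (≰⇒≥ beyond))

        start : ∀ {t₀} → Pos t₀ → t₀ + (t₀ + t₀) ≤ l → ∃[ η ] Gap 0F t₀ η → ∃[ η ] Gap 1F t₀ η → ⊥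
        start {t₀} 0<t₀ 3t₀≤l (η₀ , 0<η₀ , off₀) (η₁ , 0<η₁ , off₁) =
          let ε , 0<ε , ε≤η₀ , ε≤η₁ = pos-⊓ 0<η₀ 0<η₁
              ε′ , 0<ε′ , ε′≤ε , ε′≤t₀ = pos-⊓ 0<ε 0<t₀
              2δ≈ = half+half ε′
              δ≤ε′ = lin 2 (λ δ ε → δ ⊕ δ ≐ ε ∷ 𝟘 ≼ δ ∷ [] ⊢ δ ≼ ε) 2δ≈ (≰⇒≥ (pos-half 0<ε′))
              ε′≤η₀ = ≤-trans ε′≤ε ε≤η₀
              ε′≤η₁ = ≤-trans ε′≤ε ε≤η₁
          in walk 0<t₀ 3t₀≤l (pos-half 0<ε′) (≤-trans δ≤ε′ ε′≤t₀)
            (λ -l≤u u≤l p → line-off {η = ε′} -l≤u u≤l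
              (λ 0≤s s≤l q → off₀ 0≤s s≤l (≤-trans q ε′≤η₀))
              (λ 0≤s s≤l q → off₁ 0≤s s≤l (≤-trans q ε′≤η₁))
              (≤-respʳ 2δ≈ p))

-- Two sides at every point of a line or circle exclude tripods, claws and nets.

two-agree : (b : Fin 3 → Bool) → ∃[ i ] ∃[ j ] i ≢ j × b i ≡ b j
two-agree b with b 0F in p₀ | b 1F in p₁ | b 2F in p₂
... | true  | true  | _     = 0F , 1F , (λ ()) , ≡.trans p₀ (≡.sym p₁)
... | true  | false | true  = 0F , 2F , (λ ()) , ≡.trans p₀ (≡.sym p₂)
... | true  | false | false = 1F , 2F , (λ ()) , ≡.trans p₁ (≡.sym p₂)
... | false | false | _     = 0F , 1F , (λ ()) , ≡.trans p₀ (≡.sym p₁)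
... | false | true  | false = 0F , 2F , (λ ()) , ≡.trans p₀ (≡.sym p₂)
... | false | true  | true  = 1F , 2F , (λ ()) , ≡.trans p₁ (≡.sym p₂)

third-agrees : ∀ {x y z : Bool} → x ≢ y → x ≢ z → y ≡ z
third-agrees {true}  {true}          x≢y _   = contradiction refl x≢y
third-agrees {true}  {false} {true}  _   x≢z = contradiction refl x≢z
third-agrees {true}  {false} {false} _   _   = refl
third-agrees {false} {false}         x≢y _   = contradiction refl x≢y
third-agrees {false} {true}  {false} _   x≢z = contradiction refl x≢z
third-agrees {false} {true}  {true}  _   _   = refl

does-agree : ∀ {p q} {P : Set p} {Q : Set q} (p? : Dec P) (q? : Dec Q) →
             does p? ≡ does q? → P × Q ⊎ ¬ P × ¬ Q
does-agree (yes p) (yes q) _ = inj₁ (p , q)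
does-agree (no ¬p) (no ¬q) _ = inj₂ (¬p , ¬q)

module Sides (em : ∀ ℓ → ExcludedMiddle ℓ) (R : Reals)
             {a ℓ} (X : Geometry.MetricSpace R a ℓ) where
  open Reals R
  open LinearArithmetic R using (lin; _⊢_; _≼_; _≐_; _⊕_; _⊖_; ⊝_; 𝟘)
  open RealProperties em R
  open Geometry R
  open MetricProperties em R X
  open BallGraphs em R X using (AllClawNetFree)

  -- The point `c` may carry either label, as it is on the same side as every point.
  HasSides : Set a
  HasSides = ∀ c → Σ (Pt → Bool) λ side → ∀ x y → side x ≡ side y → SameSide c x y

  sides-from : (P : Pt → Pt → Set) →
    (∀ c x y → P c x → P c y → SameSide c x y) →
    (∀ c x y → ¬ P c x → ¬ P c y → SameSide c x y) → HasSides
  sides-from P pos neg c = (λ x → does (em _ {P c x})) , λ x y eq →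
    [ (λ (px , py) → pos c x y px py) , (λ (¬px , ¬py) → neg c x y ¬px ¬py) ]′
      (does-agree (em _) (em _) eq)

  line-sides : (φ : Pt → ℝ) → (∀ x y → dist (φ x) (φ y) ≈ d x y) → HasSides
  line-sides φ isometry = sides-from (λ c x → φ c ≤ φ x)
    (λ c x y c≤x c≤y → Sum.map (increasing c≤x) (increasing c≤y) (total (φ x) (φ y)))
    (λ c x y c≰x c≰y → Sum.map (decreasing (≰⇒≥ c≰x)) (decreasing (≰⇒≥ c≰y)) (total (φ y) (φ x)))
    where
    d-increasing : ∀ {x y} → φ x ≤ φ y → d x y ≈ φ y + - φ x
    d-increasing x≤y = ≈-trans (≈-sym (isometry _ _)) (dist-≤ x≤y)

    d-decreasing : ∀ {x y} → φ y ≤ φ x → d x y ≈ φ x + - φ y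
    d-decreasing y≤x = ≈-trans (≈-sym (isometry _ _)) (dist-≥ y≤x)

    increasing : ∀ {x y z} → φ x ≤ φ y → φ y ≤ φ z → Between x y z
    increasing x≤y y≤z =
      lin 6 (λ x y z xy yz xz → xy ≐ y ⊖ x ∷ yz ≐ z ⊖ y ∷ xz ≐ z ⊖ x ∷ [] ⊢ xy ⊕ yz ≼ xz)
        (d-increasing x≤y) (d-increasing y≤z) (d-increasing (≤-trans x≤y y≤z))

    decreasing : ∀ {x y z} → φ y ≤ φ x → φ z ≤ φ y → Between x y z
    decreasing y≤x z≤y =
      lin 6 (λ x y z xy yz xz → xy ≐ x ⊖ y ∷ yz ≐ y ⊖ z ∷ xz ≐ x ⊖ z ∷ [] ⊢ xy ⊕ yz ≼ xz)
        (d-decreasing y≤x) (d-decreasing z≤y) (d-decreasing (≤-trans z≤y y≤x))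

  -- Moving from c by E in the positive direction of a circle leads to x.
  Forward : ℝ → ℝ → ℝ → ℝ → Set
  Forward L c x E = c + E ≈ x ⊎ c + E ≈ x + L

  -- The forward way from `x` to `y` has length `F - E`. If both or neither of the ways from `c`
  -- cross the seam, this is `D`; if only the second does, it is at least `L - D`; if only the first
  -- does, `L - D` is at most 0. The coordinates are arbitrary reals, so the lemma also applies to
  -- negated ones.
  forward-distance : ∀ {L c x y E F D A} → Forward L c x E → Forward L c y F → E ≤ F →
    x + - y ≤ D → y + - x ≤ D → (D ≈ x + - y ⊎ D ≈ - (x + - y)) → A ≤ D → A ≤ L + - D → E + A ≤ F
  forward-distance (inj₁ p) (inj₁ q) E≤F _ _ (inj₁ r) A≤D _ =
    lin 7 (λ c x y E F D A → c ⊕ E ≐ x ∷ c ⊕ F ≐ y ∷ E ≼ F ∷ D ≐ x ⊖ y ∷ A ≼ D ∷ [] ⊢ E ⊕ A ≼ F)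
      p q E≤F r A≤D
  forward-distance (inj₁ p) (inj₁ q) E≤F _ _ (inj₂ r) A≤D _ =
    lin 7 (λ c x y E F D A → c ⊕ E ≐ x ∷ c ⊕ F ≐ y ∷ E ≼ F ∷ D ≐ ⊝ (x ⊖ y) ∷ A ≼ D ∷ [] ⊢ E ⊕ A ≼ F)
      p q E≤F r A≤D
  forward-distance (inj₂ p) (inj₂ q) E≤F _ _ (inj₁ r) A≤D _ =
    lin 8 (λ c x y E F D A L → c ⊕ E ≐ x ⊕ L ∷ c ⊕ F ≐ y ⊕ L ∷ E ≼ F ∷ D ≐ x ⊖ y ∷ A ≼ D ∷ [] ⊢ E ⊕ A ≼ F)
      p q E≤F r A≤D
  forward-distance (inj₂ p) (inj₂ q) E≤F _ _ (inj₂ r) A≤D _ =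
    lin 8 (λ c x y E F D A L → c ⊕ E ≐ x ⊕ L ∷ c ⊕ F ≐ y ⊕ L ∷ E ≼ F ∷ D ≐ ⊝ (x ⊖ y) ∷ A ≼ D ∷ [] ⊢ E ⊕ A ≼ F)
      p q E≤F r A≤D
  forward-distance (inj₁ p) (inj₂ q) E≤F x-y≤D _ _ _ A≤L-D =
    lin 8 (λ c x y E F D A L → c ⊕ E ≐ x ∷ c ⊕ F ≐ y ⊕ L ∷ x ⊖ y ≼ D ∷ A ≼ L ⊖ D ∷ [] ⊢ E ⊕ A ≼ F)
      p q x-y≤D A≤L-D
  forward-distance (inj₂ p) (inj₁ q) E≤F _ y-x≤D _ _ A≤L-D =
    lin 8 (λ c x y E F D A L → c ⊕ E ≐ x ⊕ L ∷ c ⊕ F ≐ y ∷ E ≼ F ∷ y ⊖ x ≼ D ∷ A ≼ L ⊖ D ∷ [] ⊢ E ⊕ A ≼ F)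
      p q E≤F y-x≤D A≤L-D

  -- Points are labelled by whether a shortest arc from `c` to them runs forward. If not, one runs
  -- backward, and negating the coordinates makes it run forward.
  circle-sides : ∀ {r} → Pos r → ∀ L (φ : Pt → Loop.Point L) →
    (∀ x y → Loop.arcDist L (φ x) (φ y) ≈ r * d x y) → HasSides
  circle-sides {r} 0<r L φ scales = sides-from (λ c x → Forward L (θ c) (θ x) (A c x))
    (λ c x y p q → compare p q)
    (λ c x y p q → compareBack (backward p) (backward q))
    where
    open Inverse 0<r using (*-cancelˡ-≤)
    θ : Pt → ℝ
    θ x = proj₁ (φ x)
    A D : Pt → Pt → ℝ
    A x y = Loop.arcDist L (φ x) (φ y)
    D x y = dist (θ x) (θ y)

    between : ∀ {c x y} → A c x + A x y ≤ A c y → Between c x y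
    between {c} {x} {y} p = *-cancelˡ-≤ (≤-respʳ (scales c y)
      (≤-respˡ (≈-trans (+-cong (scales c x) (scales x y)) (≈-sym (distribˡ r _ _))) p))

    x-y≤D : ∀ x y → θ x + - θ y ≤ D x y
    x-y≤D x y = x≤∣x∣ _
    y-x≤D : ∀ x y → θ y + - θ x ≤ D x y
    y-x≤D x y = ≤-respˡ (neg-sub _ _) (-x≤∣x∣ _)

    nearer : ∀ {c x y} → Forward L (θ c) (θ x) (A c x) → Forward L (θ c) (θ y) (A c y) →
             A c x ≤ A c y → Between c x y
    nearer {c} {x} {y} p q le = between (forward-distance p q le (x-y≤D x y) (y-x≤D x y)
      (⊔-sel _ _) (x⊓y≤x _ _) (x⊓y≤y _ _))

    compare : ∀ {c x y} → Forward L (θ c) (θ x) (A c x) → Forward L (θ c) (θ y) (A c y) → SameSide c x y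
    compare p q = Sum.map (nearer p q) (nearer q p) (total _ _)

    Back : Pt → Pt → Set
    Back c x = Forward L (- θ c) (- θ x) (A c x)

    backward : ∀ {c x} → ¬ Forward L (θ c) (θ x) (A c x) → Back c x
    backward {c} {x} ¬p = cases (⊓-sel (D c x) (L + - D c x)) (⊔-sel (θ c + - θ x) (- (θ c + - θ x)))
      where
      cases : A c x ≈ D c x ⊎ A c x ≈ L + - D c x →
              D c x ≈ θ c + - θ x ⊎ D c x ≈ - (θ c + - θ x) → Back c x
      cases (inj₁ p) (inj₁ q) = inj₁
        (lin 4 (λ c x A D → A ≐ D ∷ D ≐ c ⊖ x ∷ [] ⊢ ⊝ c ⊕ A ≐ ⊝ x) p q)
      cases (inj₁ p) (inj₂ q) = contradiction (inj₁
        (lin 4 (λ c x A D → A ≐ D ∷ D ≐ ⊝ (c ⊖ x) ∷ [] ⊢ c ⊕ A ≐ x) p q)) ¬p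
      cases (inj₂ p) (inj₁ q) = contradiction (inj₂
        (lin 5 (λ c x A D L → A ≐ L ⊖ D ∷ D ≐ c ⊖ x ∷ [] ⊢ c ⊕ A ≐ x ⊕ L) p q)) ¬p
      cases (inj₂ p) (inj₂ q) = inj₂
        (lin 5 (λ c x A D L → A ≐ L ⊖ D ∷ D ≐ ⊝ (c ⊖ x) ∷ [] ⊢ ⊝ c ⊕ A ≐ ⊝ x ⊕ L) p q)

    nearerBack : ∀ {c x y} → Back c x → Back c y → A c x ≤ A c y → Between c x y
    nearerBack {c} {x} {y} p q le = between (forward-distance p q le
      (lin 3 (λ x y D → y ⊖ x ≼ D ∷ [] ⊢ ⊝ x ⊖ (⊝ y) ≼ D) (y-x≤D x y))
      (lin 3 (λ x y D → x ⊖ y ≼ D ∷ [] ⊢ ⊝ y ⊖ (⊝ x) ≼ D) (x-y≤D x y))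
      (Sum.swap (Sum.map
        (lin 3 (λ x y D → D ≐ x ⊖ y ∷ [] ⊢ D ≐ ⊝ (⊝ x ⊖ (⊝ y))))
        (lin 3 (λ x y D → D ≐ ⊝ (x ⊖ y) ∷ [] ⊢ D ≐ ⊝ x ⊖ (⊝ y)))
        (⊔-sel _ _)))
      (x⊓y≤x _ _) (x⊓y≤y _ _))

    compareBack : ∀ {c x y} → Back c x → Back c y → SameSide c x y
    compareBack p q = Sum.map (nearerBack p q) (nearerBack q p) (total _ _)

  circleOrInterval⇒sides : CircleOrInterval → HasSides
  circleOrInterval⇒sides (inj₁ (r , 0<r , f , scales)) =
    circle-sides (<⇒≱ 0<r) (π + π) (Bijection.to f) scales
  circleOrInterval⇒sides (inj₂ (I , _ , f , scales)) =
    line-sides (λ x → proj₁ (Bijection.to f x)) (λ x y → ≈-trans (scales x y) (*-identityˡ _))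

  module _ (sides : HasSides) where

    -- Of three points at the same distance `t` from the centre, one on each leg, two share a side
    -- and therefore coincide; but distinct legs meet only in the centre.
    noTripod : ¬ HasTripod X
    noTripod (Y , tripod) = contradiction-at (pos-⊓ (0<D 0F) (0<D 1F))
      where
      open IsTripod tripod hiding (module Leg) renaming (x to end; y to centre)
      open module Leg i = Geodesic (leg i) using (γ; distancePreserving) renaming (end to γ-end)

      D : Fin 3 → ℝ
      D i = d (end i) centre

      0<D : ∀ i → Pos (D i)
      0<D i = ≉⇒pos (x≉y i)

      module At {t} (0<t : Pos t) (t≤D : ∀ i → t ≤ D i) where

        parameter : ∀ i → MetricSpace.Carrier (Geodesic.Domain (leg i))
        -- The leg runs towards the centre, so distance `t` from the centre is counted from its end.
        parameter i = D i + - t , x≤y⇒0≤y-x (t≤D i) ,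
          lin 2 (λ D t → 𝟘 ≼ t ∷ [] ⊢ D ⊖ t ≼ D) (≰⇒≥ 0<t)

        z : Fin 3 → Pt
        z i = γ i (parameter i)

        from-centre : ∀ i → d centre (z i) ≈ t
        from-centre i = ≈-trans (d-congˡ (≋-sym (γ-end i)))
          (≈-trans (distancePreserving i _ (parameter i))
            (≈-trans (dist-≥ (proj₂ (proj₂ (parameter i))))
              (lin 2 (λ D t → [] ⊢ D ⊖ (D ⊖ t) ≐ t))))

        coincide : ∀ {i j} → SameSide centre (z i) (z j) → z i ≋ z j
        coincide {i} {j} (inj₁ b) = d≤0⇒≋ (lin 4 (λ ci cj ij t →
          ci ⊕ ij ≼ cj ∷ ci ≐ t ∷ cj ≐ t ∷ [] ⊢ ij ≼ 𝟘) b (from-centre i) (from-centre j))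
        coincide {i} {j} (inj₂ b) = ≋-sym (d≤0⇒≋ (lin 4 (λ ci cj ij t →
          ci ⊕ ij ≼ cj ∷ ci ≐ t ∷ cj ≐ t ∷ [] ⊢ ij ≼ 𝟘) b (from-centre j) (from-centre i)))

        absurd : ⊥
        absurd with two-agree (λ i → proj₁ (sides centre) (z i))
        ... | i , j , i≢j , agree = 0<t (≤-respˡ (from-centre i) (≋⇒d≤0 (≋-sym zi≋centre)))
          where
          zj≋zi : z j ≋ z i
          zj≋zi = ≋-sym (coincide (proj₂ (sides centre) _ _ agree))
          zi≋centre : z i ≋ centre
          zi≋centre = Equivalence.to (meet i≢j (z i)) ((parameter i , ≋-refl) , (parameter j , zj≋zi))

      contradiction-at : ∃[ s ] Pos s × s ≤ D 0F × s ≤ D 1F → ⊥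
      contradiction-at (s , 0<s , s≤D₀ , s≤D₁) =
        let t , 0<t , t≤s , t≤D₂ = pos-⊓ 0<s (0<D 2F)
        in At.absurd 0<t λ { 0F → ≤-trans t≤s s≤D₀ ; 1F → ≤-trans t≤s s≤D₁ ; 2F → t≤D₂ }

    same-near : ∀ {c x y δ} → SameSide c x y → d c x ≤ δ → d c y ≤ δ → d x y ≤ δ
    same-near {c} {x} {y} (inj₁ b) _ cy≤ =
      lin 4 (λ cx xy cy δ → cx ⊕ xy ≼ cy ∷ cy ≼ δ ∷ 𝟘 ≼ cx ∷ [] ⊢ xy ≼ δ) b cy≤ (d≥0 c x)
    same-near {c} {x} {y} (inj₂ b) cx≤ _ =
      lin 5 (λ cx xy yx cy δ → cy ⊕ yx ≼ cx ∷ cx ≼ δ ∷ 𝟘 ≼ cy ∷ xy ≐ yx ∷ [] ⊢ xy ≼ δ)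
        b cx≤ (d≥0 c y) (d-sym x y)

    -- Two of the three leaves share a side of the centre, which puts them within δ of each other.
    noClaw : ∀ {c δ} (x : Fin 3 → Pt) → (∀ i → d c (x i) ≤ δ) → (∀ {i j} → i ≢ j → d (x i) (x j) ≰ δ) → ⊥
    noClaw {c} x near far with two-agree (λ i → proj₁ (sides c) (x i))
    ... | i , j , i≢j , agree = far i≢j (same-near (proj₂ (sides c) _ _ agree) (near i) (near j))

    -- At each triangle vertex the pendant has a side to itself, so the other
    -- two vertices share a side.
    noNet : ∀ {δ} (x p : Fin 3 → Pt) → (∀ i j → i ≢ j → d (x i) (x j) ≤ δ) → (∀ i → d (x i) (p i) ≤ δ) →
      (∀ i j → i ≢ j → d (p i) (x j) ≰ δ) → ⊥
    noNet {δ} x p triangle pendant far =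
      cases (same 0F 1F 2F (λ ()) (λ ())) (same 1F 2F 0F (λ ()) (λ ())) (same 2F 0F 1F (λ ()) (λ ()))
      where
      same : ∀ i j k → i ≢ j → i ≢ k → SameSide (x i) (x j) (x k)
      same i j k i≢j i≢k = proj₂ (sides (x i)) _ _
        (third-agrees {proj₁ (sides (x i)) (p i)} (alone i≢j) (alone i≢k))
        where
        alone : ∀ {j} → i ≢ j → proj₁ (sides (x i)) (p i) ≢ proj₁ (sides (x i)) (x j)
        alone i≢j agree = far i _ i≢j
          (same-near (proj₂ (sides (x i)) _ _ agree) (pendant i) (triangle i _ i≢j))

      -- If two vertices of the triangle coincided, the pendant of one would be within δ of the
      -- other.
      distinct : ∀ {i j} → i ≢ j → Pos (d (x i) (x j))
      distinct {i} {j} i≢j ij≤0 = far i j i≢j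
        (lin 5 (λ pj xp px xx δ → pj ≼ px ⊕ xx ∷ xx ≼ 𝟘 ∷ px ≐ xp ∷ xp ≼ δ ∷ [] ⊢ pj ≼ δ)
          (△ (p i) (x i) (x j)) ij≤0 (d-sym (p i) (x i)) (pendant i))

      degenerate : ∀ {i j k} → i ≢ j → Between (x k) (x i) (x j) → Between (x k) (x j) (x i) → ⊥
      degenerate {i} {j} i≢j b b′ = distinct i≢j
        (lin 4 (λ ki kj ij ji → ki ⊕ ij ≼ kj ∷ kj ⊕ ji ≼ ki ∷ ij ≐ ji ∷ [] ⊢ ij ≼ 𝟘)
          b b′ (d-sym (x i) (x j)))

      flip : ∀ {i j k} → Between (x i) (x j) (x k) → Between (x k) (x j) (x i)
      flip {i} {j} {k} =
        lin 6 (λ ij jk ik kj ji ki → ij ≐ ji ∷ jk ≐ kj ∷ ik ≐ ki ∷ ij ⊕ jk ≼ ik ∷ [] ⊢ kj ⊕ ji ≼ ki)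
          (d-sym (x i) (x j)) (d-sym (x j) (x k)) (d-sym (x i) (x k))

      -- Seen from each vertex, one of the other two lies in the middle of the triple. Hence two
      -- different vertices are both in the middle, and they coincide.
      cases : SameSide (x 0F) (x 1F) (x 2F) → SameSide (x 1F) (x 2F) (x 0F) →
              SameSide (x 2F) (x 0F) (x 1F) → ⊥
      cases (inj₁ b012) (inj₁ b120) _ = degenerate {1F} {2F} {0F} (λ ()) b012 (flip {1F} {2F} {0F} b120)
      cases (inj₁ b012) (inj₂ b102) _ =
        degenerate {0F} {1F} {2F} (λ ()) (flip {1F} {0F} {2F} b102) (flip {0F} {1F} {2F} b012)
      cases (inj₂ b021) _ (inj₁ b201) =
        degenerate {0F} {2F} {1F} (λ ()) (flip {2F} {0F} {1F} b201) (flip {0F} {2F} {1F} b021)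
      cases (inj₂ b021) _ (inj₂ b210) = degenerate {1F} {2F} {0F} (λ ()) (flip {2F} {1F} {0F} b210) b021

    clawNetFree : AllClawNetFree
    clawNetFree G (δ , 0<δ , ρ , adjacent) = claw-free , net-free
      where
      module Copy {n} {es : List (Fin n × Fin n)} {s : Symmetric (Covers es)}
        {i : Irreflexive _≡_ (Covers es)}
        (copy : InducedCopy (edgeGraph es s i) G) where
        open InducedCopy copy

        at : Fin n → Pt
        at u = ρ (embed u)

        close : ∀ u v {_ : False (u Fin.≟ v)} {_ : True (covers? es u v)} → d (at u) (at v) ≤ δ
        close u v {u≢v} {e} = Equivalence.to (adjacent (toWitnessFalse u≢v ∘ injective))
          (Equivalence.to (induced u v) (toWitness e))

        far : ∀ u v {_ : False (u Fin.≟ v)} {_ : False (covers? es u v)} → d (at u) (at v) ≰ δ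
        far u v {u≢v} {e} p = toWitnessFalse e (Equivalence.from (induced u v)
          (Equivalence.from (adjacent (toWitnessFalse u≢v ∘ injective)) p))

      claw-free : ¬ InducedCopy claw G
      claw-free copy = noClaw (at ∘ suc) (λ { 0F → close 0F 1F ; 1F → close 0F 2F ; 2F → close 0F 3F }) apart
        where
        open Copy copy
        apart : ∀ {i j} → i ≢ j → d (at (suc i)) (at (suc j)) ≰ δ
        apart {0F} {0F} i≢j = contradiction refl i≢j
        apart {0F} {1F} _   = far 1F 2F
        apart {0F} {2F} _   = far 1F 3F
        apart {1F} {0F} _   = far 2F 1F
        apart {1F} {1F} i≢j = contradiction refl i≢j
        apart {1F} {2F} _   = far 2F 3F
        apart {2F} {0F} _   = far 3F 1F
        apart {2F} {1F} _   = far 3F 2F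
        apart {2F} {2F} i≢j = contradiction refl i≢j

      net-free : ¬ InducedCopy net G
      net-free copy = noNet x p triangle pendant apart
        where
        open Copy copy
        x p : Fin 3 → Pt
        x = λ { 0F → at 0F ; 1F → at 1F ; 2F → at 2F }
        p = λ { 0F → at 3F ; 1F → at 4F ; 2F → at 5F }
        triangle : ∀ i j → i ≢ j → d (x i) (x j) ≤ δ
        triangle 0F 0F i≢j = contradiction refl i≢j
        triangle 0F 1F _   = close 0F 1F
        triangle 0F 2F _   = close 0F 2F
        triangle 1F 0F _   = close 1F 0F
        triangle 1F 1F i≢j = contradiction refl i≢j
        triangle 1F 2F _   = close 1F 2F
        triangle 2F 0F _   = close 2F 0F
        triangle 2F 1F _   = close 2F 1F
        triangle 2F 2F i≢j = contradiction refl i≢j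
        pendant : ∀ i → d (x i) (p i) ≤ δ
        pendant 0F = close 0F 3F
        pendant 1F = close 1F 4F
        pendant 2F = close 2F 5F
        apart : ∀ i j → i ≢ j → d (p i) (x j) ≰ δ
        apart 0F 0F i≢j = contradiction refl i≢j
        apart 0F 1F _   = far 3F 1F
        apart 0F 2F _   = far 3F 2F
        apart 1F 0F _   = far 4F 0F
        apart 1F 1F i≢j = contradiction refl i≢j
        apart 1F 2F _   = far 4F 2F
        apart 2F 0F _   = far 5F 0F
        apart 2F 1F _   = far 5F 1F
        apart 2F 2F i≢j = contradiction refl i≢j

theorem1p11 : (∀ ℓ → ExcludedMiddle ℓ) →
    (R : Reals) → let open Geometry R in
    ∀ {a ℓ} (X : MetricSpace a ℓ) → IsGeodesicSpace X →
    ((∀ G → IsUnitBallGraph X G → ClawNetFree G) ⇔ (¬ HasTripod X)) ×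
    ((¬ HasTripod X) ⇔ (Similar X S¹ ⊎ (∃[ I ] Interval I × Isometric X ⟦ I ⟧)))
theorem1p11 em R X geodesic =
  -- Conditions (1) and (2) are linked through (3): either of them excludes forks and so yields the
  -- classification, while intervals and circles have sides, which exclude tripods, claws and nets.
  mk⇔ (λ free → noTripod (circleOrInterval⇒sides (classified (λ F → ForkGraph.noFork F free))))
      (λ noTrip → clawNetFree (circleOrInterval⇒sides (classified (noTrip ∘ Fork.hasTripod)))) ,
  mk⇔ (λ noTrip → classified (noTrip ∘ Fork.hasTripod))
      (noTripod ∘ circleOrInterval⇒sides)
  where
  open MetricProperties em R X using (Fork; module Fork; CircleOrInterval)
  open BallGraphs em R X using (module ForkGraph)
  open Sides em R X
  classified : ¬ Fork → CircleOrInterval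
  classified noFork = Classification.classify em R X geodesic
    (ForkFree.noFork⇒separated em R X geodesic noFork)
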